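{- Run the Local Search algorithm below with $\alpha=8/11$ and any integer $N_{\max}\ge 9$ on an instance $(C_n,S)$ of cycle VCA, and let $(Q,F)$ be its output. Then $Q\cup F$ is feasible and $|Q\cup F|\le \frac{233}{121}|\mathrm{OPT}|$, where $\mathrm{OPT}$ is a minimum-size feasible set.
   Context: Let $n\ge 4$ and let $C_n$ be the cycle on $[n]$ with edges $\{i,i+1\}$ and $\{n,1\}$. A chord is an edge between two non-consecutive vertices of $C_n$. Chords $ab$, $cd$ with $a<b$, $c<d$ cross if $a,b,c,d$ are distinct and $c<a<d<b$ or $a<c<b<d$. An instance of cycle VCA is a pair $(C_n,S)$, $S$ a set of chords (links) with $C_n\cup S$ 3-vertex-connected; $S'\subseteq S$ is feasible if $C_n\cup S'$ is 3-vertex-connected, and the goal is a feasible set of minimum size. For a set $L$ of chords, $V(L)$ is the set of vertices incident to a chord of $L$, and the circle graph of $L$ has vertex set $L$ with two chords adjacent iff they cross. For $F\subseteq S$, a set $Q\subseteq S$ is a completion of $F$ if $F\cup Q$ is feasible, and a minimal completion if it is inclusion-minimal with this property. A set $F\subseteq S$ is singleton-free if its circle graph has no isolated vertex; then let $\mathcal{L}(F)$ be the family of (link sets of) connected components of its circle graph, and define the utility $U(F)=-|F|+\sum_{J\in\mathcal{L}(F)}(|V(J)|-3)$. For $\alpha\in(1/2,1]$ and $N_{\max}\in\mathbb{N}$, a singleton-free $F\subseteq S$ is $(\alpha,N_{\max})$-critical if there is no $K\subseteq S\setminus F$ with $|K|\le N_{\max}$ such that $F\cup K$ is singleton-free and $U(F\cup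 K)-U(F)\ge(1-\alpha)|V(F\cup K)\setminus V(F)|$. Local Search algorithm with parameters $\alpha,N_{\max}$: set $F\leftarrow\emptyset$; while $F$ is not $(\alpha,N_{\max})$-critical, choose any $K\subseteq S\setminus F$ with $|K|\le N_{\max}$, $F\cup K$ singleton-free and $U(F\cup K)-U(F)\ge(1-\alpha)|V(F\cup K)\setminus V(F)|$, and set $F\leftarrow F\cup K$; then compute a minimal completion $Q$ of $F$ and return $(Q,F)$.
   Formalization: The improving set K, in the definition of criticality and in each step of the algorithm, is required to be nonempty; with K = ∅ allowed the inequality 0 ≥ 0 always holds, so no F would be critical and the algorithm would never return an output. -}

module Defs where

open import Data.Nat as ℕ using (ℕ; zero; suc; _<_; _≤_; _<?_; _≟_)
open import Data.Integer as ℤ using (ℤ; +_)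
open import Data.Rational as ℚ using (ℚ; _/_)
open import Data.Bool using (Bool; true; false; not)
open import Data.Product using (_×_; _,_; Σ; ∃)
open import Data.Product.Properties using (≡-dec)
open import Data.Sum using (_⊎_)
open import Data.Empty using (⊥)
open import Data.List using (List; []; _∷_; _++_; length; filter; deduplicate; concatMap; any; map; foldr)
open import Data.List.Relation.Unary.All using (All)
open import Data.List.Relation.Unary.Any using (Any)
open import Relation.Nullary using (¬_; Dec; yes; no)
open import Relation.Nullary.Decidable using (⌊_⌋; _×-dec_; _⊎-dec_; ¬?)
open import Relation.Binary.PropositionalEquality using (_≡_)
open import Relation.Binary.Definitions using (DecidableEquality)

-- A chord ab of C_n is stored as the pair (a , b) with a < b.
Chord : Set
Chord = ℕ × ℕ

_≟ᶜ_ : DecidableEquality Chord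
_≟ᶜ_ = ≡-dec _≟_ _≟_

open import Data.List.Membership.DecPropositional _≟ᶜ_ public
  using (_∈_; _∉_; _∈?_)
import Data.List.Membership.DecPropositional _≟_ as ℕMem

-- Finite sets of chords are represented by lists; all notions below only
-- depend on the underlying set (membership), sizes are counted without
-- repetition.
∣_∣ : List Chord → ℕ
∣ X ∣ = length (deduplicate _≟ᶜ_ X)

_⊆_ : List Chord → List Chord → Set
X ⊆ Y = All (λ x → x ∈ Y) X

_∖_ : List Chord → List Chord → List Chord
X ∖ Y = filter (λ x → ¬? (x ∈? Y)) X

InRange : ℕ → ℕ → Set
InRange n v = 1 ≤ v × v ≤ n

IsChord : ℕ → Chord → Set
IsChord n (a , b) =
  1 ≤ a × a < b × b ≤ n × ¬ (b ≡ suc a) × ¬ (a ≡ 1 × b ≡ n)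

CycleEdge : ℕ → ℕ → ℕ → Set
CycleEdge n u v = (1 ≤ u × v ≡ suc u × v ≤ n) ⊎ (u ≡ 1 × v ≡ n)

Adj : ℕ → List Chord → ℕ → ℕ → Set
Adj n L u v = CycleEdge n u v ⊎ CycleEdge n v u ⊎ (u , v) ∈ L ⊎ (v , u) ∈ L

-- u and v are joined by a path in (C_n ∪ L) − X  (assuming u ∉ X)
data Reach (n : ℕ) (L : List Chord) (X : List ℕ) : ℕ → ℕ → Set where
  here : ∀ {u} → Reach n L X u u
  step : ∀ {u w v} → Adj n L u w → InRange n w → ¬ (ℕMem._∈_ w X) →
         Reach n L X w v → Reach n L X u v

ThreeConnected : ℕ → List Chord → Set
ThreeConnected n L =
  3 < n ×
  ((X : List ℕ) → length X ≤ 2 → All (InRange n) X →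
   (u v : ℕ) → InRange n u → InRange n v →
   ¬ (ℕMem._∈_ u X) → ¬ (ℕMem._∈_ v X) → Reach n L X u v)

Feasible : ℕ → List Chord → Set
Feasible n S' = ThreeConnected n S'

IsInstance : ℕ → List Chord → Set
IsInstance n S = All (IsChord n) S × Feasible n S

Distinct4 : ℕ → ℕ → ℕ → ℕ → Set
Distinct4 a b c d =
  ¬ a ≡ b × ¬ a ≡ c × ¬ a ≡ d × ¬ b ≡ c × ¬ b ≡ d × ¬ c ≡ d

Cross : Chord → Chord → Set
Cross (a , b) (c , d) =
  Distinct4 a b c d × ((c < a × a < d × d < b) ⊎ (a < c × c < b × b < d))

cross? : (x y : Chord) → Dec (Cross x y)
cross? (a , b) (c , d) =
  (¬? (a ≟ b) ×-dec ¬? (a ≟ c) ×-dec ¬? (a ≟ d) ×-dec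
   ¬? (b ≟ c) ×-dec ¬? (b ≟ d) ×-dec ¬? (c ≟ d))
  ×-dec
  ((c <? a ×-dec a <? d ×-dec d <? b) ⊎-dec (a <? c ×-dec c <? b ×-dec b <? d))

grow : List Chord → List Chord → List Chord
grow F C = C ++ filter (λ d → Data.List.Relation.Unary.Any.any? (λ c → cross? c d) C) F
  where import Data.List.Relation.Unary.Any

iter : ℕ → (List Chord → List Chord) → List Chord → List Chord
iter zero    f C = C
iter (suc k) f C = iter k f (f C)

-- the connected component of (the chord) c in the circle graph of F
-- (for c ∈ F): all chords reachable from c by a path of crossings in F;
-- paths of length ≤ |F| suffice.
component : List Chord → Chord → List Chord
component F c = deduplicate _≟ᶜ_ (iter (length F) (grow F) (c ∷ []))

components′ : List Chord → ℕ → List Chord → List (List Chord)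
components′ F zero    _          = []
components′ F (suc k) []         = []
components′ F (suc k) (c ∷ rest) =
  component F c ∷ components′ F k (rest ∖ component F c)

𝓛 : List Chord → List (List Chord)
𝓛 F = components′ F (length F) F

V : List Chord → List ℕ
V L = deduplicate _≟_ (concatMap (λ { (a , b) → a ∷ b ∷ [] }) L)

∣V∣ : List Chord → ℕ
∣V∣ L = length (V L)

newVertices : List Chord → List Chord → ℕ
newVertices F K = length (filter (λ v → ¬? (v ℕMem.∈? V F)) (V (F ++ K)))

SingletonFree : List Chord → Set
SingletonFree F = All (λ c → Any (λ d → Cross c d) F) F

U : List Chord → ℤ
U F = ℤ.- (+ ∣ F ∣) ℤ.+ foldr (λ J s → ((+ ∣V∣ J) ℤ.- + 3) ℤ.+ s) (+ 0) (𝓛 F)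

ℤtoℚ : ℤ → ℚ
ℤtoℚ z = z / 1

ℕtoℚ : ℕ → ℚ
ℕtoℚ m = + m / 1

Improving : List Chord → ℚ → ℕ → List Chord → List Chord → Set
Improving S α Nmax F K =
  ¬ K ≡ [] ×
  All (λ k → k ∈ S × k ∉ F) K ×
  ∣ K ∣ ≤ Nmax ×
  SingletonFree (F ++ K) ×
  (ℚ._≥_ (ℤtoℚ (U (F ++ K) ℤ.- U F))
         (ℚ._*_ (ℚ._-_ ℚ.1ℚ α) (ℕtoℚ (newVertices F K))))

Critical : List Chord → ℚ → ℕ → List Chord → Set
Critical S α Nmax F =
  F ⊆ S × SingletonFree F × ((K : List Chord) → ¬ Improving S α Nmax F K)

-- the sets F that the while-loop of Local Search can reach from ∅
data Reachable (S : List Chord) (α : ℚ) (Nmax : ℕ) : List Chord → Set where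
  start : Reachable S α Nmax []
  step  : ∀ {F K} → Reachable S α Nmax F → Improving S α Nmax F K →
          Reachable S α Nmax (F ++ K)

Completion : ℕ → List Chord → List Chord → List Chord → Set
Completion n S F Q = Q ⊆ S × Feasible n (F ++ Q)

MinimalCompletion : ℕ → List Chord → List Chord → List Chord → Set
MinimalCompletion n S F Q =
  Completion n S F Q ×
  ((Q′ : List Chord) → Q′ ⊆ Q → Completion n S F Q′ → Q ⊆ Q′)

LocalSearchOutput : ℕ → List Chord → ℚ → ℕ → List Chord → List Chord → Set
LocalSearchOutput n S α Nmax Q F =
  Reachable S α Nmax F × Critical S α Nmax F × MinimalCompletion n S F Q

IsOPT : ℕ → List Chord → List Chord → Set
IsOPT n S OPT =
  OPT ⊆ S × Feasible n OPT ×
  ((S′ : List Chord) → S′ ⊆ S → Feasible n S′ → ∣ OPT ∣ ≤ ∣ S′ ∣)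

{-# OPTIONS --safe #-}

-- Write ρ(A) = Σ (|V(J)| − 3) over the components J of the circle graph of A, so U(F) = ρ(F) − |F|.
-- Call a vertex of J interior if it is neither the smallest nor the largest vertex of J.  Components of
-- a singleton-free set have pairwise disjoint sets of interior vertices; hence merging components never
-- decreases ρ, and ρ ≤ n − 3.
--
-- Upper bound.  While C_n ∪ A is not 3-connected, a gap of a component J of A is bridged by a chord that
-- crosses J and ends outside V(J); adding it raises ρ.  So a minimal completion Q of F ≠ ∅ satisfies
-- |Q ∪ F| ≤ n − 3 − U(F), and U(F) ≥ 3/11 |V(F)| by the acceptance test of the search.
--
-- Lower bound.  Give weight 88 to the vertices of V(F) and 121 to the others, and take a tree of crossing
-- chords of OPT that covers all vertices.  Criticality of F implies that a subtree with 7 to 12 nodes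
-- adds at most 233 per node to the weight covered by its root: otherwise 7 of its chords form an
-- improving set.  Peeling off such subtrees gives 121 n ≤ 33 |V(F)| + 233 |OPT| + 54, which combines with
-- the upper bound to 121 |Q ∪ F| ≤ 233 |OPT|.
module Submission where

open import Defs
open import Data.Nat using (ℕ; zero; suc; _+_; _*_; _∸_; _≤_; _<_; z≤n; s≤s; _≟_; _<?_; _≤?_)
open import Data.Nat.Properties
open import Data.Nat.Tactic.RingSolver using (solve-∀)
open import Data.Integer as ℤ using (ℤ)
open import Data.Integer.Tactic.RingSolver using () renaming (solve-∀ to ℤ-solve-∀)
import Data.Integer.Properties as ℤP
open import Data.Rational as ℚ using (ℚ; _/_)
import Data.Rational.Properties as ℚP
import Data.Rational.Unnormalised as ℚᵘ
import Data.Rational.Unnormalised.Properties as ℚᵘP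
open import Data.Bool using (Bool; true; false; not)
open import Data.Product using (_×_; _,_; Σ; ∃; proj₁; proj₂; ∃₂)
open import Data.Sum using (_⊎_; inj₁; inj₂; [_,_]′)
open import Data.Empty using (⊥; ⊥-elim)
open import Data.List using (List; []; _∷_; [_]; _++_; length; filter; deduplicate; concatMap; concat; foldr)
open import Data.List.Properties using (length-++; length-filter)
open import Data.List.Relation.Unary.All as All using (All; []; _∷_)
open import Data.List.Relation.Unary.Any as Any using (Any; here; there)
open import Data.List.Relation.Unary.AllPairs using (AllPairs; []; _∷_)
import Data.List.Relation.Unary.AllPairs.Properties as AllPairsP
open import Data.List.Relation.Unary.Unique.Propositional using (Unique)
import Data.List.Relation.Unary.Unique.Propositional.Properties as UniqueP
import Data.List.Relation.Unary.Unique.DecPropositional.Properties as DecUniqueP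
open import Data.List.Membership.Propositional using (find; lose) renaming (_∈_ to _∈ₗ_)
open import Data.List.Membership.Propositional.Properties
open import Data.List.Membership.DecPropositional _≟_ using () renaming (_∈?_ to _∈ℕ?_)
open import Data.List.Relation.Binary.Subset.Propositional using () renaming (_⊆_ to _⊑_)
open import Relation.Nullary using (¬_; Dec; yes; no; contradiction)
open import Relation.Nullary.Decidable using (does; _×-dec_; _⊎-dec_; ¬?; dec-true; decidable-stable)
open import Relation.Binary.PropositionalEquality using (_≡_; _≢_; refl; sym; trans; cong; cong₂; subst; subst₂)
open import Function using (_∘_; id)
open import Relation.Binary.Definitions using (tri<; tri≈; tri>)

-- Sums and counts over the vertices 1, …, n

-- Since |V(J)| - 3 is the number of interior vertices minus one, a chord that crosses ℓ ≥ 1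
-- components raises ρ by at least ℓ - 1 plus the number of vertices it brings in. Hence a tree of
-- chords that touches F raises ρ by at least its number m of new vertices, whereas a tree apart
-- from F pays the 3 once. For seven chords the acceptance test follows from 11m - 77 ≥ 3m, true
-- from m = 10 on, or, for a tree with 14 vertices apart from F, from 121 - 77 ≥ 42 ≥ 3m. Seven is
-- the least number of chords with distinct ends for which the second estimate works. Two remainders
-- with at most six nodes each join to at most 12 nodes. In that extreme case the 11 nodes below the
-- root carry at most 1353 + 5 · 242 = 11 · 233, where 1353 belongs to seven of the nodes including
-- the root and 242 = 2 · 121 is the trivial bound per chord: this is the origin of 233. The weight
-- 88 = 121 - 33 leaves a deficit of 33 |V(F)|, which is exactly what 121 U(F) ≥ 33 |V(F)| pays for.

∑ : ℕ → (ℕ → ℕ) → ℕ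
∑ zero    f = 0
∑ (suc n) f = f (suc n) + ∑ n f

ind : {P : Set} → Dec P → ℕ
ind (yes _) = 1
ind (no _)  = 0

ind≤1 : {P : Set} (d : Dec P) → ind d ≤ 1
ind≤1 (yes _) = ≤-refl
ind≤1 (no _)  = z≤n

ind-yes : {P : Set} (d : Dec P) → P → ind d ≡ 1
ind-yes (yes _) p = refl
ind-yes (no ¬p) p = contradiction p ¬p

ind-no : {P : Set} (d : Dec P) → ¬ P → ind d ≡ 0
ind-no (yes p) ¬p = contradiction p ¬p
ind-no (no _)  ¬p = refl

ind-mono : {P Q : Set} (d : Dec P) (e : Dec Q) → (P → Q) → ind d ≤ ind e
ind-mono (yes p) e f = ≤-reflexive (sym (ind-yes e (f p)))
ind-mono (no _)  e f = z≤n

ind-⊎ : {P Q R : Set} (d : Dec P) (e : Dec Q) (f : Dec R) →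
        (R → P ⊎ Q) → (P → R) → (Q → R) → (P → ¬ Q) → ind d + ind e ≡ ind f
ind-⊎ (yes p) (yes q) f split inl inr dis = contradiction q (dis p)
ind-⊎ (yes p) (no _)  f split inl inr dis = sym (ind-yes f (inl p))
ind-⊎ (no _)  (yes q) f split inl inr dis = sym (ind-yes f (inr q))
ind-⊎ (no ¬p) (no ¬q) f split inl inr dis = sym (ind-no f ([ ¬p , ¬q ]′ ∘ split))

∑-mono : ∀ n {f g} → (∀ v → InRange n v → f v ≤ g v) → ∑ n f ≤ ∑ n g
∑-mono zero    h = z≤n
∑-mono (suc n) h =
  +-mono-≤ (h (suc n) (s≤s z≤n , ≤-refl)) (∑-mono n λ v (p , q) → h v (p , m≤n⇒m≤1+n q))

∑-cong : ∀ n {f g} → (∀ v → InRange n v → f v ≡ g v) → ∑ n f ≡ ∑ n g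
∑-cong n h = ≤-antisym (∑-mono n λ v r → ≤-reflexive (h v r)) (∑-mono n λ v r → ≤-reflexive (sym (h v r)))

∑-+ : ∀ n f g → ∑ n (λ v → f v + g v) ≡ ∑ n f + ∑ n g
∑-+ zero    f g = refl
∑-+ (suc n) f g rewrite ∑-+ n f g = lemma (f (suc n)) (g (suc n)) (∑ n f) (∑ n g)
  where
  lemma : ∀ a b c d → a + b + (c + d) ≡ a + c + (b + d)
  lemma = solve-∀

∑-* : ∀ n c f → ∑ n (λ v → c * f v) ≡ c * ∑ n f
∑-* zero    c f = sym (*-zeroʳ c)
∑-* (suc n) c f rewrite ∑-* n c f = sym (*-distribˡ-+ c (f (suc n)) (∑ n f))

∑-1 : ∀ n → ∑ n (λ _ → 1) ≡ n
∑-1 zero    = refl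
∑-1 (suc n) = cong suc (∑-1 n)

∑-0 : ∀ n → ∑ n (λ _ → 0) ≡ 0
∑-0 zero    = refl
∑-0 (suc n) = ∑-0 n

∑-≟ : ∀ n {m} → InRange n m → ∑ n (λ v → ind (v ≟ m)) ≡ 1
∑-≟ zero    (p , q) = contradiction (≤-trans p q) λ ()
∑-≟ (suc n) {m} (p , q) with suc n ≟ m
... | yes refl = cong suc (trans (∑-cong n λ v r → ind-no (v ≟ m) (<⇒≢ (s≤s (proj₂ r)))) (∑-0 n))
... | no  sn≢m = ∑-≟ n (p , ≤-pred (≤∧≢⇒< q (sn≢m ∘ sym)))

length-unique : ∀ n l → Unique l → All (InRange n) l → length l ≡ ∑ n (λ v → ind (v ∈ℕ? l))
length-unique n []      _        _        = sym (∑-0 n)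
length-unique n (x ∷ l) (x∉ ∷ u) (r ∷ rs) =
  trans (cong suc (length-unique n l u rs))
  (trans (cong (_+ ∑ n (λ v → ind (v ∈ℕ? l))) (sym (∑-≟ n r)))
  (trans (sym (∑-+ n _ _)) (∑-cong n λ v _ → pointwise v)))
  where
  pointwise : ∀ v → ind (v ≟ x) + ind (v ∈ℕ? l) ≡ ind (v ∈ℕ? (x ∷ l))
  pointwise v = ind-⊎ (v ≟ x) (v ∈ℕ? l) (v ∈ℕ? (x ∷ l)) Any.toSum here there λ { refl v∈ → All.lookup x∉ v∈ refl }

unique-⊑⇒length≤ : ∀ {xs ys : List Chord} → Unique xs → xs ⊑ ys → length xs ≤ length ys
unique-⊑⇒length≤ {[]}     _        _ = z≤n
unique-⊑⇒length≤ {x ∷ xs} (x∉ ∷ u) s with ∈-∃++ (s (here refl))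
... | as , bs , refl = ≤-trans (s≤s (unique-⊑⇒length≤ u s′)) (≤-reflexive len)
  where
  s′ : xs ⊑ as ++ bs
  s′ y∈ with ∈-++⁻ as (s (there y∈))
  ... | inj₁ p           = ∈-++⁺ˡ p
  ... | inj₂ (here refl) = contradiction refl (All.lookup x∉ y∈)
  ... | inj₂ (there p)   = ∈-++⁺ʳ as p
  len : suc (length (as ++ bs)) ≡ length (as ++ x ∷ bs)
  len rewrite length-++ as {bs} | length-++ as {x ∷ bs} = sym (+-suc (length as) (length bs))

unique-⊑⇒length≤∣∣ : ∀ {xs Y} → Unique xs → xs ⊑ Y → length xs ≤ ∣ Y ∣
unique-⊑⇒length≤∣∣ u s = unique-⊑⇒length≤ u (∈-deduplicate⁺ _≟ᶜ_ ∘ s)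

∣∣≤length : ∀ {X Y} → X ⊑ Y → ∣ X ∣ ≤ length Y
∣∣≤length {X} s = unique-⊑⇒length≤ (DecUniqueP.deduplicate-! _≟ᶜ_ X) (s ∘ ∈-deduplicate⁻ _≟ᶜ_ X)

-- Vertex sets of chord lists

infix 4 _∈ᵥ_ _∈ᵥ?_

End : ℕ → Chord → Set
End v x = v ≡ proj₁ x ⊎ v ≡ proj₂ x

-- Stands in for membership in the deduplicated list `V L`; `∣V∣≡cnt` and `newVertices+cnt`
-- translate the counts back.
_∈ᵥ_ : ℕ → List Chord → Set
v ∈ᵥ L = Any (End v) L

_∈ᵥ?_ : ∀ v L → Dec (v ∈ᵥ L)
v ∈ᵥ? L = Any.any? (λ x → (v ≟ proj₁ x) ⊎-dec (v ≟ proj₂ x)) L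

∈ᵥ-intro : ∀ {v x L} → x ∈ L → End v x → v ∈ᵥ L
∈ᵥ-intro x∈ e = Any.map (λ { refl → e }) x∈

∈ᵥ-elim : ∀ {v L} → v ∈ᵥ L → ∃ λ x → x ∈ L × End v x
∈ᵥ-elim (here e)  = _ , here refl , e
∈ᵥ-elim (there p) = let x , x∈ , e = ∈ᵥ-elim p in x , there x∈ , e

∈ᵥ-mono : ∀ {L M} → L ⊑ M → ∀ {v} → v ∈ᵥ L → v ∈ᵥ M
∈ᵥ-mono s p = let x , x∈ , e = ∈ᵥ-elim p in ∈ᵥ-intro (s x∈) e

V-unique : ∀ L → Unique (V L)
V-unique L = DecUniqueP.deduplicate-! _≟_ _

∈V⇒∈ᵥ : ∀ L {v} → v ∈ₗ V L → v ∈ᵥ L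
∈V⇒∈ᵥ L p = go L (∈-deduplicate⁻ _≟_ _ p)
  where
  go : ∀ L {v} → v ∈ₗ concatMap _ L → v ∈ᵥ L
  go (x ∷ L) (here e)          = here (inj₁ e)
  go (x ∷ L) (there (here e))  = here (inj₂ e)
  go (x ∷ L) (there (there p)) = there (go L p)

∈ᵥ⇒∈V : ∀ L {v} → v ∈ᵥ L → v ∈ₗ V L
∈ᵥ⇒∈V L p = ∈-deduplicate⁺ _≟_ (go L p)
  where
  go : ∀ L {v} → v ∈ᵥ L → v ∈ₗ concatMap _ L
  go (x ∷ L) (here (inj₁ e)) = here e
  go (x ∷ L) (here (inj₂ e)) = there (here e)
  go (x ∷ L) (there p)       = there (there (go L p))

module Weighted (n : ℕ) where

  wt : (ℕ → ℕ) → List Chord → ℕ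
  wt w L = ∑ n (λ v → ind (v ∈ᵥ? L) * w v)

  wt-mono : ∀ w {L M} → (∀ {v} → v ∈ᵥ L → v ∈ᵥ M) → wt w L ≤ wt w M
  wt-mono w {L} {M} s = ∑-mono n λ v _ → *-monoˡ-≤ (w v) (ind-mono (v ∈ᵥ? L) (v ∈ᵥ? M) s)

  wt-⊑ : ∀ w {L M} → L ⊑ M → wt w L ≤ wt w M
  wt-⊑ w s = wt-mono w (∈ᵥ-mono s)

  wt-∷ : ∀ w {c} → (∀ v → w v ≤ c) → ∀ x L → wt w (x ∷ L) ≤ 2 * c + wt w L
  wt-∷ w {c} w≤c x L = begin
    wt w (x ∷ L)                    ≤⟨ ∑-mono n (λ v _ → pointwise v) ⟩
    ∑ n (λ v → c * (δ₁ v + δ₂ v) + ind (v ∈ᵥ? L) * w v) ≡⟨ ∑-+ n _ _ ⟩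
    ∑ n (λ v → c * (δ₁ v + δ₂ v)) + wt w L  ≡⟨ cong (_+ wt w L) (trans (∑-* n c _) (cong (c *_) (∑-+ n δ₁ δ₂))) ⟩
    c * (∑ n δ₁ + ∑ n δ₂) + wt w L          ≤⟨ +-monoˡ-≤ (wt w L) (*-monoʳ-≤ c (+-mono-≤ (∑δ≤1 n (proj₁ x)) (∑δ≤1 n (proj₂ x)))) ⟩
    c * 2 + wt w L                          ≡⟨ cong (_+ wt w L) (*-comm c 2) ⟩
    2 * c + wt w L                          ∎
    where
    open ≤-Reasoning
    δ₁ δ₂ : ℕ → ℕ
    δ₁ v = ind (v ≟ proj₁ x)
    δ₂ v = ind (v ≟ proj₂ x)
    ∑δ≤1 : ∀ k m → ∑ k (λ v → ind (v ≟ m)) ≤ 1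
    ∑δ≤1 k m with 1 ≤? m ×-dec m ≤? k
    ... | yes r = ≤-reflexive (∑-≟ k r)
    ... | no ¬r = ≤-trans (≤-reflexive (trans (∑-cong k λ v r → ind-no (v ≟ m) λ { refl → ¬r r }) (∑-0 k))) z≤n
    pointwise : ∀ v → ind (v ∈ᵥ? (x ∷ L)) * w v ≤ c * (δ₁ v + δ₂ v) + ind (v ∈ᵥ? L) * w v
    pointwise v with v ∈ᵥ? (x ∷ L)
    ... | no _ = z≤n
    ... | yes (there p) rewrite ind-yes (v ∈ᵥ? L) p = m≤n+m _ (c * (δ₁ v + δ₂ v))
    ... | yes (here (inj₁ e)) rewrite ind-yes (v ≟ proj₁ x) e = ≤-trans (≤-trans (≤-reflexive (+-identityʳ (w v))) (w≤c v)) (≤-trans (m≤m*n c (suc (δ₂ v))) (m≤m+n _ _))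
    ... | yes (here (inj₂ e)) rewrite ind-yes (v ≟ proj₂ x) e | +-comm (δ₁ v) 1 = ≤-trans (≤-trans (≤-reflexive (+-identityʳ (w v))) (w≤c v)) (≤-trans (m≤m*n c (suc (δ₁ v))) (m≤m+n _ _))

  wt≤length : ∀ w {c} → (∀ v → w v ≤ c) → ∀ L → wt w L ≤ 2 * c * length L
  wt≤length w {c} w≤c []      = ≤-trans (≤-reflexive (∑-0 n)) z≤n
  wt≤length w {c} w≤c (x ∷ L) = ≤-trans (wt-∷ w w≤c x L)
    (≤-trans (+-monoʳ-≤ (2 * c) (wt≤length w w≤c L)) (≤-reflexive (sym (*-suc (2 * c) (length L)))))

  -- A vertex lost when `A ++ B` shrinks to `A′ ++ B′` is lost from `A` or from `B`, so the loss of
  -- the union is at most the sum of the two losses. This lets two subtrees be reduced independently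
  -- before they are joined.
  wt-submodular : ∀ w {A A′ B B′} → A′ ⊑ A → B′ ⊑ B →
    wt w (A ++ B) + (wt w A′ + wt w B′) ≤ wt w (A′ ++ B′) + (wt w A + wt w B)
  wt-submodular w {A} {A′} {B} {B′} sA sB =
    subst₂ _≤_ (split (A ++ B) A′ B′) (split (A′ ++ B′) A B) (∑-mono n λ v _ → pointwise v)
    where
    ι : List Chord → ℕ → ℕ
    ι L v = ind (v ∈ᵥ? L) * w v
    split : ∀ X Y Z → ∑ n (λ v → ι X v + (ι Y v + ι Z v)) ≡ wt w X + (wt w Y + wt w Z)
    split X Y Z = trans (∑-+ n _ _) (cong (wt w X +_) (∑-+ n _ _))
    collect : ∀ a b c d → a * d + (b * d + c * d) ≡ (a + (b + c)) * d
    collect = solve-∀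
    bits : ∀ v → ind (v ∈ᵥ? (A ++ B)) + (ind (v ∈ᵥ? A′) + ind (v ∈ᵥ? B′)) ≤ ind (v ∈ᵥ? (A′ ++ B′)) + (ind (v ∈ᵥ? A) + ind (v ∈ᵥ? B))
    bits v with v ∈ᵥ? A′ | v ∈ᵥ? B′
    ... | yes a | yes b
        rewrite ind-yes (v ∈ᵥ? A) (∈ᵥ-mono sA a) | ind-yes (v ∈ᵥ? B) (∈ᵥ-mono sB b)
              | ind-yes (v ∈ᵥ? (A′ ++ B′)) (∈ᵥ-mono ∈-++⁺ˡ a) = +-monoˡ-≤ 2 (ind≤1 (v ∈ᵥ? (A ++ B)))
    ... | yes a | no _
        rewrite ind-yes (v ∈ᵥ? A) (∈ᵥ-mono sA a) | ind-yes (v ∈ᵥ? (A′ ++ B′)) (∈ᵥ-mono ∈-++⁺ˡ a) =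
        ≤-trans (+-monoˡ-≤ 1 (ind≤1 (v ∈ᵥ? (A ++ B)))) (s≤s (s≤s z≤n))
    ... | no _  | yes b
        rewrite ind-yes (v ∈ᵥ? B) (∈ᵥ-mono sB b) | ind-yes (v ∈ᵥ? (A′ ++ B′)) (∈ᵥ-mono (∈-++⁺ʳ A′) b) =
        ≤-trans (+-monoˡ-≤ 1 (ind≤1 (v ∈ᵥ? (A ++ B)))) (s≤s (m≤n+m 1 _))
    ... | no _  | no _ with v ∈ᵥ? (A ++ B)
    ...   | no _  = z≤n
    ...   | yes p = ≤-trans q (m≤n+m _ (ind (v ∈ᵥ? (A′ ++ B′))))
      where
      q : 1 ≤ ind (v ∈ᵥ? A) + ind (v ∈ᵥ? B)
      q with ∈ᵥ-elim p
      ... | x , x∈ , e with ∈-++⁻ A x∈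
      ...   | inj₁ x∈A rewrite ind-yes (v ∈ᵥ? A) (∈ᵥ-intro x∈A e) = s≤s z≤n
      ...   | inj₂ x∈B rewrite ind-yes (v ∈ᵥ? B) (∈ᵥ-intro x∈B e) = m≤n+m 1 _
    pointwise : ∀ v → ι (A ++ B) v + (ι A′ v + ι B′ v) ≤ ι (A′ ++ B′) v + (ι A v + ι B v)
    pointwise v = subst₂ _≤_
      (sym (collect (ind (v ∈ᵥ? (A ++ B))) (ind (v ∈ᵥ? A′)) (ind (v ∈ᵥ? B′)) (w v)))
      (sym (collect (ind (v ∈ᵥ? (A′ ++ B′))) (ind (v ∈ᵥ? A)) (ind (v ∈ᵥ? B)) (w v)))
      (*-monoˡ-≤ (w v) (bits v))

  cnt : List Chord → ℕ
  cnt L = ∑ n (λ v → ind (v ∈ᵥ? L))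

  cnt≡wt : ∀ L → cnt L ≡ wt (λ _ → 1) L
  cnt≡wt L = ∑-cong n λ v _ → sym (*-identityʳ _)

  cnt-mono : ∀ {L M} → (∀ {v} → v ∈ᵥ L → v ∈ᵥ M) → cnt L ≤ cnt M
  cnt-mono {L} {M} s = ∑-mono n λ v _ → ind-mono (v ∈ᵥ? L) (v ∈ᵥ? M) s

  cnt≤n : ∀ L → cnt L ≤ n
  cnt≤n L = ≤-trans (∑-mono n λ v _ → ind≤1 (v ∈ᵥ? L)) (≤-reflexive (∑-1 n))

  VertsInRange : List Chord → Set
  VertsInRange L = ∀ {v} → v ∈ᵥ L → InRange n v

  ∣V∣≡cnt : ∀ L → VertsInRange L → ∣V∣ L ≡ cnt L
  ∣V∣≡cnt L r = trans (length-unique n (V L) (V-unique L) (All.tabulate (r ∘ ∈V⇒∈ᵥ L)))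
    (∑-cong n λ v _ → ≤-antisym (ind-mono (v ∈ℕ? V L) (v ∈ᵥ? L) (∈V⇒∈ᵥ L)) (ind-mono (v ∈ᵥ? L) (v ∈ℕ? V L) (∈ᵥ⇒∈V L)))

  newVertices+cnt : ∀ F K → VertsInRange (F ++ K) → newVertices F K + cnt F ≡ cnt (F ++ K)
  newVertices+cnt F K r =
    trans (cong (_+ cnt F) (length-unique n new (UniqueP.filter⁺ P? (V-unique (F ++ K)))
             (All.tabulate λ v∈ → r (∈V⇒∈ᵥ (F ++ K) (proj₁ (∈-filter⁻ P? {xs = V (F ++ K)} v∈))))))
    (trans (sym (∑-+ n _ _)) (∑-cong n λ v _ → pointwise v))
    where
    P? = λ v → ¬? (v ∈ℕ? V F)
    new = filter P? (V (F ++ K))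
    pointwise : ∀ v → ind (v ∈ℕ? new) + ind (v ∈ᵥ? F) ≡ ind (v ∈ᵥ? (F ++ K))
    pointwise v = ind-⊎ (v ∈ℕ? new) (v ∈ᵥ? F) (v ∈ᵥ? (F ++ K)) split
      (λ q → ∈V⇒∈ᵥ (F ++ K) (proj₁ (∈-filter⁻ P? {xs = V (F ++ K)} q)))
      (∈ᵥ-mono ∈-++⁺ˡ)
      (λ q p → proj₂ (∈-filter⁻ P? {xs = V (F ++ K)} q) (∈ᵥ⇒∈V F p))
      where
      split : v ∈ᵥ (F ++ K) → v ∈ₗ new ⊎ v ∈ᵥ F
      split p with v ∈ᵥ? F
      ... | yes q = inj₂ q
      ... | no ¬q = inj₁ (∈-filter⁺ P? (∈ᵥ⇒∈V (F ++ K) p) (¬q ∘ ∈V⇒∈ᵥ F))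

-- Crossing chords and connected chord sets

cross⁺ : ∀ {a b c d} → a < c → c < b → b < d → Cross (a , b) (c , d)
cross⁺ p q r = (<⇒≢ (<-trans p q) , <⇒≢ p , <⇒≢ (<-trans p (<-trans q r)) , >⇒≢ q , <⇒≢ r , <⇒≢ (<-trans q r))
             , inj₂ (p , q , r)

cross⁻ : ∀ {a b c d} → c < a → a < d → d < b → Cross (a , b) (c , d)
cross⁻ p q r = (<⇒≢ (<-trans q r) , >⇒≢ p , <⇒≢ q , >⇒≢ (<-trans p (<-trans q r)) , >⇒≢ r , <⇒≢ (<-trans p q))
             , inj₁ (p , q , r)

Cross-sym : ∀ {x y} → Cross x y → Cross y x
Cross-sym (_ , inj₁ (p , q , r)) = cross⁺ p q r
Cross-sym (_ , inj₂ (p , q , r)) = cross⁻ p q r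

-- Connectedness of the circle graph of J, expressed by two-colourings.
Conn : List Chord → Set
Conn J = (P : Chord → Bool) →
         (∀ {x y} → x ∈ J → y ∈ J → Cross x y → P x ≡ true → P y ≡ true) →
         ∀ {x y} → x ∈ J → y ∈ J → P x ≡ true → P y ≡ true

witness : {P : Set} (d : Dec P) → does d ≡ true → P
witness (yes p) _ = p

conn-dec : ∀ {J} → Conn J → {P : Chord → Set} → (∀ x → Dec (P x)) →
           (∀ {x y} → x ∈ J → y ∈ J → Cross x y → P x → P y) →
           ∀ {x y} → x ∈ J → y ∈ J → P x → P y
conn-dec conn P? closed {x} {y} x∈ y∈ p =
  witness (P? y) (conn (does ∘ P?)
    (λ {u} {w} u∈ w∈ c q → dec-true (P? w) (closed u∈ w∈ c (witness (P? u) q)))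
    x∈ y∈ (dec-true (P? x) p))

-- Crossing is symmetric, so the complement of a closed colouring is closed as well. If `c` were
-- outside the colour class of `x`, the complementary class would spread from `c` to `x`.
rooted⇒conn : ∀ {J c} → c ∈ J →
  ((P : Chord → Bool) → (∀ {x y} → x ∈ J → y ∈ J → Cross x y → P x ≡ true → P y ≡ true) →
   P c ≡ true → ∀ {y} → y ∈ J → P y ≡ true) → Conn J
rooted⇒conn {J} {c} c∈ root P closed {x} x∈ y∈ Px = root P closed Pc y∈
  where
  flip-closed : ∀ {x y} → x ∈ J → y ∈ J → Cross x y → not (P x) ≡ true → not (P y) ≡ true
  flip-closed {x} {y} x∈ y∈ cr q with P y in eq
  ... | false = refl
  ... | true rewrite closed y∈ x∈ (Cross-sym cr) eq = q
  Pc : P c ≡ true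
  Pc with P c in eq
  ... | true = refl
  ... | false with root (not ∘ P) flip-closed (cong not eq) x∈
  ...   | q rewrite Px = q

conn-[_] : ∀ c → Conn [ c ]
conn-[ c ] P closed (here refl) (here refl) q = q

conn-++ : ∀ {L M x y} → Conn L → Conn M → x ∈ L → y ∈ M → Cross x y → Conn (L ++ M)
conn-++ {L} {M} {x} {y} cL cM x∈ y∈ cr P closed {u} {w} u∈ w∈ Pu with ∈-++⁻ L u∈ | ∈-++⁻ L w∈
... | inj₁ u∈L | inj₁ w∈L = cL P (λ p q → closed (∈-++⁺ˡ p) (∈-++⁺ˡ q)) u∈L w∈L Pu
... | inj₂ u∈M | inj₂ w∈M = cM P (λ p q → closed (∈-++⁺ʳ L p) (∈-++⁺ʳ L q)) u∈M w∈M Pu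
... | inj₁ u∈L | inj₂ w∈M =
  cM P (λ p q → closed (∈-++⁺ʳ L p) (∈-++⁺ʳ L q)) y∈ w∈M
    (closed (∈-++⁺ˡ x∈) (∈-++⁺ʳ L y∈) cr (cL P (λ p q → closed (∈-++⁺ˡ p) (∈-++⁺ˡ q)) u∈L x∈ Pu))
... | inj₂ u∈M | inj₁ w∈L =
  cL P (λ p q → closed (∈-++⁺ˡ p) (∈-++⁺ˡ q)) x∈ w∈L
    (closed (∈-++⁺ʳ L y∈) (∈-++⁺ˡ x∈) (Cross-sym cr) (cM P (λ p q → closed (∈-++⁺ʳ L p) (∈-++⁺ʳ L q)) u∈M y∈ Pu))

-- Separation

Ordered : List Chord → Set
Ordered L = ∀ {x} → x ∈ L → proj₁ x < proj₂ x

Inside Outside : ℕ → ℕ → List Chord → Set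
-- Both sides contain `a` and `b`, because chords with a common end do not cross.
Inside  a b J = ∀ {v} → v ∈ᵥ J → a ≤ v × v ≤ b
Outside a b J = ∀ {v} → v ∈ᵥ J → v ≤ a ⊎ b ≤ v

end-inside : ∀ {a b v} x → proj₁ x < proj₂ x → ¬ Cross (a , b) x → End v x → a < v → v < b →
             a ≤ proj₁ x × proj₂ x ≤ b
end-inside {a} {b} (c , d) c<d ¬cr (inj₁ refl) a<c c<b with d ≤? b
... | yes d≤b = <⇒≤ a<c , d≤b
... | no  d≰b = contradiction (cross⁺ a<c c<b (≰⇒> d≰b)) ¬cr
end-inside {a} {b} (c , d) c<d ¬cr (inj₂ refl) a<d d<b with a ≤? c
... | yes a≤c = a≤c , <⇒≤ d<b
... | no  a≰c = contradiction (cross⁻ (≰⇒> a≰c) a<d d<b) ¬cr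

-- A chord that crosses one lying in [a, b] has an end strictly between `a` and `b`, and not
-- crossing ab it lies in [a, b] too. So lying in [a, b] spreads over all of `J`; if no chord has
-- this property, no end lies strictly between.
separation : ∀ {J} → Conn J → Ordered J → ∀ a b → (∀ {x} → x ∈ J → ¬ Cross (a , b) x) →
             Inside a b J ⊎ Outside a b J
separation {J} conn ord a b ¬cr with Any.any? In? J
  where
  In? = λ (x : Chord) → a ≤? proj₁ x ×-dec proj₂ x ≤? b
... | yes some = inj₁ inside
  where
  In? = λ (x : Chord) → a ≤? proj₁ x ×-dec proj₂ x ≤? b
  propagate : ∀ {x y} → x ∈ J → y ∈ J → Cross x y → a ≤ proj₁ x × proj₂ x ≤ b → a ≤ proj₁ y × proj₂ y ≤ b
  propagate {x} {y} x∈ y∈ (_ , inj₁ (p , q , r)) (a≤ , ≤b) =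
    end-inside y (ord y∈) (¬cr y∈) (inj₂ refl) (≤-<-trans a≤ q) (<-≤-trans r ≤b)
  propagate {x} {y} x∈ y∈ (_ , inj₂ (p , q , r)) (a≤ , ≤b) =
    end-inside y (ord y∈) (¬cr y∈) (inj₁ refl) (≤-<-trans a≤ p) (<-≤-trans q ≤b)
  inside : Inside a b J
  inside v∈ with ∈ᵥ-elim v∈ | find some
  ... | x , x∈ , e | y , y∈ , iny with conn-dec conn In? propagate y∈ x∈ iny | e
  ...   | a≤ , ≤b | inj₁ refl = a≤ , ≤-trans (<⇒≤ (ord x∈)) ≤b
  ...   | a≤ , ≤b | inj₂ refl = ≤-trans a≤ (<⇒≤ (ord x∈)) , ≤b
... | no none = inj₂ outside
  where
  outside : Outside a b J
  outside {v} v∈ with v ≤? a | b ≤? v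
  ... | yes p | _     = inj₁ p
  ... | no _  | yes q = inj₂ q
  ... | no p  | no q with ∈ᵥ-elim v∈
  ...   | x , x∈ , e = contradiction (lose x∈ (end-inside x (ord x∈) (¬cr x∈) e (≰⇒> p) (≰⇒> q))) none

-- Otherwise `e` separates `J`, yet `u` and `w` lie strictly on different sides of `e`. The pair uw
-- itself may be any two vertices of `J`, not only a chord.
cross-pair⇒cross : ∀ {J u w e} → Conn J → Ordered J → u ∈ᵥ J → w ∈ᵥ J → Cross (u , w) e → Any (Cross e) J
cross-pair⇒cross {J} {u} {w} {e} conn ord u∈ w∈ cr with Any.any? (cross? e) J
... | yes p = p
... | no ¬p with separation conn ord (proj₁ e) (proj₂ e) (λ x∈ c → ¬p (lose x∈ c)) | proj₂ cr
...   | inj₁ ins | inj₁ (p , q , r) = contradiction (<-≤-trans r (proj₂ (ins w∈))) (<-irrefl refl)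
...   | inj₁ ins | inj₂ (p , q , r) = contradiction (<-≤-trans p (proj₁ (ins u∈))) (<-irrefl refl)
...   | inj₂ out | inj₁ (p , q , r) = ⊥-elim ([ (λ s → <-irrefl refl (<-≤-trans p s)) , (λ s → <-irrefl refl (<-≤-trans q s)) ]′ (out u∈))
...   | inj₂ out | inj₂ (p , q , r) = ⊥-elim ([ (λ s → <-irrefl refl (<-≤-trans q s)) , (λ s → <-irrefl refl (<-≤-trans r s)) ]′ (out w∈))

module _ {J J′ : List Chord} (conn : Conn J) (ord : Ordered J) (conn′ : Conn J′) (ord′ : Ordered J′)
         (¬cr : ∀ {x y} → x ∈ J → y ∈ J′ → ¬ Cross x y) where

  non-interleaving : ∀ {u w} → u ∈ᵥ J → w ∈ᵥ J → Inside u w J′ ⊎ Outside u w J′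
  non-interleaving {u} {w} u∈ w∈ = separation conn′ ord′ u w λ {y} y∈ c →
    let x , x∈ , cr = find (cross-pair⇒cross conn ord u∈ w∈ c) in ¬cr x∈ y∈ (Cross-sym cr)

  -- If v lay strictly inside both spans, V(J′) would be contained in {l, v, h}, too small for a crossing.
  interior-disjoint : ∀ {v l h l′ h′} → l ∈ᵥ J → v ∈ᵥ J → h ∈ᵥ J → l < v → v < h →
    l′ ∈ᵥ J′ → v ∈ᵥ J′ → h′ ∈ᵥ J′ → l′ < v → v < h′ →
    ¬ (∃₂ λ x y → x ∈ J′ × y ∈ J′ × Cross x y)
  interior-disjoint {v} {l} {h} l∈ v∈ h∈ l<v v<h l′∈ v∈′ h′∈ l′<v v<h′ (x , y , x∈ , y∈ , cr)
    with non-interleaving l∈ v∈ | non-interleaving v∈ h∈ | non-interleaving l∈ h∈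
  ... | inj₁ ins | _        | _        = <-irrefl refl (<-≤-trans v<h′ (proj₂ (ins h′∈)))
  ... | inj₂ _   | inj₁ ins | _        = <-irrefl refl (<-≤-trans l′<v (proj₁ (ins l′∈)))
  ... | inj₂ _   | inj₂ _   | inj₂ out = [ (λ s → <-irrefl refl (<-≤-trans l<v s)) , (λ s → <-irrefl refl (<-≤-trans v<h s)) ]′ (out v∈′)
  ... | inj₂ o₁  | inj₂ o₂  | inj₁ ins = [ (λ (p , q , r) → four y₁ x₁ y₂ x₂ p q r) , (λ (p , q , r) → four x₁ y₁ x₂ y₂ p q r) ]′ (proj₂ cr)
    where
    x₁ = ∈ᵥ-intro x∈ (inj₁ refl)
    x₂ = ∈ᵥ-intro x∈ (inj₂ refl)
    y₁ = ∈ᵥ-intro y∈ (inj₁ refl)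
    y₂ = ∈ᵥ-intro y∈ (inj₂ refl)
    four : ∀ {a b c d} → a ∈ᵥ J′ → b ∈ᵥ J′ → c ∈ᵥ J′ → d ∈ᵥ J′ → a < b → b < c → c < d → ⊥
    four a∈ b∈ c∈ d∈ a<b b<c c<d with o₁ b∈
    ... | inj₁ b≤l = <-irrefl refl (≤-<-trans (proj₁ (ins a∈)) (<-≤-trans a<b b≤l))
    ... | inj₂ v≤b with o₂ c∈
    ...   | inj₁ c≤v = <-irrefl refl (≤-<-trans v≤b (<-≤-trans b<c c≤v))
    ...   | inj₂ h≤c = <-irrefl refl (≤-<-trans h≤c (<-≤-trans c<d (proj₂ (ins d∈))))

-- Gaps of a connected set

module _ {P : ℕ → Set} (P? : ∀ v → Dec (P v)) where

  last-below : ∀ z → (∀ {u} → u < z → ¬ P u) ⊎ (∃ λ x → x < z × P x × (∀ {u} → x < u → u < z → ¬ P u))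
  last-below zero = inj₁ λ ()
  last-below (suc z) with P? z
  ... | yes p = inj₂ (z , ≤-refl , p , λ z<u u<sz → contradiction (<-≤-trans z<u (≤-pred u<sz)) (<-irrefl refl))
  ... | no ¬p with last-below z
  ...   | inj₁ none = inj₁ λ {u} u<sz Pu → below u (≤-pred u<sz) Pu none
    where
    below : ∀ u → u ≤ z → P u → (∀ {u} → u < z → ¬ P u) → ⊥
    below u u≤z Pu none with m≤n⇒m<n∨m≡n u≤z
    ... | inj₁ u<z  = none u<z Pu
    ... | inj₂ refl = ¬p Pu
  ...   | inj₂ (x , x<z , Px , none) = inj₂ (x , m≤n⇒m≤1+n x<z , Px , none′)
    where
    none′ : ∀ {u} → x < u → u < suc z → ¬ P u
    none′ {u} x<u u<sz Pu with m≤n⇒m<n∨m≡n (≤-pred u<sz)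
    ... | inj₁ u<z  = none x<u u<z Pu
    ... | inj₂ refl = ¬p Pu

  first-above : ∀ k z → (∀ {u} → z < u → u ≤ k + z → ¬ P u) ⊎ (∃ λ y → z < y × P y × (∀ {u} → z < u → u < y → ¬ P u))
  first-above zero z = inj₁ λ z<u u≤z → contradiction (<-≤-trans z<u u≤z) (<-irrefl refl)
  first-above (suc k) z with P? (suc z)
  ... | yes p = inj₂ (suc z , ≤-refl , p , λ z<u u<sz → contradiction (<-≤-trans z<u (≤-pred u<sz)) (<-irrefl refl))
  ... | no ¬p with first-above k (suc z)
  ...   | inj₁ none = inj₁ none′
    where
    none′ : ∀ {u} → z < u → u ≤ suc k + z → ¬ P u
    none′ {u} z<u u≤ Pu with m≤n⇒m<n∨m≡n z<u
    ... | inj₁ sz<u = none sz<u (≤-trans u≤ (≤-reflexive (sym (+-suc k z)))) Pu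
    ... | inj₂ refl = ¬p Pu
  ...   | inj₂ (y , sz<y , Py , none) = inj₂ (y , <-trans (n<1+n z) sz<y , Py , none′)
    where
    none′ : ∀ {u} → z < u → u < y → ¬ P u
    none′ {u} z<u u<y Pu with m≤n⇒m<n∨m≡n z<u
    ... | inj₁ sz<u = none sz<u u<y Pu
    ... | inj₂ refl = ¬p Pu

-- The pairs u, w range over those whose removal cuts the cycle into two nonempty arcs, and a
-- crossing chord reconnects the arcs. This is 3-connectivity of the cycle plus `L` in terms of
-- crossings alone.
Covering : ℕ → List Chord → Set
Covering n L = ∀ u w → 1 ≤ u → suc u < w → w ≤ n → ¬ (u ≡ 1 × w ≡ n) → ∃ λ e → e ∈ L × Cross (u , w) e

module Polygon (n : ℕ) where

  open Weighted n public

  Chords : List Chord → Set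
  Chords L = ∀ {x} → x ∈ L → IsChord n x

  chords-ordered : ∀ {L} → Chords L → Ordered L
  chords-ordered ch x∈ = proj₁ (proj₂ (ch x∈))

  chords-inRange : ∀ {L} → Chords L → VertsInRange L
  chords-inRange ch v∈ with ∈ᵥ-elim v∈
  ... | x , x∈ , inj₁ refl = let p , q , r , _ = ch x∈ in p , ≤-trans (<⇒≤ q) r
  ... | x , x∈ , inj₂ refl = let p , q , r , _ = ch x∈ in ≤-trans p (<⇒≤ q) , r

  record Span (J : List Chord) : Set where
    field
      lo hi : ℕ
      lo∈   : lo ∈ᵥ J
      hi∈   : hi ∈ᵥ J
      lo≤   : ∀ {v} → v ∈ᵥ J → lo ≤ v
      ≤hi   : ∀ {v} → v ∈ᵥ J → v ≤ hi
      wide  : suc lo < hi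

  span : ∀ {J c} → Chords J → c ∈ J → Span J
  span {J} {c} ch c∈ with first-above (_∈ᵥ? J) n 0 | last-below (_∈ᵥ? J) (suc n)
  ... | inj₁ none | _ =
    let p , q , r , _ = ch c∈ in contradiction (∈ᵥ-intro c∈ (inj₁ refl)) (none p (≤-trans (≤-trans (<⇒≤ q) r) (m≤m+n n 0)))
  ... | inj₂ _    | inj₁ none =
    let p , q , r , _ = ch c∈ in contradiction (∈ᵥ-intro c∈ (inj₂ refl)) (none (s≤s r))
  ... | inj₂ (l , _ , l∈ , nl) | inj₂ (h , _ , h∈ , nh) = record
    { lo = l ; hi = h ; lo∈ = l∈ ; hi∈ = h∈ ; lo≤ = lo≤ ; ≤hi = ≤hi
    ; wide = let p , q , r , b≢ , _ = ch c∈ in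
             ≤-trans (s≤s (s≤s (lo≤ (∈ᵥ-intro c∈ (inj₁ refl))))) (≤-trans (≤∧≢⇒< q (b≢ ∘ sym)) (≤hi (∈ᵥ-intro c∈ (inj₂ refl)))) }
    where
    lo≤ : ∀ {v} → v ∈ᵥ J → l ≤ v
    lo≤ v∈ = ≮⇒≥ λ v<l → nl (proj₁ (chords-inRange ch v∈)) v<l v∈
    ≤hi : ∀ {v} → v ∈ᵥ J → v ≤ h
    ≤hi v∈ = ≮⇒≥ λ h<v → nh h<v (s≤s (proj₂ (chords-inRange ch v∈))) v∈

  -- The missing vertex `z` lies in a gap between two cyclically consecutive vertices of `J`. A
  -- chord of `L` crossing this pair has an end in the gap, hence outside V(J), and it crosses `J`
  -- by `cross-pair⇒cross`.
  escaping-chord : ∀ {J c L z} → Chords J → Conn J → c ∈ J → Covering n L → InRange n z → ¬ z ∈ᵥ J →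
                   ∃ λ e → e ∈ L × Any (Cross e) J × (∃ λ p → End p e × ¬ p ∈ᵥ J)
  escaping-chord {J} {c} {L} {z} ch conn c∈ cov (1≤z , z≤n′) z∉ = result
    where
    open Span (span ch c∈)
    ord = chords-ordered ch
    Result = ∃ λ e → e ∈ L × Any (Cross e) J × (∃ λ p → End p e × ¬ p ∈ᵥ J)

    -- The gap that runs from `hi` to `lo` across the cycle edge between n and 1.
    outer : ¬ (lo ≡ 1 × hi ≡ n) → Result
    outer ne with cov lo hi (proj₁ (chords-inRange ch lo∈)) wide (proj₂ (chords-inRange ch hi∈)) ne
    ... | e , e∈ , cr = e , e∈ , cross-pair⇒cross conn ord lo∈ hi∈ cr , escape (proj₂ cr)
      where
      escape : _ → ∃ λ p → End p e × ¬ p ∈ᵥ J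
      escape (inj₁ (p , q , r)) = proj₁ e , inj₁ refl , λ v∈ → <-irrefl refl (<-≤-trans p (lo≤ v∈))
      escape (inj₂ (p , q , r)) = proj₂ e , inj₂ refl , λ v∈ → <-irrefl refl (<-≤-trans r (≤hi v∈))

    inner : ∀ {x y} → x ∈ᵥ J → y ∈ᵥ J → x < z → z < y → (∀ {u} → x < u → u < y → ¬ u ∈ᵥ J) → Result
    inner {x} {y} x∈ y∈ x<z z<y none
      with cov x y (proj₁ (chords-inRange ch x∈)) (≤-<-trans x<z z<y) (proj₂ (chords-inRange ch y∈)) ne
      where
      -- A gap from 1 to n would force the chord `c` of `J` to join 1 and n, which is a cycle edge.
      ne : ¬ (x ≡ 1 × y ≡ n)
      ne (refl , refl) = let p , q , r , _ , no-1n = ch c∈ in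
        no-1n ( ≤-antisym (≮⇒≥ λ 1<a → none 1<a (<-≤-trans q r) (∈ᵥ-intro c∈ (inj₁ refl))) p
              , ≤-antisym r (≮⇒≥ λ b<n → none (≤-<-trans p q) b<n (∈ᵥ-intro c∈ (inj₂ refl))))
    ... | e , e∈ , cr = e , e∈ , cross-pair⇒cross conn ord x∈ y∈ cr , escape (proj₂ cr)
      where
      escape : _ → ∃ λ p → End p e × ¬ p ∈ᵥ J
      escape (inj₁ (p , q , r)) = proj₂ e , inj₂ refl , none q r
      escape (inj₂ (p , q , r)) = proj₁ e , inj₁ refl , none p q

    result : Result
    result with last-below (_∈ᵥ? J) z | first-above (_∈ᵥ? J) n z
    ... | inj₁ none | _ = outer λ (lo≡1 , _) → none (≤∧≢⇒< (≤-trans (≤-reflexive lo≡1) 1≤z) λ { refl → z∉ lo∈ }) lo∈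
    ... | inj₂ _ | inj₁ none = outer λ (_ , hi≡n) →
        none (≤∧≢⇒< (≤-trans z≤n′ (≤-reflexive (sym hi≡n))) λ { refl → z∉ hi∈ })
             (≤-trans (proj₂ (chords-inRange ch hi∈)) (m≤m+n n z)) hi∈
    ... | inj₂ (x , x<z , x∈ , nx) | inj₂ (y , z<y , y∈ , ny) = inner x∈ y∈ x<z z<y none
      where
      none : ∀ {u} → x < u → u < y → ¬ u ∈ᵥ J
      none {u} x<u u<y u∈ with <-cmp u z
      ... | tri< u<z _ _ = nx x<u u<z u∈
      ... | tri≈ _ refl _ = z∉ u∈
      ... | tri> _ _ z<u = ny z<u u<y u∈

  spanning? : ∀ J → (∀ {v} → InRange n v → v ∈ᵥ J) ⊎ (∃ λ z → InRange n z × ¬ z ∈ᵥ J)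
  spanning? J with last-below (λ v → 1 ≤? v ×-dec ¬? (v ∈ᵥ? J)) (suc n)
  ... | inj₂ (z , z<sn , (1≤z , z∉) , _) = inj₂ (z , (1≤z , ≤-pred z<sn) , z∉)
  ... | inj₁ none = inj₁ λ {v} (1≤v , v≤n) → decide v (none (s≤s v≤n)) 1≤v
    where
    decide : ∀ v → ¬ (1 ≤ v × ¬ v ∈ᵥ J) → 1 ≤ v → v ∈ᵥ J
    decide v h 1≤v with v ∈ᵥ? J
    ... | yes p = p
    ... | no ¬p = contradiction (1≤v , ¬p) h

  -- Interior vertices: the vertices of L other than its smallest and largest one.

  Int : List Chord → ℕ → Set
  Int L v = v ∈ᵥ L × Any (λ x → proj₁ x < v) L × Any (λ x → v < proj₂ x) L

  Int? : ∀ L v → Dec (Int L v)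
  Int? L v = v ∈ᵥ? L ×-dec Any.any? (λ x → proj₁ x <? v) L ×-dec Any.any? (λ x → v <? proj₂ x) L

  Int-mono : ∀ {L M v} → L ⊑ M → Int L v → Int M v
  Int-mono s (p , q , r) = ∈ᵥ-mono s p , Any-mono q , Any-mono r
    where
    Any-mono : ∀ {P} → Any P _ → Any P _
    Any-mono a = let x , x∈ , p = find a in lose (s x∈) p

  ι : List Chord → ℕ
  ι L = ∑ n (λ v → ind (Int? L v))

  -- Makes |V(J)| - 3 equal to the number of interior vertices minus one, a quantity that can be
  -- summed over components because their interiors are disjoint.
  cnt≡ι+2 : ∀ {L c} → Chords L → c ∈ L → cnt L ≡ ι L + 2
  cnt≡ι+2 {L} ch c∈ =
    trans (∑-cong n λ v _ → sym (total v))
    (trans (∑-+ n _ _) (cong (λ k → ι L + k)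
      (trans (∑-cong n λ v _ → sym (ends v))
      (trans (∑-+ n _ _) (cong₂ _+_ (∑-≟ n (chords-inRange ch lo∈)) (∑-≟ n (chords-inRange ch hi∈)))))))
    where
    open Span (span ch c∈)
    lo<hi : lo < hi
    lo<hi = <-trans (n<1+n lo) wide
    End? : ∀ v → Dec (v ≡ lo ⊎ v ≡ hi)
    End? v = (v ≟ lo) ⊎-dec (v ≟ hi)
    ends : ∀ v → ind (v ≟ lo) + ind (v ≟ hi) ≡ ind (End? v)
    ends v = ind-⊎ (v ≟ lo) (v ≟ hi) (End? v) id inj₁ inj₂ λ { refl lo≡hi → <-irrefl lo≡hi lo<hi }
    first : ∀ {v} → v ∈ᵥ L → ∃ λ x → x ∈ L × proj₁ x ≤ v
    first v∈ with ∈ᵥ-elim v∈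
    ... | x , x∈ , inj₁ refl = x , x∈ , ≤-refl
    ... | x , x∈ , inj₂ refl = x , x∈ , <⇒≤ (chords-ordered ch x∈)
    last : ∀ {v} → v ∈ᵥ L → ∃ λ x → x ∈ L × v ≤ proj₂ x
    last v∈ with ∈ᵥ-elim v∈
    ... | x , x∈ , inj₁ refl = x , x∈ , <⇒≤ (chords-ordered ch x∈)
    ... | x , x∈ , inj₂ refl = x , x∈ , ≤-refl
    total : ∀ v → ind (Int? L v) + ind (End? v) ≡ ind (v ∈ᵥ? L)
    total v = ind-⊎ (Int? L v) (End? v) (v ∈ᵥ? L) split proj₁ (λ { (inj₁ refl) → lo∈ ; (inj₂ refl) → hi∈ }) excl
      where
      split : v ∈ᵥ L → Int L v ⊎ (v ≡ lo ⊎ v ≡ hi)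
      split v∈ with v ≟ lo | v ≟ hi
      ... | yes p | _     = inj₂ (inj₁ p)
      ... | no _  | yes q = inj₂ (inj₂ q)
      ... | no p  | no q  =
        let x , x∈ , x≤ = first lo∈
            y , y∈ , ≤y = last hi∈
        in inj₁ (v∈ , lose x∈ (≤-<-trans x≤ (≤∧≢⇒< (lo≤ v∈) (p ∘ sym))) , lose y∈ (<-≤-trans (≤∧≢⇒< (≤hi v∈) q) ≤y))
      excl : Int L v → ¬ (v ≡ lo ⊎ v ≡ hi)
      excl (_ , a , _) (inj₁ refl) = let x , x∈ , x<v = find a in <-irrefl refl (<-≤-trans x<v (lo≤ (∈ᵥ-intro x∈ (inj₁ refl))))
      excl (_ , _ , b) (inj₂ refl) = let x , x∈ , v<x = find b in <-irrefl refl (<-≤-trans v<x (≤hi (∈ᵥ-intro x∈ (inj₂ refl))))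

-- 3-connectivity of the cycle plus chords as a covering property

-- With `u` and `w` removed, a path from u + 1 to a vertex beyond the arc must leave the arc. No
-- cycle edge does so, hence the step that leaves it is a chord crossing uw.
feasible⇒covering : ∀ {n L} → Ordered L → Feasible n L → Covering n L
feasible⇒covering {n} {L} ord (_ , reach) u w 1≤u u+1<w w≤n ne = finish (beyond u 1≤u ne u<w)
  where
  u<w : u < w
  u<w = <-trans (n<1+n u) u+1<w
  X = u ∷ w ∷ []
  ∉X : ∀ {v} → v ≢ u → v ≢ w → ¬ v ∈ₗ X
  ∉X p q (here e)         = p e
  ∉X p q (there (here e)) = q e
  exit : ∀ {a b} → Reach n L X a b → u < a → a < w → ¬ (u < b × b < w) → ∃ λ e → e ∈ L × Cross (u , w) e
  exit here u<a a<w b∉ = contradiction (u<a , a<w) b∉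
  exit {a} (step {w = a′} adj _ a′∉ rest) u<a a<w b∉ with u <? a′ | a′ <? w
  ... | yes p | yes q = exit rest p q b∉
  ... | yes p | no q with adj
  ...   | inj₁ (inj₁ (_ , refl , _)) = contradiction (≤∧≢⇒< a<w λ { refl → a′∉ (there (here refl)) }) q
  ...   | inj₁ (inj₂ (refl , _)) = contradiction (<-≤-trans u<a 1≤u) (<-irrefl refl)
  ...   | inj₂ (inj₁ (inj₁ (_ , refl , _))) = contradiction (<-trans (n<1+n _) a<w) q
  ...   | inj₂ (inj₁ (inj₂ (_ , refl))) = contradiction (<-≤-trans a<w w≤n) (<-irrefl refl)
  ...   | inj₂ (inj₂ (inj₁ e)) = _ , e , cross⁺ u<a a<w (≤∧≢⇒< (≮⇒≥ q) λ { refl → a′∉ (there (here refl)) })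
  ...   | inj₂ (inj₂ (inj₂ e)) = contradiction (<-trans (ord e) a<w) q
  exit {a} (step {w = a′} adj _ a′∉ rest) u<a a<w b∉ | no p | _ with adj
  ...   | inj₁ (inj₁ (_ , refl , _)) = contradiction (<-trans u<a (n<1+n _)) p
  ...   | inj₁ (inj₂ (refl , _)) = contradiction (<-≤-trans u<a 1≤u) (<-irrefl refl)
  ...   | inj₂ (inj₁ (inj₁ (_ , refl , _))) = contradiction (≤∧≢⇒< (≤-pred u<a) λ { refl → a′∉ (here refl) }) p
  ...   | inj₂ (inj₁ (inj₂ (_ , refl))) = contradiction (<-≤-trans a<w w≤n) (<-irrefl refl)
  ...   | inj₂ (inj₂ (inj₁ e)) = contradiction (<-trans u<a (ord e)) p
  ...   | inj₂ (inj₂ (inj₂ e)) = _ , e , cross⁻ (≤∧≢⇒< (≮⇒≥ p) λ { refl → a′∉ (here refl) }) u<a a<w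
  -- The target outside the arc is w + 1, or u - 1 when w = n; then u = 1 is excluded.
  beyond : ∀ u → 1 ≤ u → ¬ (u ≡ 1 × w ≡ n) → u < w → ∃ λ b → InRange n b × (b < u ⊎ w < b)
  beyond u 1≤u ne u<w with w ≟ n
  ... | no w≢n = suc w , (s≤s z≤n , ≤∧≢⇒< w≤n w≢n) , inj₂ ≤-refl
  beyond (suc zero)    _ ne u<w | yes p = contradiction (refl , p) ne
  beyond (suc (suc u)) _ ne u<w | yes p = suc u , (s≤s z≤n , ≤-trans (<⇒≤ (<-trans (n<1+n (suc u)) u<w)) w≤n) , inj₁ ≤-refl
  finish : (∃ λ b → InRange n b × (b < u ⊎ w < b)) → ∃ λ e → e ∈ L × Cross (u , w) e
  finish (b , rb , side) =
    exit (reach X ≤-refl ((1≤u , ≤-trans (<⇒≤ u<w) w≤n) ∷ (≤-trans 1≤u (<⇒≤ u<w) , w≤n) ∷ [])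
            (suc u) b (s≤s z≤n , <⇒≤ (<-≤-trans u+1<w w≤n)) rb
            (∉X (>⇒≢ (n<1+n u)) (<⇒≢ u+1<w)) (∉b side))
         (n<1+n u) u+1<w (b-out side)
    where
    ∉b : b < u ⊎ w < b → ¬ b ∈ₗ X
    ∉b (inj₁ p) = ∉X (<⇒≢ p) (<⇒≢ (<-trans p u<w))
    ∉b (inj₂ p) = ∉X (>⇒≢ (<-trans u<w p)) (>⇒≢ p)
    b-out : b < u ⊎ w < b → ¬ (u < b × b < w)
    b-out (inj₁ p) (q , _) = <-asym p q
    b-out (inj₂ p) (_ , q) = <-asym p q

feasible-mono : ∀ {n L M} → L ⊑ M → Feasible n L → Feasible n M
feasible-mono {n} {L} {M} s (3<n , reach) = 3<n , λ X l r u v ru rv u∉ v∉ → Reach-mono (reach X l r u v ru rv u∉ v∉)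
  where
  Reach-mono : ∀ {X u v} → Reach n L X u v → Reach n M X u v
  Reach-mono here = here
  Reach-mono (step (inj₁ e) r x p) = step (inj₁ e) r x (Reach-mono p)
  Reach-mono (step (inj₂ (inj₁ e)) r x p) = step (inj₂ (inj₁ e)) r x (Reach-mono p)
  Reach-mono (step (inj₂ (inj₂ (inj₁ e))) r x p) = step (inj₂ (inj₂ (inj₁ (s e)))) r x (Reach-mono p)
  Reach-mono (step (inj₂ (inj₂ (inj₂ e))) r x p) = step (inj₂ (inj₂ (inj₂ (s e)))) r x (Reach-mono p)

-- Removing at most two vertices leaves at most two arcs of the cycle. Each arc is walked along
-- cycle edges, and if both are nonempty, `Covering` supplies a chord between them.
covering⇒feasible : ∀ {n L} → 4 ≤ n → (∀ {v} → v ∈ᵥ L → InRange n v) → Covering n L → Feasible n L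
covering⇒feasible {n} {L} 4≤n inR cov = 4≤n , main
  where
  1≤n : 1 ≤ n
  1≤n = ≤-trans (s≤s z≤n) 4≤n

  Reach-trans : ∀ {X u v w} → Reach n L X u v → Reach n L X v w → Reach n L X u w
  Reach-trans here           q = q
  Reach-trans (step a r x p) q = step a r x (Reach-trans p q)

  module _ (X : List ℕ) where

    -- `Reach` does not require its starting vertex to avoid `X`, so it is not symmetric as it
    -- stands; both directions are carried along.
    R : ℕ → ℕ → Set
    R u v = Reach n L X u v × Reach n L X v u

    R-sym : ∀ {u v} → R u v → R v u
    R-sym (p , q) = q , p

    infixr 5 _⟫_
    _⟫_ : ∀ {u v w} → R u v → R v w → R u w
    (p , q) ⟫ (p′ , q′) = Reach-trans p p′ , Reach-trans q′ q

    Adj-sym : ∀ {u v} → Adj n L u v → Adj n L v u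
    Adj-sym (inj₁ e)               = inj₂ (inj₁ e)
    Adj-sym (inj₂ (inj₁ e))        = inj₁ e
    Adj-sym (inj₂ (inj₂ (inj₁ e))) = inj₂ (inj₂ (inj₂ e))
    Adj-sym (inj₂ (inj₂ (inj₂ e))) = inj₂ (inj₂ (inj₁ e))

    edge : ∀ {u v} → Adj n L u v → InRange n u → InRange n v → ¬ u ∈ₗ X → ¬ v ∈ₗ X → R u v
    edge a ru rv u∉ v∉ = step a rv v∉ here , step (Adj-sym a) ru u∉ here

    walk : ∀ {a b} → 1 ≤ a → a ≤ b → b ≤ n → (∀ v → a ≤ v → v ≤ b → ¬ v ∈ₗ X) → R a b
    walk {a} {zero}  1≤a a≤b _ _ = contradiction (≤-trans 1≤a a≤b) λ ()
    walk {a} {suc b} 1≤a a≤b b≤n free with m≤n⇒m<n∨m≡n a≤b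
    ... | inj₂ refl = here , here
    ... | inj₁ a<b  =
      walk 1≤a (≤-pred a<b) (<⇒≤ b≤n) (λ v p q → free v p (m≤n⇒m≤1+n q))
      ⟫ edge (inj₁ (inj₁ (≤-trans 1≤a (≤-pred a<b) , refl , b≤n)))
             (≤-trans 1≤a (≤-pred a<b) , <⇒≤ b≤n) (s≤s z≤n , b≤n) (free b (≤-pred a<b) (n≤1+n b)) (free (suc b) a≤b ≤-refl)

    walk± : ∀ {a b lo hi} → 1 ≤ lo → hi ≤ n → (∀ v → lo ≤ v → v ≤ hi → ¬ v ∈ₗ X) →
            lo ≤ a → a ≤ hi → lo ≤ b → b ≤ hi → R a b
    walk± {a} {b} 1≤lo hi≤n free p q r s with ≤-total a b
    ... | inj₁ a≤b = walk (≤-trans 1≤lo p) a≤b (≤-trans s hi≤n) λ v x y → free v (≤-trans p x) (≤-trans y s)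
    ... | inj₂ b≤a = R-sym (walk (≤-trans 1≤lo r) b≤a (≤-trans q hi≤n) λ v x y → free v (≤-trans r x) (≤-trans y q))

    -- x = y = 0 covers X = ∅, and x = y ≥ 1 covers a single removed vertex.
    two-arcs : ∀ x y → x ≤ y → y ≤ n → (x < y → 1 ≤ x) → (∀ {v} → v ≢ x → v ≢ y → ¬ v ∈ₗ X) →
               ∀ {u v} → InRange n u → InRange n v → u ≢ x → u ≢ y → v ≢ x → v ≢ y → R u v
    two-arcs x y x≤y y≤n 1≤x avoid {u} {v} ru rv u≢x u≢y v≢x v≢y = go (side u≢x u≢y) (side v≢x v≢y)
      where
      Out In : ℕ → Set
      Out v = v < x ⊎ y < v
      In  v = x < v × v < y
      side : ∀ {v} → v ≢ x → v ≢ y → Out v ⊎ In v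
      side {v} v≢x v≢y with <-cmp v x | <-cmp v y
      ... | tri< p _ _ | _          = inj₁ (inj₁ p)
      ... | tri≈ _ p _ | _          = contradiction p v≢x
      ... | tri> _ _ p | tri< q _ _ = inj₂ (p , q)
      ... | tri> _ _ p | tri≈ _ q _ = contradiction q v≢y
      ... | tri> _ _ p | tri> _ _ q = inj₁ (inj₂ q)
      below : ∀ v → v < x → ¬ v ∈ₗ X
      below v p = avoid (<⇒≢ p) (<⇒≢ (<-≤-trans p x≤y))
      above : ∀ v → y < v → ¬ v ∈ₗ X
      above v p = avoid (>⇒≢ (≤-<-trans x≤y p)) (>⇒≢ p)
      to-1 : ∀ {v} → 1 ≤ v → v < x → R v 1
      to-1 1≤v v<x = R-sym (walk ≤-refl 1≤v (<⇒≤ (<-≤-trans v<x (≤-trans x≤y y≤n))) λ z _ z≤v → below z (≤-<-trans z≤v v<x))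
      to-n : ∀ {v} → v ≤ n → y < v → R v n
      to-n {v} v≤n y<v = walk (≤-trans (s≤s z≤n) y<v) v≤n ≤-refl λ z v≤z _ → above z (<-≤-trans y<v v≤z)
      wrap : 1 < x → y < n → R 1 n
      wrap 1<x y<n = edge (inj₁ (inj₂ (refl , refl))) (≤-refl , 1≤n) (1≤n , ≤-refl) (below 1 1<x) (above n y<n)
      out-out : ∀ {u v} → InRange n u → InRange n v → Out u → Out v → R u v
      out-out (1≤u , _)   (1≤v , _)   (inj₁ p) (inj₁ q) = to-1 1≤u p ⟫ R-sym (to-1 1≤v q)
      out-out (_ , u≤n)   (_ , v≤n)   (inj₂ p) (inj₂ q) = to-n u≤n p ⟫ R-sym (to-n v≤n q)
      out-out (1≤u , _)   (_ , v≤n)   (inj₁ p) (inj₂ q) =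
        to-1 1≤u p ⟫ wrap (≤-<-trans 1≤u p) (<-≤-trans q v≤n) ⟫ R-sym (to-n v≤n q)
      out-out (_ , u≤n)   (1≤v , _)   (inj₂ p) (inj₁ q) =
        to-n u≤n p ⟫ R-sym (wrap (≤-<-trans 1≤v q) (<-≤-trans p u≤n)) ⟫ R-sym (to-1 1≤v q)
      in-in : ∀ {u v} → In u → In v → R u v
      in-in {u} {v} (p , q) (r , s) =
        walk± (s≤s z≤n) (≤-trans (n≤1+n _) (≤-trans y-1<y y≤n)) free p (≤-pred′ q) r (≤-pred′ s)
        where
        ≤-pred′ : ∀ {v} → v < y → v ≤ y ∸ 1
        ≤-pred′ v<y = ∸-monoˡ-≤ 1 v<y
        y-1<y : suc (y ∸ 1) ≤ y
        y-1<y = ≤-reflexive (m+[n∸m]≡n {1} {y} (≤-trans (s≤s z≤n) q))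
        free : ∀ z → suc x ≤ z → z ≤ y ∸ 1 → ¬ z ∈ₗ X
        free z a b = avoid (>⇒≢ a) (<⇒≢ (≤-trans (s≤s b) y-1<y))
      in-out : ∀ {u v} → InRange n u → InRange n v → In u → Out v → R u v
      in-out {u} {v} ru rv (x<u , u<y) o with cov x y (1≤x x<y) (≤-<-trans x<u u<y) y≤n ne
        where
        x<y = <-trans x<u u<y
        ne : ¬ (x ≡ 1 × y ≡ n)
        ne (refl , refl) = [ (λ p → <-irrefl refl (<-≤-trans p (proj₁ rv))) , (λ p → <-irrefl refl (<-≤-trans p (proj₂ rv))) ]′ o
      ... | e , e∈ , (_ , inj₁ (p , q , r)) =
          in-in (x<u , u<y) (q , r) ⟫ R-sym (edge (inj₂ (inj₂ (inj₁ e∈))) (inR (∈ᵥ-intro e∈ (inj₁ refl))) (inR (∈ᵥ-intro e∈ (inj₂ refl)))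
            (below _ p) (avoid (>⇒≢ q) (<⇒≢ r))) ⟫ out-out (inR (∈ᵥ-intro e∈ (inj₁ refl))) rv (inj₁ p) o
      ... | e , e∈ , (_ , inj₂ (p , q , r)) =
          in-in (x<u , u<y) (p , q) ⟫ edge (inj₂ (inj₂ (inj₁ e∈))) (inR (∈ᵥ-intro e∈ (inj₁ refl))) (inR (∈ᵥ-intro e∈ (inj₂ refl)))
            (avoid (>⇒≢ p) (<⇒≢ q)) (above _ r) ⟫ out-out (inR (∈ᵥ-intro e∈ (inj₂ refl))) rv (inj₂ r) o
      go : Out u ⊎ In u → Out v ⊎ In v → R u v
      go (inj₁ p) (inj₁ q) = out-out ru rv p q
      go (inj₂ p) (inj₂ q) = in-in p q
      go (inj₂ p) (inj₁ q) = in-out ru rv p q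
      go (inj₁ p) (inj₂ q) = R-sym (in-out rv ru q p)

  main : (X : List ℕ) → length X ≤ 2 → All (InRange n) X → (u v : ℕ) → InRange n u → InRange n v →
         ¬ u ∈ₗ X → ¬ v ∈ₗ X → Reach n L X u v
  main [] _ _ u v ru rv _ _ =
    proj₁ (two-arcs [] 0 0 z≤n z≤n (λ ()) (λ _ _ ()) ru rv (>⇒≢ (proj₁ ru)) (>⇒≢ (proj₁ ru)) (>⇒≢ (proj₁ rv)) (>⇒≢ (proj₁ rv)))
  main (x ∷ []) _ (rx ∷ []) u v ru rv u∉ v∉ =
    proj₁ (two-arcs _ x x ≤-refl (proj₂ rx) (λ _ → proj₁ rx) (λ { p _ (here e) → p e }) ru rv
      (u∉ ∘ here) (u∉ ∘ here) (v∉ ∘ here) (v∉ ∘ here))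
  main (x ∷ y ∷ []) _ (rx ∷ ry ∷ []) u v ru rv u∉ v∉ with ≤-total x y
  ... | inj₁ x≤y = proj₁ (two-arcs _ x y x≤y (proj₂ ry) (λ _ → proj₁ rx) (λ { p q (here e) → p e ; p q (there (here e)) → q e }) ru rv
      (u∉ ∘ here) (u∉ ∘ there ∘ here) (v∉ ∘ here) (v∉ ∘ there ∘ here))
  ... | inj₂ y≤x = proj₁ (two-arcs _ y x y≤x (proj₂ rx) (λ _ → proj₁ ry) (λ { p q (here e) → q e ; p q (there (here e)) → p e }) ru rv
      (u∉ ∘ there ∘ here) (u∉ ∘ here) (v∉ ∘ there ∘ here) (v∉ ∘ here))
  main (_ ∷ _ ∷ _ ∷ _) (s≤s (s≤s ())) _ _ _ _ _ _ _

-- Systems of connected components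

Disj : List Chord → List Chord → Set
Disj J K = ∀ {x} → x ∈ J → ¬ x ∈ K

-- Characterises a list of components up to order and repetition of chords. Components of enlarged
-- sets can then be assembled by hand and compared with `𝓛` through `ρ-unique`, without computing
-- `𝓛` again.
record Sys (A : List Chord) (Js : List (List Chord)) : Set where
  field
    conn     : ∀ {J} → J ∈ₗ Js → Conn J
    nonempty : ∀ {J} → J ∈ₗ Js → ∃ λ x → x ∈ J
    sub      : ∀ {J} → J ∈ₗ Js → J ⊑ A
    closed   : ∀ {J} → J ∈ₗ Js → ∀ {x y} → x ∈ J → y ∈ A → Cross x y → y ∈ J
    cover    : ∀ {x} → x ∈ A → ∃ λ J → J ∈ₗ Js × x ∈ J
    disjoint : AllPairs Disj Js

-- Components obtained by iterated growth

ClosedIn : List Chord → List Chord → Set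
ClosedIn F C = ∀ {x y} → x ∈ C → y ∈ F → Cross x y → y ∈ C

∈-grow⁻ : ∀ F C {y} → y ∈ grow F C → y ∈ C ⊎ (y ∈ F × Any (λ c → Cross c y) C)
∈-grow⁻ F C y∈ with ∈-++⁻ C y∈
... | inj₁ p = inj₁ p
... | inj₂ p = inj₂ (∈-filter⁻ (λ d → Any.any? (λ c → cross? c d) C) {xs = F} p)

∈-grow⁺ : ∀ F C {x y} → x ∈ C → y ∈ F → Cross x y → y ∈ grow F C
∈-grow⁺ F C x∈ y∈ cr = ∈-++⁺ʳ C (∈-filter⁺ (λ d → Any.any? (λ c → cross? c d) C) y∈ (lose x∈ cr))

grow-⊑ : ∀ F C → C ⊑ grow F C
grow-⊑ F C = ∈-++⁺ˡ

iter-⊑ : ∀ F k C → C ⊑ iter k (grow F) C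
iter-⊑ F zero    C = id
iter-⊑ F (suc k) C = iter-⊑ F k (grow F C) ∘ grow-⊑ F C

iter-sub : ∀ F k C → C ⊑ F → iter k (grow F) C ⊑ F
iter-sub F zero    C s = s
iter-sub F (suc k) C s = iter-sub F k (grow F C) λ y∈ → [ s , proj₁ ]′ (∈-grow⁻ F C y∈)

iter-induct : ∀ F k C (P : Chord → Bool) →
  (∀ {x y} → x ∈ iter k (grow F) C → y ∈ iter k (grow F) C → Cross x y → P x ≡ true → P y ≡ true) →
  (∀ {x} → x ∈ C → P x ≡ true) → ∀ {y} → y ∈ iter k (grow F) C → P y ≡ true
iter-induct F zero    C P cl base = base
iter-induct F (suc k) C P cl base = iter-induct F k (grow F C) P cl base′
  where
  base′ : ∀ {y} → y ∈ grow F C → P y ≡ true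
  base′ y∈ with ∈-grow⁻ F C y∈
  ... | inj₁ p = base p
  ... | inj₂ (_ , some) = let x , x∈ , cr = find some in
    cl (iter-⊑ F k _ (grow-⊑ F C x∈)) (iter-⊑ F k _ y∈) cr (base x∈)

grow-closed : ∀ F C → ClosedIn F C → ClosedIn F (grow F C)
grow-closed F C cl {x} {y} x∈ y∈ cr with ∈-grow⁻ F C x∈
... | inj₁ p = ∈-++⁺ˡ (cl p y∈ cr)
... | inj₂ (x∈F , some) = let c , c∈ , cr′ = find some in ∈-++⁺ˡ (cl (cl c∈ x∈F cr′) y∈ cr)

iter-keeps-closed : ∀ F k C → ClosedIn F C → ClosedIn F (iter k (grow F) C)
iter-keeps-closed F zero    C cl = cl
iter-keeps-closed F (suc k) C cl = iter-keeps-closed F k (grow F C) (grow-closed F C cl)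

length-filter-≤ : ∀ {P Q : Chord → Set} (P? : ∀ x → Dec (P x)) (Q? : ∀ x → Dec (Q x)) → (∀ {x} → P x → Q x) →
  ∀ L → length (filter P? L) ≤ length (filter Q? L)
length-filter-≤ P? Q? f [] = z≤n
length-filter-≤ P? Q? f (x ∷ L) with P? x | Q? x
... | yes p | yes q = s≤s (length-filter-≤ P? Q? f L)
... | yes p | no ¬q = contradiction (f p) ¬q
... | no _  | yes _ = m≤n⇒m≤1+n (length-filter-≤ P? Q? f L)
... | no _  | no _  = length-filter-≤ P? Q? f L

length-filter-< : ∀ {P Q : Chord → Set} (P? : ∀ x → Dec (P x)) (Q? : ∀ x → Dec (Q x)) → (∀ {x} → P x → Q x) →
  ∀ {L x} → x ∈ L → Q x → ¬ P x → length (filter P? L) < length (filter Q? L)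
length-filter-< P? Q? f {y ∷ L} (here refl) q ¬p with P? y | Q? y
... | yes p | _     = contradiction p ¬p
... | no _  | no ¬q = contradiction q ¬q
... | no _  | yes _ = s≤s (length-filter-≤ P? Q? f L)
length-filter-< P? Q? f {y ∷ L} (there x∈) q ¬p with P? y | Q? y
... | yes p | yes _ = s≤s (length-filter-< P? Q? f x∈ q ¬p)
... | yes p | no ¬q = contradiction (f p) ¬q
... | no _  | yes _ = m≤n⇒m≤1+n (length-filter-< P? Q? f x∈ q ¬p)
... | no _  | no _  = length-filter-< P? Q? f x∈ q ¬p

-- Every round that is not yet stable absorbs a chord of F ∖ C, so length F rounds suffice.
iter-closed : ∀ F k C → length (F ∖ C) ≤ k → ClosedIn F (iter k (grow F) C)
iter-closed F zero C small {y = y} x∈ y∈ cr with y ∈? C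
... | yes p = p
... | no ¬p with length-filter-< (λ _ → no id) (λ x → ¬? (x ∈? C)) ⊥-elim y∈ ¬p id
...   | q = contradiction (<-≤-trans q small) λ ()
iter-closed F (suc k) C small with Any.any? (λ y → ¬? (y ∈? C) ×-dec Any.any? (λ c → cross? c y) C) F
... | no none = iter-keeps-closed F k (grow F C) (grow-closed F C cl)
  where
  cl : ClosedIn F C
  cl {y = y} x∈ y∈ cr with y ∈? C
  ... | yes p = p
  ... | no ¬p = contradiction (lose y∈ (¬p , lose x∈ cr)) none
... | yes some with find some
...   | y , y∈ , y∉C , cr = iter-closed F k (grow F C) (≤-pred (≤-trans smaller small))
  where
  smaller : length (F ∖ grow F C) < length (F ∖ C)
  smaller = length-filter-< (λ x → ¬? (x ∈? grow F C)) (λ x → ¬? (x ∈? C)) (λ p q → p (grow-⊑ F C q)) y∈ y∉C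
    λ q → let c , c∈ , cr′ = find cr in q (∈-grow⁺ F C c∈ y∈ cr′)

module _ (F : List Chord) where

  ∈-comp⁻ : ∀ c {x} → x ∈ component F c → x ∈ iter (length F) (grow F) (c ∷ [])
  ∈-comp⁻ c = ∈-deduplicate⁻ _≟ᶜ_ _

  ∈-comp⁺ : ∀ c {x} → x ∈ iter (length F) (grow F) (c ∷ []) → x ∈ component F c
  ∈-comp⁺ c = ∈-deduplicate⁺ _≟ᶜ_

  comp-root : ∀ c → c ∈ component F c
  comp-root c = ∈-comp⁺ c (iter-⊑ F (length F) _ (here refl))

  comp-sub : ∀ {c} → c ∈ F → component F c ⊑ F
  comp-sub {c} c∈ x∈ = iter-sub F (length F) _ (λ { (here refl) → c∈ }) (∈-comp⁻ c x∈)

  comp-closed : ∀ c → ClosedIn F (component F c)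
  comp-closed c x∈ y∈ cr = ∈-comp⁺ c (iter-closed F (length F) _ small (∈-comp⁻ c x∈) y∈ cr)
    where
    small : length (F ∖ (c ∷ [])) ≤ length F
    small = length-filter (λ x → ¬? (x ∈? (c ∷ []))) F

  comp-conn : ∀ c → Conn (component F c)
  comp-conn c = rooted⇒conn (comp-root c) λ P cl Pc y∈ →
    iter-induct F (length F) _ P (λ p q → cl (∈-comp⁺ c p) (∈-comp⁺ c q)) (λ { (here refl) → Pc }) (∈-comp⁻ c y∈)

  -- The component of `c` is closed under crossing, so lying outside it spreads from `d` over the
  -- whole component of `d`.
  comp-disjoint : ∀ {c d} → d ∈ F → ¬ d ∈ component F c → Disj (component F c) (component F d)
  comp-disjoint {c} {d} d∈ d∉ x∈c x∈d =
    conn-dec (comp-conn d) (λ x → ¬? (x ∈? component F c))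
      (λ u∈ w∈ cr u∉ w∈c → u∉ (comp-closed c w∈c (comp-sub d∈ u∈) (Cross-sym cr)))
      (comp-root d) x∈d d∉ x∈c

  components′-sys : ∀ k rest → length rest ≤ k → rest ⊑ F →
    (∀ {J} → J ∈ₗ components′ F k rest → ∃ λ c → c ∈ rest × J ≡ component F c)
    × (∀ {x} → x ∈ rest → ∃ λ J → J ∈ₗ components′ F k rest × x ∈ J)
    × AllPairs Disj (components′ F k rest)
  components′-sys zero    []         _ _ = (λ ()) , (λ ()) , []
  components′-sys (suc k) []         _ _ = (λ ()) , (λ ()) , []
  components′-sys (suc k) (c ∷ rest) (s≤s len) s = roots , covers , (All.tabulate apart ∷ proj₂ (proj₂ ih))
    where
    rest′ = rest ∖ component F c
    out? = λ x → ¬? (x ∈? component F c)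
    rest′-sub : rest′ ⊑ rest
    rest′-sub x∈ = proj₁ (∈-filter⁻ out? {xs = rest} x∈)
    ih = components′-sys k rest′ (≤-trans (length-filter out? rest) len) (s ∘ there ∘ rest′-sub)
    roots : ∀ {J} → J ∈ₗ components′ F (suc k) (c ∷ rest) → ∃ λ d → d ∈ c ∷ rest × J ≡ component F d
    roots (here e)  = c , here refl , e
    roots (there p) = let d , d∈ , e = proj₁ ih p in d , there (rest′-sub d∈) , e
    covers : ∀ {x} → x ∈ c ∷ rest → ∃ λ J → J ∈ₗ components′ F (suc k) (c ∷ rest) × x ∈ J
    covers (here refl) = _ , here refl , comp-root c
    covers {x} (there x∈) with x ∈? component F c
    ... | yes p = _ , here refl , p
    ... | no ¬p = let J , J∈ , q = proj₁ (proj₂ ih) (∈-filter⁺ out? x∈ ¬p) in J , there J∈ , q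
    apart : ∀ {J} → J ∈ₗ components′ F k rest′ → Disj (component F c) J
    apart J∈ with proj₁ ih J∈
    ... | d , d∈ , refl = comp-disjoint (s (there (rest′-sub d∈))) (proj₂ (∈-filter⁻ out? {xs = rest} d∈))

  𝓛-sys : Sys F (𝓛 F)
  𝓛-sys with components′-sys (length F) F ≤-refl id
  ... | roots , covers , dis = record
    { conn     = λ J∈ → let c , c∈ , e = roots J∈ in subst Conn (sym e) (comp-conn c)
    ; nonempty = λ J∈ → let c , c∈ , e = roots J∈ in c , subst (c ∈_) (sym e) (comp-root c)
    ; sub      = λ J∈ → let c , c∈ , e = roots J∈ in subst (_⊑ F) (sym e) (comp-sub c∈)
    ; closed   = λ J∈ → let c , c∈ , e = roots J∈ in subst (ClosedIn F) (sym e) (comp-closed c)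
    ; cover    = covers
    ; disjoint = dis }

-- The potential Σ (|V(J)| − 3)

module Potential (n : ℕ) where

  open Polygon n public

  -- Truncated subtraction is harmless: components of a singleton-free set have at least three
  -- vertices (`3≤cnt`), and `U≡` identifies the result with the integer sum in `U`.
  ρ : List (List Chord) → ℕ
  ρ []       = 0
  ρ (J ∷ Js) = (cnt J ∸ 3) + ρ Js

  ρ-filter : ∀ {P : List Chord → Set} (P? : ∀ J → Dec (P J)) Js →
             ρ Js ≡ ρ (filter P? Js) + ρ (filter (λ J → ¬? (P? J)) Js)
  ρ-filter P? [] = refl
  ρ-filter P? (J ∷ Js) with P? J
  ... | yes _ = trans (cong (λ k → (cnt J ∸ 3) + k) (ρ-filter P? Js)) (sym (+-assoc (cnt J ∸ 3) _ _))
  ... | no _  = trans (cong (λ k → (cnt J ∸ 3) + k) (ρ-filter P? Js)) (lemma (cnt J ∸ 3) (ρ (filter P? Js)) _)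
    where
    lemma : ∀ a b c → a + (b + c) ≡ b + (a + c)
    lemma = solve-∀

  ρ-++ : ∀ Js Ks → ρ (Js ++ Ks) ≡ ρ Js + ρ Ks
  ρ-++ []       Ks = refl
  ρ-++ (J ∷ Js) Ks = trans (cong (λ k → (cnt J ∸ 3) + k) (ρ-++ Js Ks)) (sym (+-assoc (cnt J ∸ 3) _ _))

  -- The matching sends different members of `Js` to different positions of `Ks`, since disjoint
  -- nonempty lists cannot both equal the same `K` as sets. A used `K` can therefore be struck out.
  ρ-injection : ∀ Js Ks → AllPairs Disj Js → (∀ {J} → J ∈ₗ Js → ∃ λ x → x ∈ J) →
    (∀ {J} → J ∈ₗ Js → ∃ λ K → K ∈ₗ Ks × J ⊑ K × K ⊑ J) → ρ Js ≤ ρ Ks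
  ρ-injection []       Ks _ _ _ = z≤n
  ρ-injection (J ∷ Js) Ks (dJ ∷ dis) ne match with match (here refl)
  ... | K , K∈ , J⊑K , K⊑J with ∈-∃++ K∈
  ...   | as , bs , refl = begin
    (cnt J ∸ 3) + ρ Js         ≤⟨ +-mono-≤ (∸-monoˡ-≤ 3 (cnt-mono (∈ᵥ-mono J⊑K))) (ρ-injection Js (as ++ bs) dis (ne ∘ there) match′) ⟩
    (cnt K ∸ 3) + ρ (as ++ bs) ≡⟨ cong (λ k → (cnt K ∸ 3) + k) (ρ-++ as bs) ⟩
    (cnt K ∸ 3) + (ρ as + ρ bs) ≡⟨ lemma (cnt K ∸ 3) (ρ as) (ρ bs) ⟩
    ρ as + ((cnt K ∸ 3) + ρ bs) ≡⟨ sym (ρ-++ as (K ∷ bs)) ⟩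
    ρ (as ++ K ∷ bs)           ∎
    where
    open ≤-Reasoning
    lemma : ∀ a b c → a + (b + c) ≡ b + (a + c)
    lemma = solve-∀
    match′ : ∀ {J′} → J′ ∈ₗ Js → ∃ λ K′ → K′ ∈ₗ as ++ bs × J′ ⊑ K′ × K′ ⊑ J′
    match′ J′∈ with match (there J′∈)
    ... | K′ , K′∈ , s , t with ∈-++⁻ as K′∈
    ...   | inj₁ p           = K′ , ∈-++⁺ˡ p , s , t
    ...   | inj₂ (there p)   = K′ , ∈-++⁺ʳ as p , s , t
    ...   | inj₂ (here refl) = let x , x∈ = ne (there J′∈) in contradiction x∈ (All.lookup dJ J′∈ (K⊑J (s x∈)))

  -- Two components with a common chord absorb each other: membership in one spreads along crossings
  -- through the other. So systems of equal chord sets match component by component.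
  ρ-unique : ∀ {A B Js Ks} → Sys A Js → Sys B Ks → A ⊑ B → B ⊑ A → ρ Js ≤ ρ Ks
  ρ-unique {A} {B} {Js} {Ks} sA sB A⊑B B⊑A = ρ-injection Js Ks (Sys.disjoint sA) (Sys.nonempty sA) match
    where
    absorb : ∀ {A B Js Ks J K x} → Sys A Js → Sys B Ks → A ⊑ B → J ∈ₗ Js → K ∈ₗ Ks → x ∈ J → x ∈ K → J ⊑ K
    absorb {K = K} sA sB s J∈ K∈ x∈J x∈K y∈ =
      conn-dec (Sys.conn sA J∈) (_∈? K) (λ u∈ w∈ cr u∈K → Sys.closed sB K∈ u∈K (s (Sys.sub sA J∈ w∈)) cr) x∈J y∈ x∈K
    match : ∀ {J} → J ∈ₗ Js → ∃ λ K → K ∈ₗ Ks × J ⊑ K × K ⊑ J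
    match J∈ with Sys.nonempty sA J∈
    ... | x , x∈ with Sys.cover sB (A⊑B (Sys.sub sA J∈ x∈))
    ...   | K , K∈ , x∈K = K , K∈ , absorb sA sB A⊑B J∈ K∈ x∈ x∈K , absorb sB sA B⊑A K∈ J∈ x∈K x∈

  module Merge {A Js} (sys : Sys A Js) (ch : Chords A) (sf : SingletonFree A) where

    open Sys sys

    crossing-pair : ∀ {J} → J ∈ₗ Js → ∃₂ λ x y → x ∈ J × y ∈ J × Cross x y
    crossing-pair J∈ = let x , x∈ = nonempty J∈
                           y , y∈ , cr = find (All.lookup sf (sub J∈ x∈))
                       in x , y , x∈ , closed J∈ x∈ y∈ cr , cr

    chordsJ : ∀ {J} → J ∈ₗ Js → Chords J
    chordsJ J∈ x∈ = ch (sub J∈ x∈)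

    -- Of two crossing chords, the larger left end is interior. The crossing pair exists because `A`
    -- is singleton-free.
    1≤ι : ∀ {J} → J ∈ₗ Js → 1 ≤ ι J
    1≤ι {J} J∈ with crossing-pair J∈
    ... | x , y , x∈ , y∈ , cr =
      [ (λ (p , q , r) → interior (lose y∈ p) (lose x∈ (<-trans q r)) (∈ᵥ-intro x∈ (inj₁ refl)))
      , (λ (p , q , r) → interior (lose x∈ p) (lose y∈ (<-trans q r)) (∈ᵥ-intro y∈ (inj₁ refl))) ]′ (proj₂ cr)
      where
      interior : ∀ {v} → Any (λ x → proj₁ x < v) J → Any (λ x → v < proj₂ x) J → v ∈ᵥ J → 1 ≤ ι J
      interior {v} a b v∈ = ≤-trans (≤-reflexive (sym (∑-≟ n (chords-inRange (chordsJ J∈) v∈))))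
        (∑-mono n λ w _ → ind-mono (w ≟ v) (Int? J w) λ { refl → v∈ , a , b })

    cntJ : ∀ {J} → J ∈ₗ Js → cnt J ≡ ι J + 2
    cntJ J∈ = cnt≡ι+2 (chordsJ J∈) (proj₂ (nonempty J∈))

    3≤cnt : ∀ {J} → J ∈ₗ Js → 3 ≤ cnt J
    3≤cnt J∈ = ≤-trans (+-monoˡ-≤ 2 (1≤ι J∈)) (≤-reflexive (sym (cntJ J∈)))

    int-disjoint : ∀ {J K v} → J ∈ₗ Js → K ∈ₗ Js → Disj J K → Int J v → ¬ Int K v
    int-disjoint J∈ K∈ dis (v∈ , a , b) (v∈′ , a′ , b′) =
      let x , x∈ , p = find a ; y , y∈ , q = find b ; x′ , x∈′ , p′ = find a′ ; y′ , y∈′ , q′ = find b′ in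
      interior-disjoint (conn J∈) (chords-ordered (chordsJ J∈)) (conn K∈) (chords-ordered (chordsJ K∈))
        (λ x∈ y∈ cr → dis (closed J∈ x∈ (sub K∈ y∈) cr) y∈)
        (∈ᵥ-intro x∈ (inj₁ refl)) v∈ (∈ᵥ-intro y∈ (inj₂ refl)) p q
        (∈ᵥ-intro x∈′ (inj₁ refl)) v∈′ (∈ᵥ-intro y∈′ (inj₂ refl)) p′ q′ (crossing-pair K∈)

    ints : List (List Chord) → ℕ → ℕ
    ints []       v = 0
    ints (K ∷ Ks) v = ind (Int? K v) + ints Ks v

    ints≤ : ∀ Ks v → (∀ {K} → K ∈ₗ Ks → K ∈ₗ Js) → AllPairs Disj Ks → ints Ks v ≤ ind (Int? (concat Ks) v)
    ints≤ [] v _ _ = z≤n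
    ints≤ (K ∷ Ks) v s (dK ∷ dis) with Int? K v
    ... | no _ = ≤-trans (ints≤ Ks v (s ∘ there) dis) (ind-mono (Int? (concat Ks) v) (Int? (K ++ concat Ks) v) (Int-mono (∈-++⁺ʳ K)))
    ... | yes i = ≤-trans (≤-reflexive (cong suc (zeros Ks (s ∘ there) dK)))
                    (≤-reflexive (sym (ind-yes (Int? (K ++ concat Ks) v) (Int-mono ∈-++⁺ˡ i))))
      where
      zeros : ∀ Ks → (∀ {K} → K ∈ₗ Ks → K ∈ₗ Js) → All (Disj K) Ks → ints Ks v ≡ 0
      zeros []       _ _        = refl
      zeros (L ∷ Ks) t (d ∷ ds) = cong₂ _+_ (ind-no (Int? L v) (int-disjoint (s (here refl)) (t (here refl)) d i)) (zeros Ks (t ∘ there) ds)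

    -- Of the 3 subtracted per component, two account for the extreme vertices; giving back the
    -- third leaves the interior vertices.
    ρ+length : ∀ Ks → (∀ {K} → K ∈ₗ Ks → K ∈ₗ Js) → ρ Ks + length Ks ≡ ∑ n (ints Ks)
    ρ+length []       s = sym (∑-0 n)
    ρ+length (K ∷ Ks) s = begin
      (cnt K ∸ 3) + ρ Ks + suc (length Ks)   ≡⟨ lemma (cnt K ∸ 3) (ρ Ks) (length Ks) ⟩
      (cnt K ∸ 3) + 1 + (ρ Ks + length Ks)   ≡⟨ cong₂ _+_ one (ρ+length Ks (s ∘ there)) ⟩
      ι K + ∑ n (ints Ks)                    ≡⟨ sym (∑-+ n _ _) ⟩
      ∑ n (ints (K ∷ Ks))                    ∎
      where
      open Relation.Binary.PropositionalEquality.≡-Reasoning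
      lemma : ∀ a b c → a + b + suc c ≡ a + 1 + (b + c)
      lemma = solve-∀
      one : (cnt K ∸ 3) + 1 ≡ ι K
      one = trans (cong (λ c → c ∸ 3 + 1) (cntJ (s (here refl)))) (shift (ι K) (1≤ι (s (here refl))))
        where
        shift : ∀ i → 1 ≤ i → i + 2 ∸ 3 + 1 ≡ i
        shift (suc i) _ rewrite +-comm i 2 = +-comm i 1

    -- The interiors are disjoint and remain interior in the union, which has two further extreme
    -- vertices. Counted as one component, the union of ℓ components thus has at least ℓ - 1 more
    -- potential than they had together.
    merge : ∀ Ks → (∀ {K} → K ∈ₗ Ks → K ∈ₗ Js) → AllPairs Disj Ks → ∀ {K} → K ∈ₗ Ks → ρ Ks + length Ks + 2 ≤ cnt (concat Ks)
    merge Ks s dis K∈ = begin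
      ρ Ks + length Ks + 2   ≡⟨ cong (_+ 2) (ρ+length Ks s) ⟩
      ∑ n (ints Ks) + 2      ≤⟨ +-monoˡ-≤ 2 (∑-mono n λ v _ → ints≤ Ks v s dis) ⟩
      ι (concat Ks) + 2      ≡⟨ sym (cnt≡ι+2 chC (∈-concat⁺′ (proj₂ (nonempty (s K∈))) K∈)) ⟩
      cnt (concat Ks)        ∎
      where
      open ≤-Reasoning
      chC : Chords (concat Ks)
      chC x∈ = let K , x∈K , K∈ = ∈-concat⁻′ Ks x∈ in ch (sub (s K∈) x∈K)

    ρ+3≤n : ∀ {J} → J ∈ₗ Js → ρ Js + 3 ≤ n
    ρ+3≤n J∈ = ≤-trans (≤-trans (subst (_≤ ρ Js + length Js + 2) (+-assoc (ρ Js) 1 2) (+-monoˡ-≤ 2 (+-monoʳ-≤ (ρ Js) (nonzero J∈))))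
                                (merge Js id disjoint J∈)) (cnt≤n (concat Js))
      where
      nonzero : ∀ {J Js} → J ∈ₗ Js → 1 ≤ length Js
      nonzero (here _)  = s≤s z≤n
      nonzero (there _) = s≤s z≤n

    module Extend {k} (k∉A : ¬ k ∈ A) where

      Touch? : ∀ J → Dec (Any (Cross k) J)
      Touch? = Any.any? (cross? k)
      Js₁ Js₀ Js⁺ : List (List Chord)
      C : List Chord
      Js₁ = filter Touch? Js
      Js₀ = filter (λ J → ¬? (Touch? J)) Js
      C = concat Js₁
      Js⁺ = (k ∷ C) ∷ Js₀

      ∈Js₁⁻ : ∀ {J} → J ∈ₗ Js₁ → J ∈ₗ Js × Any (Cross k) J
      ∈Js₁⁻ = ∈-filter⁻ Touch? {xs = Js}
      ∈Js₀⁻ : ∀ {J} → J ∈ₗ Js₀ → J ∈ₗ Js × ¬ Any (Cross k) J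
      ∈Js₀⁻ = ∈-filter⁻ (λ J → ¬? (Touch? J)) {xs = Js}

      C⊑A : C ⊑ A
      C⊑A x∈ = let K , x∈K , K∈ = ∈-concat⁻′ Js₁ x∈ in sub (proj₁ (∈Js₁⁻ K∈)) x∈K

      connected : Conn (k ∷ C)
      connected = rooted⇒conn (here refl) reach
        where
        reach : (P : Chord → Bool) → (∀ {x y} → x ∈ k ∷ C → y ∈ k ∷ C → Cross x y → P x ≡ true → P y ≡ true) →
                P k ≡ true → ∀ {y} → y ∈ k ∷ C → P y ≡ true
        reach P cl Pk (here refl) = Pk
        reach P cl Pk (there y∈) =
          let K , y∈K , K∈ = ∈-concat⁻′ Js₁ y∈
              x , x∈K , cr = find (proj₂ (∈Js₁⁻ K∈))
              lift = λ {z} (z∈ : z ∈ K) → there (∈-concat⁺′ z∈ K∈)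
          in conn (proj₁ (∈Js₁⁻ K∈)) P (λ p q → cl (lift p) (lift q)) x∈K y∈K (cl (here refl) (lift x∈K) cr Pk)

      same : ∀ {Ks : List (List Chord)} {J K x} → AllPairs Disj Ks → J ∈ₗ Ks → K ∈ₗ Ks → x ∈ J → x ∈ K → J ≡ K
      same (_ ∷ _)   (here refl) (here refl) _ _ = refl
      same (d ∷ _)   (here refl) (there q)   a b = contradiction b (All.lookup d q a)
      same (d ∷ _)   (there p)   (here refl) a b = contradiction a (All.lookup d p b)
      same (_ ∷ dis) (there p)   (there q)   a b = same dis p q a b

      extend : Sys (k ∷ A) Js⁺
      extend = record
        { conn     = λ { (here refl) → connected ; (there J∈) → conn (proj₁ (∈Js₀⁻ J∈)) }
        ; nonempty = λ { (here refl) → k , here refl ; (there J∈) → nonempty (proj₁ (∈Js₀⁻ J∈)) }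
        ; sub      = λ { (here refl) → λ { (here e) → here e ; (there x∈) → there (C⊑A x∈) }
                       ; (there J∈) → there ∘ sub (proj₁ (∈Js₀⁻ J∈)) }
        ; closed   = closed⁺
        ; cover    = cover⁺
        ; disjoint = All.tabulate apart ∷ AllPairsP.filter⁺ (λ J → ¬? (Touch? J)) disjoint
        }
        where
        closed⁺ : ∀ {J} → J ∈ₗ Js⁺ → ∀ {x y} → x ∈ J → y ∈ k ∷ A → Cross x y → y ∈ J
        closed⁺ (here refl) x∈ (here refl) cr = here refl
        closed⁺ (here refl) (here refl) (there y∈) cr =
          let K , K∈ , y∈K = cover y∈ in there (∈-concat⁺′ y∈K (∈-filter⁺ Touch? K∈ (lose y∈K cr)))
        closed⁺ (here refl) (there x∈) (there y∈) cr =
          let K , x∈K , K∈ = ∈-concat⁻′ Js₁ x∈ in there (∈-concat⁺′ (closed (proj₁ (∈Js₁⁻ K∈)) x∈K y∈ cr) K∈)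
        closed⁺ (there J∈) x∈ (here refl) cr = contradiction (lose x∈ (Cross-sym cr)) (proj₂ (∈Js₀⁻ J∈))
        closed⁺ (there J∈) x∈ (there y∈) cr = closed (proj₁ (∈Js₀⁻ J∈)) x∈ y∈ cr
        cover⁺ : ∀ {x} → x ∈ k ∷ A → ∃ λ J → J ∈ₗ Js⁺ × x ∈ J
        cover⁺ (here refl) = _ , here refl , here refl
        cover⁺ (there x∈) with cover x∈
        ... | J , J∈ , x∈J with Touch? J
        ...   | yes t = _ , here refl , there (∈-concat⁺′ x∈J (∈-filter⁺ Touch? J∈ t))
        ...   | no ¬t = J , there (∈-filter⁺ (λ J → ¬? (Touch? J)) J∈ ¬t) , x∈J
        apart : ∀ {J} → J ∈ₗ Js₀ → Disj (k ∷ C) J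
        apart J∈ (here refl) x∈J = k∉A (sub (proj₁ (∈Js₀⁻ J∈)) x∈J)
        apart {J} J∈ (there x∈) x∈J with ∈-concat⁻′ Js₁ x∈
        ... | K , x∈K , K∈ = proj₂ (∈Js₀⁻ J∈) (subst (Any (Cross k)) (same disjoint (proj₁ (∈Js₁⁻ K∈)) (proj₁ (∈Js₀⁻ J∈)) x∈K x∈J) (proj₂ (∈Js₁⁻ K∈)))

      -- Subtraction-free form of a gain of ℓ - 1 from fusing the ℓ touched components, by `merge`,
      -- plus the number of vertices that `k` adds to them.
      ρ-extend : ∀ {J} → J ∈ₗ Js → Any (Cross k) J → ρ Js + length Js₁ + cnt (k ∷ C) ≤ ρ Js⁺ + 1 + cnt C
      ρ-extend {J} J∈ t = +-cancelʳ-≤ 2 _ _ (begin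
        ρ Js + ℓ + M + 2                    ≡⟨ cong (λ r → r + ℓ + M + 2) (ρ-filter Touch? Js) ⟩
        ρ Js₁ + ρ Js₀ + ℓ + M + 2           ≡⟨ lemma₁ (ρ Js₁) (ρ Js₀) ℓ M ⟩
        ρ Js₁ + ℓ + 2 + (ρ Js₀ + M)         ≤⟨ +-mono-≤ mrg (+-monoʳ-≤ (ρ Js₀) (≤-reflexive (sym (m∸n+n≡m 3≤M)))) ⟩
        cnt C + (ρ Js₀ + (M ∸ 3 + 3))       ≡⟨ lemma₂ (cnt C) (ρ Js₀) (M ∸ 3) ⟩
        M ∸ 3 + ρ Js₀ + 1 + cnt C + 2       ∎)
        where
        open ≤-Reasoning
        ℓ = length Js₁
        M = cnt (k ∷ C)
        J∈₁ : J ∈ₗ Js₁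
        J∈₁ = ∈-filter⁺ Touch? J∈ t
        mrg : ρ Js₁ + ℓ + 2 ≤ cnt C
        mrg = merge Js₁ (proj₁ ∘ ∈Js₁⁻) (AllPairsP.filter⁺ Touch? disjoint) J∈₁
        3≤M : 3 ≤ M
        3≤M = ≤-trans (3≤cnt J∈) (cnt-mono (∈ᵥ-mono λ x∈ → there (∈-concat⁺′ x∈ J∈₁)))
        lemma₁ : ∀ a b c d → a + b + c + d + 2 ≡ a + c + 2 + (b + d)
        lemma₁ = solve-∀
        lemma₂ : ∀ a b c → a + (b + (c + 3)) ≡ c + b + 1 + a + 2
        lemma₂ = solve-∀

      -- A vertex new to `A` is also new to the touched components, and ℓ ≥ 1, so `ρ-extend` pays
      -- for every new vertex.
      ρ-extend-new : Any (Cross k) A → ρ Js + cnt (k ∷ A) ≤ ρ Js⁺ + cnt A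
      ρ-extend-new t with find t
      ... | a , a∈ , cr with cover a∈
      ...   | J , J∈ , a∈J = +-cancelʳ-≤ (1 + cnt C + M) _ _ (begin
        ρ Js + cnt (k ∷ A) + (1 + cnt C + M)          ≡⟨ lemma₁ (ρ Js) (cnt (k ∷ A)) (cnt C) M ⟩
        (ρ Js + 1 + M) + (cnt (k ∷ A) + cnt C)        ≤⟨ +-mono-≤ (≤-trans (+-monoˡ-≤ M (+-monoʳ-≤ (ρ Js) 1≤ℓ)) (ρ-extend J∈ (lose a∈J cr))) submod ⟩
        (ρ Js⁺ + 1 + cnt C) + (M + cnt A)             ≡⟨ lemma₂ (ρ Js⁺) (cnt C) M (cnt A) ⟩
        ρ Js⁺ + cnt A + (1 + cnt C + M)               ∎)
        where
        open ≤-Reasoning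
        M = cnt (k ∷ C)
        1≤ℓ : 1 ≤ length Js₁
        1≤ℓ with Js₁ | ∈-filter⁺ Touch? J∈ (lose a∈J cr)
        ... | _ ∷ _ | _ = s≤s z≤n
        lemma₁ : ∀ a b c d → a + b + (1 + c + d) ≡ (a + 1 + d) + (b + c)
        lemma₁ = solve-∀
        lemma₂ : ∀ a b c d → (a + 1 + b) + (c + d) ≡ a + d + (1 + b + c)
        lemma₂ = solve-∀
        submod : cnt (k ∷ A) + cnt C ≤ M + cnt A
        submod = subst₂ _≤_ (∑-+ n _ _) (∑-+ n _ _) (∑-mono n λ v _ → pointwise v)
          where
          pointwise : ∀ v → ind (v ∈ᵥ? (k ∷ A)) + ind (v ∈ᵥ? C) ≤ ind (v ∈ᵥ? (k ∷ C)) + ind (v ∈ᵥ? A)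
          pointwise v = bits (v ∈ᵥ? (k ∷ A)) (v ∈ᵥ? C) (v ∈ᵥ? (k ∷ C)) (v ∈ᵥ? A)
            where
            bits : (d : Dec (v ∈ᵥ k ∷ A)) (e : Dec (v ∈ᵥ C)) (f : Dec (v ∈ᵥ k ∷ C)) (g : Dec (v ∈ᵥ A)) → ind d + ind e ≤ ind f + ind g
            bits d (yes p) f g rewrite ind-yes f (there p) | ind-yes g (∈ᵥ-mono C⊑A p) = +-monoˡ-≤ 1 (ind≤1 d)
            bits (no _) (no _) f g = z≤n
            bits (yes (here e))  (no _) f g rewrite ind-yes f (here e) = s≤s z≤n
            bits (yes (there p)) (no _) f g rewrite ind-yes g p = m≤n+m 1 (ind f)

      -- If `k` touches `J` alone, the vertex `p` is gained; if it touches a second component, the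
      -- fusion already gains one, even when `p` belongs to that component.
      ρ-extend-escape : ∀ {J p} → J ∈ₗ Js → Any (Cross k) J → End p k → InRange n p → ¬ p ∈ᵥ J → ρ Js + 1 ≤ ρ Js⁺
      ρ-extend-escape {J} {p} J∈ t end rp p∉ = go Js₁ refl (∈-filter⁺ Touch? J∈ t) (ρ-extend J∈ t)
        where
        open ≤-Reasoning
        go : ∀ Ks → Ks ≡ Js₁ → J ∈ₗ Ks → ρ Js + length Ks + cnt (k ∷ concat Ks) ≤ ρ Js⁺ + 1 + cnt (concat Ks) → ρ Js + 1 ≤ ρ Js⁺
        go (.J ∷ []) _ (here refl) h = +-cancelʳ-≤ (1 + cnt (J ++ [])) _ _ (begin
          ρ Js + 1 + (1 + cnt (J ++ []))     ≤⟨ +-monoʳ-≤ (ρ Js + 1) bigger ⟩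
          ρ Js + 1 + cnt (k ∷ J ++ [])       ≤⟨ h ⟩
          ρ Js⁺ + 1 + cnt (J ++ [])          ≡⟨ +-assoc (ρ Js⁺) 1 _ ⟩
          ρ Js⁺ + (1 + cnt (J ++ []))        ∎)
          where
          J[]⊑J : J ++ [] ⊑ J
          J[]⊑J x∈ with ∈-++⁻ J x∈
          ... | inj₁ q = q
          bigger : 1 + cnt (J ++ []) ≤ cnt (k ∷ J ++ [])
          bigger = ≤-trans (≤-reflexive (trans (cong (_+ cnt (J ++ [])) (sym (∑-≟ n rp))) (sym (∑-+ n _ _))))
            (∑-mono n λ v _ → bits v (v ≟ p) (v ∈ᵥ? (J ++ [])) (v ∈ᵥ? (k ∷ J ++ [])))
            where
            bits : ∀ v (d : Dec (v ≡ p)) (e : Dec (v ∈ᵥ J ++ [])) (f : Dec (v ∈ᵥ k ∷ J ++ [])) → ind d + ind e ≤ ind f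
            bits v (yes refl) (yes q) f = contradiction (∈ᵥ-mono J[]⊑J q) p∉
            bits v (yes refl) (no _)  f = ≤-reflexive (sym (ind-yes f (here end)))
            bits v (no _)     (yes q) f = ≤-reflexive (sym (ind-yes f (there q)))
            bits v (no _)     (no _)  f = z≤n
        go (K ∷ L ∷ Ks) _ _ h = +-cancelʳ-≤ (1 + cnt D) _ _ (begin
          ρ Js + 1 + (1 + cnt D)                       ≡⟨ lemma (ρ Js) (cnt D) ⟩
          ρ Js + 2 + cnt D                             ≤⟨ +-mono-≤ (+-monoʳ-≤ (ρ Js) (s≤s (s≤s z≤n))) (cnt-mono {D} there) ⟩
          ρ Js + length (K ∷ L ∷ Ks) + cnt (k ∷ D)     ≤⟨ h ⟩
          ρ Js⁺ + 1 + cnt D                            ≡⟨ +-assoc (ρ Js⁺) 1 _ ⟩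
          ρ Js⁺ + (1 + cnt D)                          ∎)
          where
          D = concat (K ∷ L ∷ Ks)
          lemma : ∀ a b → a + 1 + (1 + b) ≡ a + 2 + b
          lemma = solve-∀

-- Minimal completions are small

module Completions (n : ℕ) (4≤n : 4 ≤ n) where

  open Potential n

  -- An uncrossed pair uw would separate `J`. Lying outside is refuted by the vertex u + 1, and
  -- lying inside forces u = 1 and w = n.
  spanning⇒covering : ∀ {J} → Conn J → Ordered J → (∀ {v} → InRange n v → v ∈ᵥ J) → Covering n J
  spanning⇒covering {J} conn ord all u w 1≤u u+1<w w≤n ne with Any.any? (cross? (u , w)) J
  ... | yes some = find some
  ... | no none with separation conn ord u w (λ x∈ cr → none (lose x∈ cr))
  ...   | inj₂ out = ⊥-elim ([ <-irrefl refl , <-irrefl refl ∘ <-≤-trans u+1<w ]′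
                       (out (all (s≤s z≤n , <⇒≤ (<-≤-trans u+1<w w≤n)))))
  ...   | inj₁ ins = contradiction
            ( ≤-antisym (proj₁ (ins (all (≤-refl , 1≤n)))) 1≤u
            , ≤-antisym w≤n (proj₂ (ins (all (1≤n , ≤-refl))))) ne
    where 1≤n = ≤-trans (s≤s z≤n) 4≤n

  singletonFree-∷ : ∀ {e A} → Any (Cross e) A → SingletonFree A → SingletonFree (e ∷ A)
  singletonFree-∷ t sf = there t ∷ All.map there sf

  -- Every added chord escapes a fixed component, so it raises ρ, and ρ + 3 ≤ n throughout.
  grow-to-feasible : ∀ {L} → Chords L → Covering n L → ∀ fuel {A Js} → Sys A Js → A ⊑ L → SingletonFree A →
    (∃ λ x → x ∈ A) → n ≤ fuel + ρ Js →
    ∃ λ Qs → (∀ {x} → x ∈ Qs → x ∈ L × ¬ x ∈ A) × Feasible n (Qs ++ A) × length Qs + ρ Js + 3 ≤ n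
  grow-to-feasible {L} chL cov fuel {A} {Js} sys A⊑L sf (x , x∈A) enough = from-component (Sys.cover sys x∈A)
    where
    chA : Chords A
    chA = chL ∘ A⊑L
    open Merge sys chA sf
    Result = ∃ λ Qs → (∀ {x} → x ∈ Qs → x ∈ L × ¬ x ∈ A) × Feasible n (Qs ++ A) × length Qs + ρ Js + 3 ≤ n
    from-component : (∃ λ J → J ∈ₗ Js × x ∈ J) → Result
    from-component (J , J∈ , x∈J) with spanning? J
    ... | inj₁ all = [] , (λ ()) , feasible-mono (Sys.sub sys J∈)
            (covering⇒feasible 4≤n (chords-inRange (chordsJ J∈)) (spanning⇒covering (Sys.conn sys J∈) (chords-ordered (chordsJ J∈)) all))
            , ρ+3≤n J∈
    ... | inj₂ (z , rz , z∉) with escaping-chord (chordsJ J∈) (Sys.conn sys J∈) x∈J cov rz z∉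
    ...   | e , e∈L , t , p , end , p∉ = add fuel enough
      where
      e∉A : ¬ e ∈ A
      e∉A e∈A = let y , y∈ , cr = find t in p∉ (∈ᵥ-intro (Sys.closed sys J∈ y∈ e∈A (Cross-sym cr)) end)
      open Extend e∉A
      gain : ρ Js + 1 ≤ ρ Js⁺
      gain = ρ-extend-escape J∈ t end (chords-inRange chL (∈ᵥ-intro e∈L end)) p∉
      touch : Any (Cross e) A
      touch = let y , y∈ , cr = find t in lose (Sys.sub sys J∈ y∈) cr
      include : (∃ λ Qs → (∀ {x} → x ∈ Qs → x ∈ L × ¬ x ∈ e ∷ A) × Feasible n (Qs ++ e ∷ A) × length Qs + ρ Js⁺ + 3 ≤ n) → Result
      include (Qs , from , feas , small) = Qs ++ [ e ] , from′ , feasible-mono assoc feas , small′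
        where
        from′ : ∀ {x} → x ∈ Qs ++ [ e ] → x ∈ L × ¬ x ∈ A
        from′ q with ∈-++⁻ Qs q
        ... | inj₁ r           = proj₁ (from r) , proj₂ (from r) ∘ there
        ... | inj₂ (here refl) = e∈L , e∉A
        assoc : Qs ++ e ∷ A ⊑ (Qs ++ [ e ]) ++ A
        assoc q with ∈-++⁻ Qs q
        ... | inj₁ r           = ∈-++⁺ˡ (∈-++⁺ˡ r)
        ... | inj₂ (here refl) = ∈-++⁺ˡ (∈-++⁺ʳ Qs (here refl))
        ... | inj₂ (there r)   = ∈-++⁺ʳ (Qs ++ [ e ]) r
        small′ : length (Qs ++ [ e ]) + ρ Js + 3 ≤ n
        small′ = ≤-trans (≤-trans (≤-reflexive (trans (cong (λ l → l + ρ Js + 3) (length-++ Qs)) (lemma (length Qs) (ρ Js))))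
                   (+-monoˡ-≤ 3 (+-monoʳ-≤ (length Qs) gain))) small
          where
          lemma : ∀ a b → a + 1 + b + 3 ≡ a + (b + 1) + 3
          lemma = solve-∀
      add : ∀ fuel → n ≤ fuel + ρ Js → Result
      add zero n≤ρ = contradiction (≤-trans (ρ+3≤n J∈) n≤ρ) (m+1+n≰m (ρ Js))
      add (suc fuel) enough =
        include (grow-to-feasible chL cov fuel extend (λ { (here refl) → e∈L ; (there q) → A⊑L q })
                   (singletonFree-∷ touch sf) (e , here refl)
                   (≤-trans enough (≤-trans (≤-reflexive (lemma fuel (ρ Js))) (+-monoʳ-≤ fuel gain))))
        where
        lemma : ∀ a b → suc a + b ≡ a + (b + 1)
        lemma = solve-∀

  module _ {S F Q : List Chord} (chS : Chords S) (F⊑S : F ⊑ S) (mc : MinimalCompletion n S F Q) where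

    private
      Q⊑S : Q ⊑ S
      Q⊑S = All.lookup (proj₁ (proj₁ mc))
      chFQ : Chords (F ++ Q)
      chFQ x∈ = chS ([ F⊑S , Q⊑S ]′ (∈-++⁻ F x∈))
      cov : Covering n (F ++ Q)
      cov = feasible⇒covering (chords-ordered chFQ) (proj₂ (proj₁ mc))
      minimal : ∀ {Q′} → Q′ ⊑ Q → Feasible n (F ++ Q′) → Q ⊑ Q′
      minimal {Q′} s feas = All.lookup (proj₂ mc Q′ (All.tabulate s) (All.tabulate (Q⊑S ∘ s) , feas))

    -- The chords found by `grow-to-feasible` lie in `Q` and already complete `F`; minimality makes
    -- them all of `Q`, so their number bounds its size.
    completion-bound : SingletonFree F → (∃ λ x → x ∈ F) → ∣ Q ++ F ∣ + ρ (𝓛 F) + 3 ≤ n + ∣ F ∣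
    completion-bound sf ne = conclude (grow-to-feasible chFQ cov n (𝓛-sys F) ∈-++⁺ˡ sf ne (m≤m+n n _))
      where
      conclude : (∃ λ Qs → (∀ {x} → x ∈ Qs → x ∈ F ++ Q × ¬ x ∈ F) × Feasible n (Qs ++ F) × length Qs + ρ (𝓛 F) + 3 ≤ n) →
                 ∣ Q ++ F ∣ + ρ (𝓛 F) + 3 ≤ n + ∣ F ∣
      conclude (Qs , from , feas , small) = begin
        ∣ Q ++ F ∣ + ρ (𝓛 F) + 3                ≤⟨ +-monoˡ-≤ 3 (+-monoˡ-≤ (ρ (𝓛 F)) size) ⟩
        length Qs + ∣ F ∣ + ρ (𝓛 F) + 3         ≡⟨ lemma (length Qs) ∣ F ∣ (ρ (𝓛 F)) ⟩
        length Qs + ρ (𝓛 F) + 3 + ∣ F ∣         ≤⟨ +-monoˡ-≤ ∣ F ∣ small ⟩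
        n + ∣ F ∣                               ∎
        where
        open ≤-Reasoning
        lemma : ∀ a b c → a + b + c + 3 ≡ a + c + 3 + b
        lemma = solve-∀
        Qs⊑Q : Qs ⊑ Q
        Qs⊑Q x∈ with ∈-++⁻ F (proj₁ (from x∈))
        ... | inj₁ p = contradiction p (proj₂ (from x∈))
        ... | inj₂ p = p
        Q⊑Qs : Q ⊑ Qs
        Q⊑Qs = minimal Qs⊑Q (feasible-mono (λ x∈ → [ ∈-++⁺ʳ F , ∈-++⁺ˡ ]′ (∈-++⁻ Qs x∈)) feas)
        size : ∣ Q ++ F ∣ ≤ length Qs + ∣ F ∣
        size = ≤-trans (∣∣≤length {Q ++ F} {Qs ++ deduplicate _≟ᶜ_ F}
                 (λ x∈ → [ ∈-++⁺ˡ ∘ Q⊑Qs , ∈-++⁺ʳ Qs ∘ ∈-deduplicate⁺ _≟ᶜ_ ]′ (∈-++⁻ Q x∈))) (≤-reflexive (length-++ Qs))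

    completion-bound-from : F ≡ [] → ∀ {A} → A ⊑ Q → SingletonFree A → (∃ λ x → x ∈ A) → ∣ Q ++ F ∣ + 3 ≤ n + length A
    completion-bound-from refl {A} A⊑Q sf ne = conclude (grow-to-feasible chFQ cov n (𝓛-sys A) A⊑Q sf ne (m≤m+n n _))
      where
      conclude : (∃ λ Qs → (∀ {x} → x ∈ Qs → x ∈ Q × ¬ x ∈ A) × Feasible n (Qs ++ A) × length Qs + ρ (𝓛 A) + 3 ≤ n) →
                 ∣ Q ++ [] ∣ + 3 ≤ n + length A
      conclude (Qs , from , feas , small) = begin
        ∣ Q ++ [] ∣ + 3                     ≤⟨ +-monoˡ-≤ 3 (∣∣≤length {Q ++ []} (λ x∈ → [ Q⊑Q′ , (λ ()) ]′ (∈-++⁻ Q x∈))) ⟩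
        length (Qs ++ A) + 3                ≡⟨ cong (_+ 3) (length-++ Qs) ⟩
        length Qs + length A + 3            ≤⟨ +-monoˡ-≤ 3 (+-monoˡ-≤ (length A) (m≤m+n (length Qs) (ρ (𝓛 A)))) ⟩
        length Qs + ρ (𝓛 A) + length A + 3  ≡⟨ lemma (length Qs + ρ (𝓛 A)) (length A) ⟩
        length Qs + ρ (𝓛 A) + 3 + length A  ≤⟨ +-monoˡ-≤ (length A) small ⟩
        n + length A                        ∎
        where
        open ≤-Reasoning
        lemma : ∀ a b → a + b + 3 ≡ a + 3 + b
        lemma = solve-∀
        Q⊑Q′ : Q ⊑ Qs ++ A
        Q⊑Q′ = minimal (λ x∈ → [ proj₁ ∘ from , A⊑Q ]′ (∈-++⁻ Qs x∈)) feas

    -- An empty `F` offers no component to grow from, so two crossing chords of `Q` take its place: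
    -- one crossing the pair 1, 3 and one crossing that chord. Their own potential is dropped; n - 1
    -- is good enough.
    completion-bound-∅ : F ≡ [] → ∣ Q ++ F ∣ + 1 ≤ n
    completion-bound-∅ refl =
      let e , e∈ , _          = cov 1 3 ≤-refl ≤-refl (≤-trans (s≤s (s≤s (s≤s z≤n))) 4≤n) (λ { (_ , refl) → <-irrefl refl 4≤n })
          p , q , r , b≢ , ne = chFQ e∈
          d , d∈ , cr         = cov (proj₁ e) (proj₂ e) p (≤∧≢⇒< q (b≢ ∘ sym)) r ne
      in +-cancelʳ-≤ 2 (∣ Q ++ [] ∣ + 1) n (subst (_≤ n + 2) (sym (+-assoc ∣ Q ++ [] ∣ 1 2))
           (completion-bound-from refl {e ∷ d ∷ []} (λ { (here refl) → e∈ ; (there (here refl)) → d∈ })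
             (there (here cr) ∷ here (Cross-sym cr) ∷ []) (e , here refl)))

-- Utility and the acceptance test in integer form

module _ where

  -- For unnormalised rationals the order is cross-multiplication of integers, so no common divisors
  -- have to be handled.
  toℚᵘ-fraction : ∀ k d m →
    ℚ.toℚᵘ ((ℤ.+ k / suc d) ℚ.* (ℤ.+ m / 1)) ℚᵘ.≃ ℚᵘ.mkℚᵘ (ℤ.+ k) d ℚᵘ.* ℚᵘ.mkℚᵘ (ℤ.+ m) 0
  toℚᵘ-fraction k d m = ℚᵘP.≃-trans (ℚP.toℚᵘ-homo-* (ℤ.+ k / suc d) (ℤ.+ m / 1))
    (ℚᵘP.*-cong (ℚP.toℚᵘ-fromℚᵘ (ℚᵘ.mkℚᵘ (ℤ.+ k) d)) (ℚP.toℚᵘ-fromℚᵘ (ℚᵘ.mkℚᵘ (ℤ.+ m) 0)))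

  toℚᵘ-integer : ∀ z → ℚ.toℚᵘ (z / 1) ℚᵘ.≃ ℚᵘ.mkℚᵘ z 0
  toℚᵘ-integer z = ℚP.toℚᵘ-fromℚᵘ (ℚᵘ.mkℚᵘ z 0)

  fraction≤⁻ : ∀ k d m z → (ℤ.+ k / suc d) ℚ.* (ℤ.+ m / 1) ℚ.≤ z / 1 → ℤ.+ k ℤ.* ℤ.+ m ℤ.≤ z ℤ.* ℤ.+ suc d
  fraction≤⁻ k d m z h with ℚᵘP.≤-respʳ-≃ (toℚᵘ-integer z) (ℚᵘP.≤-respˡ-≃ (toℚᵘ-fraction k d m) (ℚP.toℚᵘ-mono-≤ h))
  ... | ℚᵘ.*≤* q = subst₂ ℤ._≤_ (ℤP.*-identityʳ _) (cong (λ e → z ℤ.* ℤ.+ suc e) (*-identityʳ d)) q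

  fraction≤⁺ : ∀ k d m z → ℤ.+ k ℤ.* ℤ.+ m ℤ.≤ z ℤ.* ℤ.+ suc d → (ℤ.+ k / suc d) ℚ.* (ℤ.+ m / 1) ℚ.≤ z / 1
  fraction≤⁺ k d m z q = ℚP.toℚᵘ-cancel-≤ (ℚᵘP.≤-respʳ-≃ (ℚᵘP.≃-sym (toℚᵘ-integer z))
    (ℚᵘP.≤-respˡ-≃ (ℚᵘP.≃-sym (toℚᵘ-fraction k d m))
      (ℚᵘ.*≤* (subst₂ ℤ._≤_ (sym (ℤP.*-identityʳ _)) (cong (λ e → z ℤ.* ℤ.+ suc e) (sym (*-identityʳ d))) q))))

  ratio-bound : ∀ a m → 121 * a ≤ 233 * m → ℕtoℚ a ℚ.≤ (ℤ.+ 233 / 121) ℚ.* ℕtoℚ m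
  ratio-bound a m h = ℚP.toℚᵘ-cancel-≤ (ℚᵘP.≤-respˡ-≃ (ℚᵘP.≃-sym (toℚᵘ-integer (ℤ.+ a)))
    (ℚᵘP.≤-respʳ-≃ (ℚᵘP.≃-sym (toℚᵘ-fraction 233 120 m))
      (ℚᵘ.*≤* (subst₂ ℤ._≤_ (ℤP.pos-* a 121) (trans (ℤP.pos-* 233 m) (sym (ℤP.*-identityʳ _)))
        (ℤ.+≤+ (≤-trans (≤-reflexive (*-comm a 121)) h))))))

  utility-diff : (f r f′ r′ : ℕ) → ℤ
  utility-diff f r f′ r′ = (ℤ.- (ℤ.+ f′) ℤ.+ ℤ.+ r′) ℤ.- (ℤ.- (ℤ.+ f) ℤ.+ ℤ.+ r)

  private
    pos-linear : ∀ a b → ℤ.+ (11 * a + 11 * b) ≡ ℤ.+ 11 ℤ.* ℤ.+ a ℤ.+ ℤ.+ 11 ℤ.* ℤ.+ b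
    pos-linear a b = trans (ℤP.pos-+ (11 * a) (11 * b)) (cong₂ ℤ._+_ (ℤP.pos-* 11 a) (ℤP.pos-* 11 b))

    expand : ∀ f r f′ r′ → utility-diff f r f′ r′ ℤ.* ℤ.+ 11 ℤ.+ ℤ.+ (11 * f′ + 11 * r) ≡ ℤ.+ (11 * r′ + 11 * f)
    expand f r f′ r′ = trans (cong (λ s → utility-diff f r f′ r′ ℤ.* ℤ.+ 11 ℤ.+ s) (pos-linear f′ r))
      (trans (lemma (ℤ.+ f) (ℤ.+ r) (ℤ.+ f′) (ℤ.+ r′)) (sym (pos-linear r′ f)))
      where
      lemma : ∀ f r f′ r′ → ((ℤ.- f′ ℤ.+ r′) ℤ.- (ℤ.- f ℤ.+ r)) ℤ.* ℤ.+ 11 ℤ.+ (ℤ.+ 11 ℤ.* f′ ℤ.+ ℤ.+ 11 ℤ.* r) ≡ ℤ.+ 11 ℤ.* r′ ℤ.+ ℤ.+ 11 ℤ.* f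
      lemma = ℤ-solve-∀

    collect : ∀ r f′ m → ℤ.+ 3 ℤ.* ℤ.+ m ℤ.+ ℤ.+ (11 * f′ + 11 * r) ≡ ℤ.+ (3 * m + (11 * f′ + 11 * r))
    collect r f′ m = trans (cong (λ x → x ℤ.+ ℤ.+ (11 * f′ + 11 * r)) (sym (ℤP.pos-* 3 m))) (sym (ℤP.pos-+ (3 * m) _))

  -- 3/11 = 1 − 8/11
  accept⁻ : ∀ f r f′ r′ m → ℤtoℚ (utility-diff f r f′ r′) ℚ.≥ (ℚ.1ℚ ℚ.- (ℤ.+ 8 / 11)) ℚ.* ℕtoℚ m →
            3 * m + (11 * f′ + 11 * r) ≤ 11 * r′ + 11 * f
  accept⁻ f r f′ r′ m h = ℤP.drop‿+≤+ (subst₂ ℤ._≤_ (collect r f′ m) (expand f r f′ r′)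
    (ℤP.+-monoˡ-≤ (ℤ.+ (11 * f′ + 11 * r)) (fraction≤⁻ 3 10 m (utility-diff f r f′ r′) h)))

  accept⁺ : ∀ f r f′ r′ m → 3 * m + (11 * f′ + 11 * r) ≤ 11 * r′ + 11 * f →
            ℤtoℚ (utility-diff f r f′ r′) ℚ.≥ (ℚ.1ℚ ℚ.- (ℤ.+ 8 / 11)) ℚ.* ℕtoℚ m
  accept⁺ f r f′ r′ m h = fraction≤⁺ 3 10 m (utility-diff f r f′ r′)
    (cancel (ℤ.+ (11 * f′ + 11 * r)) (subst₂ ℤ._≤_ (sym (collect r f′ m)) (sym (expand f r f′ r′)) (ℤ.+≤+ h)))
    where
    cancel : ∀ c {a b} → a ℤ.+ c ℤ.≤ b ℤ.+ c → a ℤ.≤ b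
    cancel c {a} {b} q = subst₂ ℤ._≤_ (undo a c) (undo b c) (ℤP.+-monoˡ-≤ (ℤ.- c) q)
      where
      undo : ∀ x c → x ℤ.+ c ℤ.+ ℤ.- c ≡ x
      undo = ℤ-solve-∀

module Utility (n : ℕ) where

  open Potential n

  U≡ : ∀ {F} → Chords F → SingletonFree F → U F ≡ ℤ.- (ℤ.+ ∣ F ∣) ℤ.+ ℤ.+ ρ (𝓛 F)
  U≡ {F} ch sf = cong (λ s → ℤ.- (ℤ.+ ∣ F ∣) ℤ.+ s) (fold (𝓛 F) id)
    where
    open Merge (𝓛-sys F) ch sf
    fold : ∀ Js → (∀ {J} → J ∈ₗ Js → J ∈ₗ 𝓛 F) →
           foldr (λ J s → ((ℤ.+ ∣V∣ J) ℤ.- ℤ.+ 3) ℤ.+ s) (ℤ.+ 0) Js ≡ ℤ.+ ρ Js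
    fold []       s = refl
    fold (J ∷ Js) s = trans (cong₂ ℤ._+_ summand (fold Js (s ∘ there))) (sym (ℤP.pos-+ (cnt J ∸ 3) (ρ Js)))
      where
      summand : (ℤ.+ ∣V∣ J) ℤ.- ℤ.+ 3 ≡ ℤ.+ (cnt J ∸ 3)
      summand = trans (cong (λ m → (ℤ.+ m) ℤ.- ℤ.+ 3) (∣V∣≡cnt J (chords-inRange (chordsJ (s (here refl))))))
                      (ℤP.⊖-≥ (3≤cnt (s (here refl))))

  -- The acceptance tests telescope, and the new vertices of all rounds together make up V(F). The
  -- last conjunct is U(F) ≥ 3/11 |V(F)| without fractions or subtraction.
  Reachable-invariant : ∀ {S N F} → Chords S → Reachable S (ℤ.+ 8 / 11) N F →
    F ⊑ S × SingletonFree F × 3 * cnt F + 11 * ∣ F ∣ ≤ 11 * ρ (𝓛 F)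
  Reachable-invariant chS start = (λ ()) , [] , ≤-reflexive (cong (λ c → 3 * c + 0) (∑-0 n))
  Reachable-invariant {S} chS (step {F} {K} reach (_ , KS , _ , sf′ , gain)) = FK⊑S , sf′ , total
    where
    F⊑S = proj₁ (Reachable-invariant chS reach)
    sf  = proj₁ (proj₂ (Reachable-invariant chS reach))
    ih  = proj₂ (proj₂ (Reachable-invariant chS reach))
    FK⊑S : F ++ K ⊑ S
    FK⊑S x∈ = [ F⊑S , proj₁ ∘ All.lookup KS ]′ (∈-++⁻ F x∈)
    f = ∣ F ∣
    f′ = ∣ F ++ K ∣
    r = ρ (𝓛 F)
    r′ = ρ (𝓛 (F ++ K))
    m = newVertices F K
    step-gain : 3 * m + (11 * f′ + 11 * r) ≤ 11 * r′ + 11 * f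
    step-gain = accept⁻ f r f′ r′ m (subst (λ z → ℤtoℚ z ℚ.≥ (ℚ.1ℚ ℚ.- (ℤ.+ 8 / 11)) ℚ.* ℕtoℚ m)
      (cong₂ ℤ._-_ (U≡ (chS ∘ FK⊑S) sf′) (U≡ (chS ∘ F⊑S) sf)) gain)
    total : 3 * cnt (F ++ K) + 11 * f′ ≤ 11 * r′
    total = +-cancelʳ-≤ (11 * r + 11 * f) _ _ (begin
      3 * cnt (F ++ K) + 11 * f′ + (11 * r + 11 * f)   ≡⟨ cong (λ c → 3 * c + 11 * f′ + (11 * r + 11 * f)) (sym (newVertices+cnt F K (chords-inRange (chS ∘ FK⊑S)))) ⟩
      3 * (m + cnt F) + 11 * f′ + (11 * r + 11 * f)    ≡⟨ lemma₁ m (cnt F) (11 * f′) (11 * r) (11 * f) ⟩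
      (3 * m + (11 * f′ + 11 * r)) + (3 * cnt F + 11 * f) ≤⟨ +-mono-≤ step-gain ih ⟩
      (11 * r′ + 11 * f) + 11 * r                      ≡⟨ lemma₂ (11 * r′) (11 * f) (11 * r) ⟩
      11 * r′ + (11 * r + 11 * f)                      ∎)
      where
      open ≤-Reasoning
      lemma₁ : ∀ m c f′ r f → 3 * (m + c) + f′ + (r + f) ≡ (3 * m + (f′ + r)) + (3 * c + f)
      lemma₁ = solve-∀
      lemma₂ : ∀ a b c → (a + b) + c ≡ a + (c + b)
      lemma₂ = solve-∀

-- Trees of crossing chords

-- `join` hangs the second tree below the root of the first, so repeated joins give rooted trees of
-- arbitrary degree with binary induction.
data Tree : Chord → Set where
  leaf : ∀ c → Tree c
  join : ∀ {c d} → Tree c → Tree d → Cross c d → Tree c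

nodes : ∀ {c} → Tree c → List Chord
nodes (leaf c)      = [ c ]
nodes (join T T′ _) = nodes T ++ nodes T′

size : ∀ {c} → Tree c → ℕ
size T = length (nodes T)

size-join : ∀ {c d} (T : Tree c) (T′ : Tree d) (cr : Cross c d) → size (join T T′ cr) ≡ size T + size T′
size-join T T′ cr = length-++ (nodes T)

nodes-root : ∀ {c} (T : Tree c) → ∃ λ rest → nodes T ≡ c ∷ rest
nodes-root (leaf c) = [] , refl
nodes-root (join T T′ _) = let rest , e = nodes-root T in rest ++ nodes T′ , cong (_++ nodes T′) e

root∈ : ∀ {c} (T : Tree c) → c ∈ nodes T
root∈ T = let _ , e = nodes-root T in subst (_ ∈_) (sym e) (here refl)

1≤size : ∀ {c} (T : Tree c) → 1 ≤ size T
1≤size T = subst (λ L → 1 ≤ length L) (sym (proj₂ (nodes-root T))) (s≤s z≤n)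

tree-conn : ∀ {c} (T : Tree c) → Conn (nodes T)
tree-conn (leaf c)       = conn-[ c ]
tree-conn (join T T′ cr) = conn-++ (tree-conn T) (tree-conn T′) (root∈ T) (root∈ T′) cr

any-++ˡ : ∀ {P : Chord → Set} {L M} → Any P L → Any P (L ++ M)
any-++ˡ p = let x , x∈ , q = find p in lose (∈-++⁺ˡ x∈) q

any-++ʳ : ∀ {P : Chord → Set} L {M} → Any P M → Any P (L ++ M)
any-++ʳ L p = let x , x∈ , q = find p in lose (∈-++⁺ʳ L x∈) q

-- Only the root can lack a crossing partner in its own subtree; the next `join` supplies one, which
-- carries the induction.
crossed-or-root : ∀ {c} (T : Tree c) {x} → x ∈ nodes T → Any (Cross x) (nodes T) ⊎ x ≡ c
crossed-or-root (leaf c) (here refl) = inj₂ refl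
crossed-or-root (join T T′ cr) x∈ with ∈-++⁻ (nodes T) x∈
... | inj₁ p with crossed-or-root T p
...   | inj₁ q    = inj₁ (any-++ˡ q)
...   | inj₂ refl = inj₁ (lose (∈-++⁺ʳ (nodes T) (root∈ T′)) cr)
crossed-or-root (join T T′ cr) x∈ | inj₂ p with crossed-or-root T′ p
...   | inj₁ q    = inj₁ (any-++ʳ (nodes T) q)
...   | inj₂ refl = inj₁ (lose (∈-++⁺ˡ (root∈ T)) (Cross-sym cr))

tree-crossed : ∀ {c} (T : Tree c) → 2 ≤ size T → ∀ {x} → x ∈ nodes T → Any (Cross x) (nodes T)
tree-crossed (leaf c) (s≤s ())
tree-crossed (join T T′ cr) _ x∈ with crossed-or-root (join T T′ cr) x∈
... | inj₁ q    = q
... | inj₂ refl = lose (∈-++⁺ʳ (nodes T) (root∈ T′)) cr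

-- Descending into the last subtree ends at a leaf different from the root; removing it keeps the
-- tree connected and rooted at `c`.
prune : ∀ {c} (T : Tree c) k → size T ≡ 2 + k →
  ∃ λ (T′ : Tree c) → size T′ ≡ 1 + k × nodes T′ ⊑ nodes T × (∃ λ d → nodes T ⊑ d ∷ nodes T′)
prune (leaf c) k ()
prune (join T (leaf d) cr) k e = T , suc-injective (trans (sym (trans (size-join T (leaf d) cr) (+-comm (size T) 1))) e)
  , ∈-++⁺ˡ , d , λ x∈ → [ there , (λ { (here refl) → here refl }) ]′ (∈-++⁻ (nodes T) x∈)
prune (join {d = d} T T₁@(join T₂ T₃ cr′) cr) k e with prune T₁ (size T₁ ∸ 2) (sym (m+[n∸m]≡n 2≤))
  where
  2≤ : 2 ≤ size T₁
  2≤ = subst (2 ≤_) (sym (size-join T₂ T₃ cr′)) (+-mono-≤ (1≤size T₂) (1≤size T₃))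
... | T′ , e′ , s , x , t = join T T′ cr , suc-injective total
  , (λ y∈ → [ ∈-++⁺ˡ , ∈-++⁺ʳ (nodes T) ∘ s ]′ (∈-++⁻ (nodes T) y∈)) , x
  , (λ y∈ → [ there ∘ ∈-++⁺ˡ , split ∘ t ]′ (∈-++⁻ (nodes T) y∈))
  where
  split : ∀ {y} → y ∈ x ∷ nodes T′ → y ∈ x ∷ nodes T ++ nodes T′
  split (here e)  = here e
  split (there p) = there (∈-++⁺ʳ (nodes T) p)
  2≤ : 2 ≤ size T₁
  2≤ = subst (2 ≤_) (sym (size-join T₂ T₃ cr′)) (+-mono-≤ (1≤size T₂) (1≤size T₃))
  total : suc (size (join T T′ cr)) ≡ suc (suc k)
  total = trans (cong suc (size-join T T′ cr)) (trans (sym (+-suc (size T) (size T′)))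
    (trans (cong (λ l → size T + l) (trans (cong suc e′) (m+[n∸m]≡n 2≤))) (trans (sym (size-join T T₁ cr)) e)))

attach : ∀ {c e} (T : Tree c) → Any (Cross e) (nodes T) →
  ∃ λ (T′ : Tree c) → size T′ ≡ suc (size T) × nodes T′ ⊑ e ∷ nodes T × e ∷ nodes T ⊑ nodes T′
attach {e = e} (leaf c) (here cr) = join (leaf c) (leaf e) (Cross-sym cr) , refl
  , (λ { (here p) → there (here p) ; (there (here p)) → here p })
  , (λ { (here p) → there (here p) ; (there (here p)) → here p })
attach {e = e} (join T T′ cr) t with find t
... | x , x∈ , xr with ∈-++⁻ (nodes T) x∈
...   | inj₁ p = let R , l , s , u = attach T (lose p xr) in join R T′ cr
  , trans (size-join R T′ cr) (trans (cong (_+ size T′) l) (cong suc (sym (size-join T T′ cr))))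
  , (λ y∈ → [ (λ q → ∈-++⁺ˡ {xs = e ∷ nodes T} (s q)) , ∈-++⁺ʳ (e ∷ nodes T) ]′ (∈-++⁻ (nodes R) y∈))
  , (λ y∈ → [ ∈-++⁺ˡ ∘ u , ∈-++⁺ʳ (nodes R) ]′ (∈-++⁻ (e ∷ nodes T) y∈))
...   | inj₂ p = let R , l , s , u = attach T′ (lose p xr) in join T R cr
  , trans (size-join T R cr) (trans (cong (λ m → size T + m) l) (trans (+-suc (size T) (size T′)) (cong suc (sym (size-join T T′ cr)))))
  , (λ y∈ → [ there ∘ ∈-++⁺ˡ , up s ]′ (∈-++⁻ (nodes T) y∈))
  , (λ { (here q) → ∈-++⁺ʳ (nodes T) (u (here q)) ; (there q) → [ ∈-++⁺ˡ , ∈-++⁺ʳ (nodes T) ∘ u ∘ there ]′ (∈-++⁻ (nodes T) q) })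
  where
  up : ∀ {L y} → L ⊑ e ∷ nodes T′ → y ∈ L → y ∈ e ∷ nodes T ++ nodes T′
  up s q with s q
  ... | here r  = here r
  ... | there r = there (∈-++⁺ʳ (nodes T) r)

module Trees (n : ℕ) where

  open Potential n

  -- Each removed chord takes away at most two vertices of weight at most 121, hence 242.
  prune-to : ∀ w → (∀ v → w v ≤ 121) → ∀ {c} j k (T : Tree c) → size T ≡ j + (1 + k) →
    ∃ λ (T′ : Tree c) → size T′ ≡ 1 + k × nodes T′ ⊑ nodes T × wt w (nodes T) ≤ 242 * j + wt w (nodes T′)
  prune-to w w≤ zero    k T e = T , e , id , ≤-refl
  prune-to w w≤ (suc j) k T e with prune T (j + k) (trans e (cong suc (+-suc j k)))
  ... | T₁ , e₁ , s₁ , d , t₁ with prune-to w w≤ j k T₁ (trans e₁ (sym (+-suc j k)))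
  ...   | T₂ , e₂ , s₂ , b = T₂ , e₂ , s₁ ∘ s₂ , (begin
    wt w (nodes T)                      ≤⟨ wt-⊑ w t₁ ⟩
    wt w (d ∷ nodes T₁)                 ≤⟨ wt-∷ w w≤ d (nodes T₁) ⟩
    242 + wt w (nodes T₁)               ≤⟨ +-monoʳ-≤ 242 b ⟩
    242 + (242 * j + wt w (nodes T₂))   ≡⟨ sym (+-assoc 242 (242 * j) _) ⟩
    242 + 242 * j + wt w (nodes T₂)     ≡⟨ cong (_+ wt w (nodes T₂)) (sym (*-suc 242 j)) ⟩
    242 * suc j + wt w (nodes T₂)       ∎)
    where open ≤-Reasoning

  SpanningTree : List Chord → Set
  SpanningTree O = ∃ λ c → Σ (Tree c) λ T → nodes T ⊑ O × size T ≤ ∣ O ∣ × (∀ {v} → InRange n v → v ∈ᵥ nodes T)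

  -- As long as a vertex is uncovered, an escaping chord can be attached. The duplicate-free copy
  -- `M` of the nodes bounds their number by `∣ O ∣`, which also limits the fuel.
  grow-tree : ∀ {O} → Chords O → Covering n O → ∀ fuel {c} (T : Tree c) M → Unique M → M ⊑ O →
    nodes T ⊑ M → M ⊑ nodes T → length M ≡ size T → ∣ O ∣ ≤ fuel + length M → SpanningTree O
  grow-tree {O} chO cov fuel {c} T M u M⊑O T⊑M M⊑T len enough with spanning? (nodes T)
  ... | inj₁ all = c , T , M⊑O ∘ T⊑M , ≤-trans (≤-reflexive (sym len)) (unique-⊑⇒length≤∣∣ {Y = O} u M⊑O) , all
  ... | inj₂ (z , rz , z∉) with escaping-chord (chO ∘ M⊑O ∘ T⊑M) (tree-conn T) (root∈ T) cov rz z∉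
  ...   | e , e∈ , t , p , end , p∉ with attach T t
  ...     | T′ , l , s , r = add fuel enough
    where
    M′-unique : Unique (e ∷ M)
    M′-unique = All.tabulate (λ { x∈ refl → p∉ (∈ᵥ-intro (M⊑T x∈) end) }) ∷ u
    M′⊑O : e ∷ M ⊑ O
    M′⊑O (here refl) = e∈
    M′⊑O (there q)   = M⊑O q
    lift : ∀ {L L′ : List Chord} → L ⊑ L′ → e ∷ L ⊑ e ∷ L′
    lift s (here q)  = here q
    lift s (there q) = there (s q)
    add : ∀ fuel → ∣ O ∣ ≤ fuel + length M → SpanningTree O
    add zero enough = contradiction (≤-trans (unique-⊑⇒length≤∣∣ {Y = O} M′-unique M′⊑O) enough) (<-irrefl refl)
    add (suc fuel) enough = grow-tree chO cov fuel T′ (e ∷ M) M′-unique M′⊑O (lift T⊑M ∘ s) (r ∘ lift M⊑T)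
      (trans (cong suc len) (sym l)) (≤-trans enough (≤-reflexive (sym (+-suc fuel (length M)))))

  spanning-tree : ∀ {O} → 4 ≤ n → Chords O → Covering n O → SpanningTree O
  spanning-tree {O} 4≤n chO cov =
    let e , e∈ , _ = cov 1 3 ≤-refl ≤-refl (≤-trans (s≤s (s≤s (s≤s z≤n))) 4≤n) (λ { (_ , refl) → <-irrefl refl 4≤n })
    in grow-tree chO cov ∣ O ∣ (leaf e) [ e ] ([] ∷ []) (λ { (here refl) → e∈ }) id id refl (m≤m+n ∣ O ∣ 1)

  -- `A′` is the union of `A` and `L` as a set; `gain` says that the potential grows by at least the
  -- number of vertices new to `A`.
  record Absorbed (A : List Chord) (Js : List (List Chord)) (L : List Chord) : Set where
    field
      A′   : List Chord
      Js′  : List (List Chord)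
      sys′ : Sys A′ Js′
      sf′  : SingletonFree A′
      A⊑   : A ⊑ A′
      L⊑   : L ⊑ A′
      ⊑AL  : A′ ⊑ A ++ L
      gain : ρ Js + cnt A′ ≤ ρ Js′ + cnt A

  Touching : List Chord → Chord → Set
  Touching A x = x ∈ A ⊎ Any (Cross x) A

  Touching? : ∀ A x → Dec (Touching A x)
  Touching? A x = (x ∈? A) ⊎-dec Any.any? (cross? x) A

  absorb-trans : ∀ {A Js L M} (a : Absorbed A Js L) → Absorbed (Absorbed.A′ a) (Absorbed.Js′ a) M → ∀ {N} →
    N ⊑ L ++ M → L ++ M ⊑ N → Absorbed A Js N
  absorb-trans {A} {Js} {L} {M} a b {N} s t = record
    { A′ = B.A′ ; Js′ = B.Js′ ; sys′ = B.sys′ ; sf′ = B.sf′ ; A⊑ = B.A⊑ ∘ P.A⊑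
    ; L⊑ = λ x∈ → [ B.A⊑ ∘ P.L⊑ , B.L⊑ ]′ (∈-++⁻ L (s x∈))
    ; ⊑AL = λ x∈ → [ (λ y∈ → [ ∈-++⁺ˡ , ∈-++⁺ʳ A ∘ t ∘ ∈-++⁺ˡ ]′ (∈-++⁻ A (P.⊑AL y∈))) , ∈-++⁺ʳ A ∘ t ∘ ∈-++⁺ʳ L ]′ (∈-++⁻ P.A′ (B.⊑AL x∈))
    ; gain = +-cancelʳ-≤ (ρ P.Js′ + cnt P.A′) _ _ (begin
        ρ Js + cnt B.A′ + (ρ P.Js′ + cnt P.A′)        ≡⟨ lemma (ρ Js) (cnt B.A′) (ρ P.Js′) (cnt P.A′) ⟩
        (ρ Js + cnt P.A′) + (ρ P.Js′ + cnt B.A′)      ≤⟨ +-mono-≤ P.gain B.gain ⟩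
        (ρ P.Js′ + cnt A) + (ρ B.Js′ + cnt P.A′)      ≡⟨ lemma (ρ P.Js′) (cnt A) (ρ B.Js′) (cnt P.A′) ⟩
        (ρ P.Js′ + cnt P.A′) + (ρ B.Js′ + cnt A)      ≡⟨ +-comm (ρ P.Js′ + cnt P.A′) _ ⟩
        ρ B.Js′ + cnt A + (ρ P.Js′ + cnt P.A′)        ∎) }
    where
    module P = Absorbed a
    module B = Absorbed b
    open ≤-Reasoning
    lemma : ∀ a b c d → a + b + (c + d) ≡ (a + d) + (c + b)
    lemma = solve-∀

  -- Absorption begins in the subtree that touches `A`; the other one then touches through the
  -- crossing of the two roots. Hence every chord is added while it crosses the present set, and
  -- `ρ-extend-new` applies.
  absorb-tree : ∀ {c} (T : Tree c) → Chords (nodes T) → ∀ {A Js} → Sys A Js → Chords A → SingletonFree A →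
    Any (Touching A) (nodes T) → Absorbed A Js (nodes T)
  absorb-tree (leaf c) chT {A} {Js} sys chA sf t with c ∈? A
  ... | yes c∈ = record { A′ = A ; Js′ = Js ; sys′ = sys ; sf′ = sf ; A⊑ = id ; L⊑ = λ { (here refl) → c∈ } ; ⊑AL = ∈-++⁺ˡ ; gain = ≤-refl }
  absorb-tree (leaf c) chT {A} {Js} sys chA sf (here (inj₁ c∈)) | no c∉ = contradiction c∈ c∉
  absorb-tree (leaf c) chT {A} {Js} sys chA sf (here (inj₂ t))  | no c∉ = record
    { A′ = c ∷ A ; Js′ = Js⁺ ; sys′ = extend ; sf′ = there t ∷ All.map there sf ; A⊑ = there
    ; L⊑ = λ { (here refl) → here refl } ; ⊑AL = λ { (here refl) → ∈-++⁺ʳ A (here refl) ; (there p) → ∈-++⁺ˡ p }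
    ; gain = ρ-extend-new t }
    where
    open Merge sys chA sf
    open Extend c∉
  absorb-tree (join {c} {d} T T′ cr) chT {A} {Js} sys chA sf t = [ first , second ]′ (touched t)
    where
    chT₁ : Chords (nodes T)
    chT₁ = chT ∘ ∈-++⁺ˡ
    chT₂ : Chords (nodes T′)
    chT₂ = chT ∘ ∈-++⁺ʳ (nodes T)
    touched : Any (Touching A) (nodes T ++ nodes T′) → Any (Touching A) (nodes T) ⊎ Any (Touching A) (nodes T′)
    touched t with find t
    ... | x , x∈ , q with ∈-++⁻ (nodes T) x∈
    ...   | inj₁ p = inj₁ (lose p q)
    ...   | inj₂ p = inj₂ (lose p q)
    chAL : ∀ {L A′} → Chords L → A′ ⊑ A ++ L → Chords A′
    chAL chL s x∈ = [ chA , chL ]′ (∈-++⁻ A (s x∈))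
    first : Any (Touching A) (nodes T) → Absorbed A Js (nodes T ++ nodes T′)
    first t₁ = absorb-trans a (absorb-tree T′ chT₂ P.sys′ (chAL chT₁ P.⊑AL) P.sf′
                 (lose (root∈ T′) (inj₂ (lose (P.L⊑ (root∈ T)) (Cross-sym cr))))) id id
      where
      a = absorb-tree T chT₁ sys chA sf t₁
      module P = Absorbed a
    second : Any (Touching A) (nodes T′) → Absorbed A Js (nodes T ++ nodes T′)
    second t₂ = absorb-trans a (absorb-tree T chT₁ P.sys′ (chAL chT₂ P.⊑AL) P.sf′
                  (lose (root∈ T) (inj₂ (lose (P.L⊑ (root∈ T′)) cr))))
                  (λ x∈ → [ ∈-++⁺ʳ (nodes T′) , ∈-++⁺ˡ ]′ (∈-++⁻ (nodes T) x∈))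
                  (λ x∈ → [ ∈-++⁺ʳ (nodes T) , ∈-++⁺ˡ ]′ (∈-++⁻ (nodes T′) x∈))
      where
      a = absorb-tree T′ chT₂ sys chA sf t₂
      module P = Absorbed a

-- The lower bound on OPT

module _ where

  private
    eq₁ : ∀ a b → 88 * (12 + a) + 33 * (9 + b) ≡ 88 * a + 33 * b + 1353
    eq₁ = solve-∀
    eq₂ : ∀ p q a → 88 * p + 33 * q + 33 * a ≡ 88 * p + 33 * (q + a)
    eq₂ = solve-∀
    eq₃ : ∀ b p → 88 * p + 33 * (b + p) ≡ 33 * b + 121 * p
    eq₃ = solve-∀
    eq₄ : ∀ a b → 33 * b + 121 * (11 + a) ≡ 88 * a + 33 * b + 1331 + 33 * a
    eq₄ = solve-∀

  -- 1353 = 88 · 12 + 33 · 9: a heavier seven-node tree covers 12 vertices besides those of its root,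
  -- at least 10 of them outside V(F).
  many-new : ∀ {p q a b} → p ≤ 12 + a → ¬ (88 * p + 33 * q ≤ 88 * a + 33 * b + 1353) → 10 + b ≤ q
  many-new {p} {q} {a} {b} p≤ heavy = ≰⇒> λ q≤ → heavy (≤-trans (+-mono-≤ (*-monoʳ-≤ 88 p≤) (*-monoʳ-≤ 33 q≤)) (≤-reflexive (eq₁ a b)))

  -- Eleven vertices besides those of the root weigh at most 11 · 121 = 1331, which is below 1353.
  -- The first hypothesis says that no more of these vertices are fresh than there are.
  all-distinct : ∀ {p q a b} → q + a ≤ b + p → ¬ (88 * p + 33 * q ≤ 88 * a + 33 * b + 1353) → 12 + a ≤ p
  all-distinct {p} {q} {a} {b} qa≤ heavy = ≰⇒> λ p≤ → heavy (≤-trans (+-cancelʳ-≤ (33 * a) _ _ (begin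
    88 * p + 33 * q + 33 * a             ≡⟨ eq₂ p q a ⟩
    88 * p + 33 * (q + a)                ≤⟨ +-monoʳ-≤ (88 * p) (*-monoʳ-≤ 33 qa≤) ⟩
    88 * p + 33 * (b + p)                ≡⟨ eq₃ b p ⟩
    33 * b + 121 * p                     ≤⟨ +-monoʳ-≤ (33 * b) (*-monoʳ-≤ 121 p≤) ⟩
    33 * b + 121 * (11 + a)              ≡⟨ eq₄ a b ⟩
    88 * a + 33 * b + 1331 + 33 * a      ∎)) (+-monoʳ-≤ (88 * a + 33 * b) (m≤m+n 1331 22)))
    where open ≤-Reasoning

++-⊑-++∖ : ∀ F P → F ++ P ⊑ F ++ (P ∖ F)
++-⊑-++∖ F P {x} x∈ with ∈-++⁻ F x∈
... | inj₁ p = ∈-++⁺ˡ p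
... | inj₂ p with x ∈? F
...   | yes q = ∈-++⁺ˡ q
...   | no ¬q = ∈-++⁺ʳ F (∈-filter⁺ (λ x → ¬? (x ∈? F)) p ¬q)

module LowerBound (n : ℕ) {S : List Chord} (chS : Polygon.Chords n S) {N : ℕ} (9≤N : 9 ≤ N) {F : List Chord}
                  (crit : Critical S (ℤ.+ 8 / 11) N F) where

  open Potential n
  open Trees n
  open Utility n

  private
    F⊑S : F ⊑ S
    F⊑S = All.lookup (proj₁ crit)
    chF : Chords F
    chF = chS ∘ F⊑S
    sfF : SingletonFree F
    sfF = proj₁ (proj₂ crit)

  fresh : ℕ → ℕ
  fresh v = ind (¬? (v ∈ᵥ? F))

  weight : ℕ → ℕ
  weight v = 88 + 33 * fresh v

  weight≤121 : ∀ v → weight v ≤ 121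
  weight≤121 v = +-monoʳ-≤ 88 (*-monoʳ-≤ 33 (ind≤1 (¬? (v ∈ᵥ? F))))

  wt-weight : ∀ L → wt weight L ≡ 88 * cnt L + 33 * wt fresh L
  wt-weight L = trans (∑-cong n λ v _ → lemma (ind (v ∈ᵥ? L)) (fresh v))
    (trans (∑-+ n _ _) (cong₂ _+_ (∑-* n 88 _) (∑-* n 33 _)))
    where
    lemma : ∀ a b → a * (88 + 33 * b) ≡ 88 * a + 33 * (a * b)
    lemma = solve-∀

  cnt-++-fresh : ∀ L → cnt (F ++ L) ≡ cnt F + wt fresh L
  cnt-++-fresh L = trans (∑-cong n λ v _ → bits v (v ∈ᵥ? F) (v ∈ᵥ? L) (v ∈ᵥ? (F ++ L))) (∑-+ n _ _)
    where
    bits : ∀ v (d : Dec (v ∈ᵥ F)) (e : Dec (v ∈ᵥ L)) (f : Dec (v ∈ᵥ F ++ L)) → ind f ≡ ind d + ind e * ind (¬? d)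
    bits v (yes p) (yes _) f = ind-yes f (∈ᵥ-mono ∈-++⁺ˡ p)
    bits v (yes p) (no _)  f = ind-yes f (∈ᵥ-mono ∈-++⁺ˡ p)
    bits v (no _)  (yes q) f = ind-yes f (∈ᵥ-mono (∈-++⁺ʳ F) q)
    bits v (no ¬p) (no ¬q) f = ind-no f λ r → let x , x∈ , e = ∈ᵥ-elim r in
      [ (λ y → ¬p (∈ᵥ-intro y e)) , (λ y → ¬q (∈ᵥ-intro y e)) ]′ (∈-++⁻ F x∈)

  module _ {c} (T : Tree c) (T⊑S : nodes T ⊑ S) (size≡7 : size T ≡ 7)
           (14≤cnt : 14 ≤ cnt (nodes T)) (10≤fresh : 10 ≤ wt fresh (nodes T)) where

    private
      P K : List Chord
      P = nodes T
      -- An improving set must avoid `F`; chords of the tree that are already in `F` change neither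
      -- the union nor its vertices.
      K = P ∖ F

      ∈K⁻ : ∀ {x} → x ∈ K → x ∈ P × ¬ x ∈ F
      ∈K⁻ = ∈-filter⁻ (λ x → ¬? (x ∈? F)) {xs = P}

      FK⊑FP : F ++ K ⊑ F ++ P
      FK⊑FP x∈ = [ ∈-++⁺ˡ , ∈-++⁺ʳ F ∘ proj₁ ∘ ∈K⁻ ]′ (∈-++⁻ F x∈)

      FP⊑FK : F ++ P ⊑ F ++ K
      FP⊑FK = ++-⊑-++∖ F P

      chP : Chords P
      chP = chS ∘ T⊑S
      chFP : Chords (F ++ P)
      chFP x∈ = [ chF , chP ]′ (∈-++⁻ F x∈)
      chFK : Chords (F ++ K)
      chFK = chFP ∘ FK⊑FP

      sfFK : SingletonFree (F ++ K)
      sfFK = All.tabulate λ x∈ → move (crossed (FK⊑FP x∈))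
        where
        move : ∀ {x} → Any (Cross x) (F ++ P) → Any (Cross x) (F ++ K)
        move t = let y , y∈ , cr = find t in lose (FP⊑FK y∈) cr
        crossed : ∀ {x} → x ∈ F ++ P → Any (Cross x) (F ++ P)
        crossed x∈ with ∈-++⁻ F x∈
        ... | inj₁ p = any-++ˡ (All.lookup sfF p)
        ... | inj₂ p = any-++ʳ F (tree-crossed T (≤-trans (s≤s (s≤s z≤n)) (≤-reflexive (sym size≡7))) p)

      f = ∣ F ∣
      f′ = ∣ F ++ K ∣
      r = ρ (𝓛 F)
      r′ = ρ (𝓛 (F ++ K))
      m = newVertices F K

      m≡fresh : m ≡ wt fresh P
      m≡fresh = +-cancelʳ-≡ (cnt F) m (wt fresh P) (trans (newVertices+cnt F K (chords-inRange chFK))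
        (trans (≤-antisym (cnt-mono (∈ᵥ-mono FK⊑FP)) (cnt-mono (∈ᵥ-mono FP⊑FK))) (trans (cnt-++-fresh P) (+-comm (cnt F) _))))

      10≤m : 10 ≤ m
      10≤m = subst (10 ≤_) (sym m≡fresh) 10≤fresh

      f′≤ : f′ ≤ f + 7
      f′≤ = ≤-trans (∣∣≤length {F ++ K} {deduplicate _≟ᶜ_ F ++ P}
               (λ x∈ → [ ∈-++⁺ˡ ∘ ∈-deduplicate⁺ _≟ᶜ_ , ∈-++⁺ʳ (deduplicate _≟ᶜ_ F) ]′ (∈-++⁻ F (FK⊑FP x∈))))
             (≤-reflexive (trans (length-++ (deduplicate _≟ᶜ_ F)) (cong (λ s → f + s) size≡7)))

      K≢[] : ¬ K ≡ []
      K≢[] e = contradiction (≤-trans 10≤m (+-cancelʳ-≤ (cnt F) m 0 (≤-trans (≤-reflexive (newVertices+cnt F K (chords-inRange chFK)))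
        (cnt-mono (∈ᵥ-mono (λ x∈ → [ id , (λ y∈ → ⊥-elim (none (subst (_ ∈_) e y∈))) ]′ (∈-++⁻ F x∈))))))) λ ()
        where
        none : ∀ {x : Chord} → ¬ x ∈ []
        none ()

      improving : 3 * m + (11 * f′ + 11 * r) ≤ 11 * r′ + 11 * f → ⊥
      improving h = proj₂ (proj₂ crit) K
        ( K≢[]
        , All.tabulate (λ x∈ → T⊑S (proj₁ (∈K⁻ x∈)) , proj₂ (∈K⁻ x∈))
        , ≤-trans (∣∣≤length {K} {P} (proj₁ ∘ ∈K⁻)) (≤-trans (≤-reflexive size≡7) (≤-trans (m≤m+n 7 2) 9≤N))
        , sfFK
        , subst (λ z → ℤtoℚ z ℚ.≥ (ℚ.1ℚ ℚ.- (ℤ.+ 8 / 11)) ℚ.* ℕtoℚ m)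
            (sym (cong₂ ℤ._-_ (U≡ chFK sfFK) (U≡ chF sfF))) (accept⁺ f r f′ r′ m h) )

      -- Times 11, the seven chords cost at most 77 and the vertices require 3m of the gain 11m; 8m
      -- ≥ 80 leaves enough.
      attached : r + m ≤ r′ → ⊥
      attached h = improving (begin
        3 * m + (11 * f′ + 11 * r)             ≤⟨ +-monoʳ-≤ (3 * m) (+-monoˡ-≤ (11 * r) (*-monoʳ-≤ 11 f′≤)) ⟩
        3 * m + (11 * (f + 7) + 11 * r)        ≡⟨ eq₁ m f r ⟩
        77 + (3 * m + (11 * f + 11 * r))       ≤⟨ +-monoˡ-≤ _ (≤-trans (m≤m+n 77 3) (*-monoʳ-≤ 8 10≤m)) ⟩
        8 * m + (3 * m + (11 * f + 11 * r))    ≡⟨ eq₂ m f r ⟩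
        11 * (r + m) + 11 * f                  ≤⟨ +-monoˡ-≤ (11 * f) (*-monoʳ-≤ 11 h) ⟩
        11 * r′ + 11 * f                       ∎)
        where
        open ≤-Reasoning
        eq₁ : ∀ m f r → 3 * m + (11 * (f + 7) + 11 * r) ≡ 77 + (3 * m + (11 * f + 11 * r))
        eq₁ = solve-∀
        eq₂ : ∀ m f r → 8 * m + (3 * m + (11 * f + 11 * r)) ≡ 11 * (r + m) + 11 * f
        eq₂ = solve-∀

      -- A new component with 14 vertices gains 11. Times 11 this is 121, against 77 for the chords
      -- and at most 3 · 14 = 42 for the vertices.
      detached : 11 + r ≤ r′ → ⊥
      detached h = improving (begin
        3 * m + (11 * f′ + 11 * r)             ≤⟨ +-mono-≤ (*-monoʳ-≤ 3 m≤14) (+-monoˡ-≤ (11 * r) (*-monoʳ-≤ 11 f′≤)) ⟩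
        42 + (11 * (f + 7) + 11 * r)           ≡⟨ eq₁ f r ⟩
        119 + (11 * r + 11 * f)                ≤⟨ +-monoˡ-≤ _ (m≤m+n 119 2) ⟩
        121 + (11 * r + 11 * f)                ≡⟨ eq₂ f r ⟩
        11 * (11 + r) + 11 * f                 ≤⟨ +-monoˡ-≤ (11 * f) (*-monoʳ-≤ 11 h) ⟩
        11 * r′ + 11 * f                       ∎)
        where
        open ≤-Reasoning
        eq₁ : ∀ f r → 42 + (11 * (f + 7) + 11 * r) ≡ 119 + (11 * r + 11 * f)
        eq₁ = solve-∀
        eq₂ : ∀ f r → 121 + (11 * r + 11 * f) ≡ 11 * (11 + r) + 11 * f
        eq₂ = solve-∀
        m≤14 : m ≤ 14
        m≤14 = ≤-trans (≤-reflexive m≡fresh) (≤-trans (wt≤length fresh (λ v → ind≤1 (¬? (v ∈ᵥ? F))) P)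
                 (≤-reflexive (cong (λ s → 2 * 1 * s) size≡7)))

      absorb : Any (Touching F) P → r + m ≤ r′
      absorb t = +-cancelʳ-≤ (cnt F) (r + m) r′ (begin
        r + m + cnt F              ≡⟨ +-assoc r m (cnt F) ⟩
        r + (m + cnt F)            ≡⟨ cong (λ s → r + s) (newVertices+cnt F K (chords-inRange chFK)) ⟩
        r + cnt (F ++ K)           ≤⟨ +-monoʳ-≤ r (cnt-mono (∈ᵥ-mono (FP⊑A ∘ FK⊑FP))) ⟩
        r + cnt A′                 ≤⟨ gain ⟩
        ρ Js′ + cnt F              ≤⟨ +-monoˡ-≤ (cnt F) (ρ-unique sys′ (𝓛-sys (F ++ K)) (FP⊑FK ∘ ⊑AL) (FP⊑A ∘ FK⊑FP)) ⟩
        r′ + cnt F                 ∎)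
        where
        open ≤-Reasoning
        open Absorbed (absorb-tree T chP (𝓛-sys F) chF sfF t)
        FP⊑A : F ++ P ⊑ A′
        FP⊑A x∈ = [ A⊑ , L⊑ ]′ (∈-++⁻ F x∈)

      -- Without contact to `F` the tree is a component of its own next to the old ones, even if it
      -- shares vertices with them; it contributes at least 14 - 3.
      separate : ¬ Any (Touching F) P → 11 + r ≤ r′
      separate none = ≤-trans (+-monoˡ-≤ r (∸-monoˡ-≤ 3 14≤cnt))
        (ρ-unique sys⁺ (𝓛-sys (F ++ K)) FP⊑FK FK⊑FP)
        where
        open Sys (𝓛-sys F)
        no-cross : ∀ {x y} → x ∈ P → y ∈ F → ¬ Cross x y
        no-cross x∈ y∈ cr = none (lose x∈ (inj₂ (lose y∈ cr)))
        sys⁺ : Sys (F ++ P) (P ∷ 𝓛 F)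
        sys⁺ = record
          { conn     = λ { (here refl) → tree-conn T ; (there J∈) → conn J∈ }
          ; nonempty = λ { (here refl) → c , root∈ T ; (there J∈) → nonempty J∈ }
          ; sub      = λ { (here refl) → ∈-++⁺ʳ F ; (there J∈) → ∈-++⁺ˡ ∘ sub J∈ }
          ; closed   = λ { (here refl) x∈ y∈ cr → [ (λ q → contradiction cr (no-cross x∈ q)) , id ]′ (∈-++⁻ F y∈)
                         ; (there J∈) x∈ y∈ cr → [ (λ q → closed J∈ x∈ q cr) , (λ q → contradiction (Cross-sym cr) (no-cross q (sub J∈ x∈))) ]′ (∈-++⁻ F y∈) }
          ; cover    = λ x∈ → [ (λ q → let J , J∈ , p = cover q in J , there J∈ , p) , (λ q → P , here refl , q) ]′ (∈-++⁻ F x∈)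
          ; disjoint = All.tabulate (λ J∈ x∈P x∈J → none (lose x∈P (inj₁ (sub J∈ x∈J)))) ∷ disjoint
          }

    spread-tree-improves : ⊥
    spread-tree-improves with Any.any? (Touching? F) P
    ... | yes t = attached (absorb t)
    ... | no ¬t = detached (separate ¬t)

  seven-node-bound : ∀ {c} (T : Tree c) → nodes T ⊑ S → size T ≡ 7 → wt weight (nodes T) ≤ wt weight [ c ] + 1353
  seven-node-bound {c} T T⊑S size≡7 = subst₂ (λ a b → a ≤ b + 1353) (sym (wt-weight (nodes T))) (sym (wt-weight [ c ]))
    (decidable-stable (88 * cnt (nodes T) + 33 * wt fresh (nodes T) ≤? 88 * cnt [ c ] + 33 * wt fresh [ c ] + 1353) λ heavy →
      spread-tree-improves T T⊑S size≡7
        -- The 14 vertices are the two ends of the root and the 12 others.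
        (≤-trans (+-monoʳ-≤ 12 2≤cnt-c) (all-distinct fresh-bound heavy))
        (≤-trans (m≤m+n 10 _) (many-new {b = wt fresh [ c ]} cnt-bound heavy)))
    where
    rest = proj₁ (nodes-root T)
    eq : nodes T ≡ c ∷ rest
    eq = proj₂ (nodes-root T)
    length-rest : length rest ≡ 6
    length-rest = suc-injective (trans (cong length (sym eq)) size≡7)
    c-chord : IsChord n c
    c-chord = chS (T⊑S (root∈ T))
    2≤cnt-c : 2 ≤ cnt [ c ]
    2≤cnt-c = ≤-trans (≤-reflexive (sym (trans (∑-+ n _ _) (cong₂ _+_ (∑-≟ n (inR (inj₁ refl))) (∑-≟ n (inR (inj₂ refl)))))))
      (∑-mono n λ v _ → bits v (v ≟ proj₁ c) (v ≟ proj₂ c) (v ∈ᵥ? [ c ]))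
      where
      inR : ∀ {v} → End v c → InRange n v
      inR e = chords-inRange (λ { (here refl) → c-chord }) (here {xs = []} e)
      bits : ∀ v (d : Dec (v ≡ proj₁ c)) (e : Dec (v ≡ proj₂ c)) (f : Dec (v ∈ᵥ [ c ])) → ind d + ind e ≤ ind f
      bits v (yes refl) (yes p) f = contradiction p (<⇒≢ (proj₁ (proj₂ c-chord)))
      bits v (yes p)    (no _)  f = ≤-reflexive (sym (ind-yes f (here (inj₁ p))))
      bits v (no _)     (yes p) f = ≤-reflexive (sym (ind-yes f (here (inj₂ p))))
      bits v (no _)     (no _)  f = z≤n
    cnt-bound : cnt (nodes T) ≤ 12 + cnt [ c ]
    cnt-bound = begin
      cnt (nodes T)           ≡⟨ cong cnt eq ⟩
      cnt (c ∷ rest)          ≤⟨ ∑-mono n (λ v _ → bits v (v ∈ᵥ? (c ∷ rest)) (v ∈ᵥ? rest) (v ∈ᵥ? [ c ])) ⟩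
      ∑ n (λ v → ind (v ∈ᵥ? rest) + ind (v ∈ᵥ? [ c ])) ≡⟨ ∑-+ n _ _ ⟩
      cnt rest + cnt [ c ]    ≤⟨ +-monoˡ-≤ (cnt [ c ]) (≤-trans (≤-reflexive (cnt≡wt rest)) (≤-trans (wt≤length (λ _ → 1) (λ _ → ≤-refl) rest) (≤-reflexive (cong (λ s → 2 * 1 * s) length-rest)))) ⟩
      12 + cnt [ c ]          ∎
      where
      open ≤-Reasoning
      bits : ∀ v (d : Dec (v ∈ᵥ c ∷ rest)) (e : Dec (v ∈ᵥ rest)) (f : Dec (v ∈ᵥ [ c ])) → ind d ≤ ind e + ind f
      bits v (no _)          e f = z≤n
      bits v (yes (here p))  e f = ≤-trans (≤-reflexive (sym (ind-yes f (here p)))) (m≤n+m (ind f) (ind e))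
      bits v (yes (there p)) e f = ≤-trans (≤-reflexive (sym (ind-yes e p))) (m≤m+n (ind e) (ind f))
    fresh-bound : wt fresh (nodes T) + cnt [ c ] ≤ wt fresh [ c ] + cnt (nodes T)
    fresh-bound = subst₂ _≤_ (∑-+ n _ _) (∑-+ n _ _) (∑-mono n λ v _ → bits v (v ∈ᵥ? nodes T) (v ∈ᵥ? [ c ]))
      where
      bits : ∀ v (d : Dec (v ∈ᵥ nodes T)) (e : Dec (v ∈ᵥ [ c ])) → ind d * fresh v + ind e ≤ ind e * fresh v + ind d
      bits v (yes _) (yes _)        = ≤-refl
      bits v (no ¬q) (yes (here p)) = contradiction (∈ᵥ-intro (root∈ T) p) ¬q
      bits v (no _)  (no _)         = z≤n
      bits v (yes _) (no _)         = ≤-trans (≤-reflexive (trans (+-identityʳ _) (+-identityʳ _))) (ind≤1 (¬? (v ∈ᵥ? F)))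

  -- Pruning j nodes down to seven costs 242 j, which exceeds 233 j by 9j, while the seven-node
  -- bound saves 6 · 233 - 1353 = 45. The saving covers j ≤ 5, with equality at 12 nodes.
  peel : ∀ {c} (T : Tree c) → nodes T ⊑ S → 7 ≤ size T → size T ≤ 12 →
         wt weight (nodes T) + 233 ≤ wt weight [ c ] + 233 * size T
  peel {c} T T⊑S 7≤ ≤12 = conclude (prune-to weight weight≤121 j 6 T (sym (m∸n+n≡m 7≤)))
    where
    j = size T ∸ 7
    open ≤-Reasoning
    eq₁ : ∀ j x → 242 * j + (x + 1353) + 233 ≡ x + 233 * j + (9 * j + 1586)
    eq₁ = solve-∀
    eq₂ : ∀ j x → x + 233 * j + (9 * 5 + 1586) ≡ x + 233 * (j + 7)
    eq₂ = solve-∀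
    conclude : (∃ λ (T′ : Tree c) → size T′ ≡ 7 × nodes T′ ⊑ nodes T × wt weight (nodes T) ≤ 242 * j + wt weight (nodes T′)) →
               wt weight (nodes T) + 233 ≤ wt weight [ c ] + 233 * size T
    conclude (T′ , size≡7 , s , b) = begin
      wt weight (nodes T) + 233                         ≤⟨ +-monoˡ-≤ 233 (≤-trans b (+-monoʳ-≤ (242 * j) (seven-node-bound T′ (T⊑S ∘ s) size≡7))) ⟩
      242 * j + (wt weight [ c ] + 1353) + 233          ≡⟨ eq₁ j (wt weight [ c ]) ⟩
      wt weight [ c ] + 233 * j + (9 * j + 1586)        ≤⟨ +-monoʳ-≤ (wt weight [ c ] + 233 * j) (+-monoˡ-≤ 1586 (*-monoʳ-≤ 9 (∸-monoˡ-≤ 7 ≤12))) ⟩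
      wt weight [ c ] + 233 * j + (9 * 5 + 1586)        ≡⟨ eq₂ j (wt weight [ c ]) ⟩
      wt weight [ c ] + 233 * (j + 7)                   ≡⟨ cong (λ k → wt weight [ c ] + 233 * k) (m∸n+n≡m 7≤) ⟩
      wt weight [ c ] + 233 * size T                    ∎

  -- The weight lost in passing from `T` to `R` is at most 233 per removed node. The root is the
  -- same, so that `R` can replace `T` in a larger tree.
  Residual : ∀ {c} → Tree c → Set
  Residual {c} T = ∃ λ (R : Tree c) → nodes R ⊑ nodes T × size R ≤ 6 ×
                   wt weight (nodes T) + 233 * size R ≤ wt weight (nodes R) + 233 * size T

  -- Peel off bottom-up subtrees with 7 to 12 nodes, keeping their roots.
  residual : ∀ {c} (T : Tree c) → nodes T ⊑ S → Residual T
  residual (leaf c) _ = leaf c , id , s≤s z≤n , ≤-refl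
  residual (join {c} T T′ cr) T⊑S = combine (residual T (T⊑S ∘ ∈-++⁺ˡ)) (residual T′ (T⊑S ∘ ∈-++⁺ʳ (nodes T)))
    where
    open ≤-Reasoning
    ω : List Chord → ℕ
    ω = wt weight
    sum-up : ∀ x a b c d e r s t u → x + (c + d) ≤ e + (a + b) → a + 233 * r ≤ c + 233 * t → b + 233 * s ≤ d + 233 * u →
             x + 233 * (r + s) ≤ e + 233 * (t + u)
    sum-up x a b c d e r s t u h₁ h₂ h₃ = +-cancelʳ-≤ (a + b + (c + d)) _ _ (begin
      x + 233 * (r + s) + (a + b + (c + d))              ≡⟨ lemma₁ x a b c d r s ⟩
      (x + (c + d)) + ((a + 233 * r) + (b + 233 * s))    ≤⟨ +-mono-≤ h₁ (+-mono-≤ h₂ h₃) ⟩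
      (e + (a + b)) + ((c + 233 * t) + (d + 233 * u))    ≡⟨ lemma₂ e a b c d t u ⟩
      e + 233 * (t + u) + (a + b + (c + d))              ∎)
      where
      lemma₁ : ∀ x a b c d r s → x + 233 * (r + s) + (a + b + (c + d)) ≡ (x + (c + d)) + ((a + 233 * r) + (b + 233 * s))
      lemma₁ = solve-∀
      lemma₂ : ∀ e a b c d t u → (e + (a + b)) + ((c + 233 * t) + (d + 233 * u)) ≡ e + 233 * (t + u) + (a + b + (c + d))
      lemma₂ = solve-∀
    combine : Residual T → Residual T′ → Residual (join T T′ cr)
    combine (R , s , R≤6 , b) (R′ , s′ , R′≤6 , b′) = finish (size (join R R′ cr) ≤? 6)
      where
      J = join R R′ cr
      J⊑ : nodes J ⊑ nodes T ++ nodes T′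
      J⊑ x∈ = [ ∈-++⁺ˡ ∘ s , ∈-++⁺ʳ (nodes T) ∘ s′ ]′ (∈-++⁻ (nodes R) x∈)
      bound : ω (nodes T ++ nodes T′) + 233 * size J ≤ ω (nodes J) + 233 * size (join T T′ cr)
      bound = subst₂ (λ a b → ω (nodes T ++ nodes T′) + 233 * a ≤ ω (nodes J) + 233 * b)
        (sym (size-join R R′ cr)) (sym (size-join T T′ cr))
        (sum-up (ω (nodes T ++ nodes T′)) (ω (nodes T)) (ω (nodes T′)) (ω (nodes R)) (ω (nodes R′)) (ω (nodes J))
          (size R) (size R′) (size T) (size T′) (wt-submodular weight s s′) b b′)
      finish : Dec (size J ≤ 6) → Residual (join T T′ cr)
      finish (yes small) = J , J⊑ , small , bound
      -- The joined remainder has 7 to 12 nodes; all of it but the root is peeled off.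
      finish (no large)  = leaf c , (λ { (here refl) → ∈-++⁺ˡ (root∈ T) }) , s≤s z≤n
        , +-cancelʳ-≤ (233 * size J + ω (nodes J)) _ _ (begin
            ω (nodes T ++ nodes T′) + 233 * 1 + (233 * size J + ω (nodes J))     ≡⟨ lemma₁ (ω (nodes T ++ nodes T′)) 233 (233 * size J) (ω (nodes J)) ⟩
            (ω (nodes T ++ nodes T′) + 233 * size J) + (ω (nodes J) + 233)       ≤⟨ +-mono-≤ bound (peel J (T⊑S ∘ J⊑) (≰⇒> large) J≤12) ⟩
            (ω (nodes J) + 233 * size (join T T′ cr)) + (ω [ c ] + 233 * size J) ≡⟨ lemma₂ (ω (nodes J)) (233 * size (join T T′ cr)) (ω [ c ]) (233 * size J) ⟩
            ω [ c ] + 233 * size (join T T′ cr) + (233 * size J + ω (nodes J))   ∎)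
        where
        J≤12 : size J ≤ 12
        J≤12 = ≤-trans (≤-reflexive (size-join R R′ cr)) (+-mono-≤ R≤6 R′≤6)
        lemma₁ : ∀ x k a b → x + k * 1 + (a + b) ≡ (x + a) + (b + k)
        lemma₁ = solve-∀
        lemma₂ : ∀ a b c d → (a + b) + (c + d) ≡ c + b + (d + a)
        lemma₂ = solve-∀

  lower-bound : 4 ≤ n → ∀ {O} → O ⊑ S → Feasible n O → 121 * n ≤ 33 * cnt F + 233 * ∣ O ∣ + 54
  lower-bound 4≤n {O} O⊑S feas =
    let c , T , T⊑O , small , all = spanning-tree 4≤n (chS ∘ O⊑S) (feasible⇒covering (chords-ordered (chS ∘ O⊑S)) feas)
    in via T all small (residual T (O⊑S ∘ T⊑O))
    where
    open ≤-Reasoning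
    via : ∀ {c} (T : Tree c) → (∀ {v} → InRange n v → v ∈ᵥ nodes T) → size T ≤ ∣ O ∣ → Residual T →
          121 * n ≤ 33 * cnt F + 233 * ∣ O ∣ + 54
    via T all small (R , _ , R≤6 , b) = begin
      121 * n                                     ≡⟨ cong (λ k → 121 * k) (sym (∑-1 n)) ⟩
      121 * ∑ n (λ _ → 1)                         ≡⟨ sym (∑-* n 121 (λ _ → 1)) ⟩
      -- The 33 missing from the weight of a vertex of V(F) is added separately.
      ∑ n (λ _ → 121 * 1)                         ≤⟨ ∑-mono n (λ v rv → bits v (v ∈ᵥ? F) (v ∈ᵥ? nodes T) (all rv)) ⟩
      ∑ n (λ v → 33 * ind (v ∈ᵥ? F) + ind (v ∈ᵥ? nodes T) * weight v) ≡⟨ ∑-+ n _ _ ⟩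
      ∑ n (λ v → 33 * ind (v ∈ᵥ? F)) + wt weight (nodes T)            ≡⟨ cong (_+ wt weight (nodes T)) (∑-* n 33 _) ⟩
      33 * cnt F + wt weight (nodes T)            ≤⟨ +-monoʳ-≤ (33 * cnt F) total ⟩
      33 * cnt F + (233 * ∣ O ∣ + 54)             ≡⟨ sym (+-assoc (33 * cnt F) _ 54) ⟩
      33 * cnt F + 233 * ∣ O ∣ + 54               ∎
      where
      bits : ∀ v (d : Dec (v ∈ᵥ F)) (e : Dec (v ∈ᵥ nodes T)) → v ∈ᵥ nodes T → 121 * 1 ≤ 33 * ind d + ind e * (88 + 33 * ind (¬? d))
      bits v (yes _) (yes _) _ = ≤-refl
      bits v (no _)  (yes _) _ = ≤-refl
      bits v _       (no ¬q) q = contradiction q ¬q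
      -- The last remainder is charged 242 per node, 9 too much for each of at most six nodes: 54.
      total : wt weight (nodes T) ≤ 233 * ∣ O ∣ + 54
      total = +-cancelʳ-≤ (233 * size R) _ _ (begin
        wt weight (nodes T) + 233 * size R         ≤⟨ b ⟩
        wt weight (nodes R) + 233 * size T         ≤⟨ +-mono-≤ (wt≤length weight weight≤121 (nodes R)) (*-monoʳ-≤ 233 small) ⟩
        242 * size R + 233 * ∣ O ∣                 ≡⟨ lemma (size R) (233 * ∣ O ∣) ⟩
        233 * ∣ O ∣ + 9 * size R + 233 * size R    ≤⟨ +-monoˡ-≤ (233 * size R) (+-monoʳ-≤ (233 * ∣ O ∣) (*-monoʳ-≤ 9 R≤6)) ⟩
        233 * ∣ O ∣ + 54 + 233 * size R            ∎)
        where
        lemma : ∀ r o → 242 * r + o ≡ o + 9 * r + 233 * r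
        lemma = solve-∀

-- Combination of the two bounds

module _ where

  private
    eq₁ : ∀ A r f x n → 121 * A + 363 + (121 * (r + f + n) + 33 * x) ≡ 121 * (A + r + 3) + 11 * (3 * x + 11 * f) + 121 * n
    eq₁ = solve-∀
    eq₂ : ∀ r f x n m → 121 * (n + f) + 11 * (11 * r) + (33 * x + 233 * m + 54) ≡ 233 * m + 54 + (121 * (r + f + n) + 33 * x)
    eq₂ = solve-∀

  -- The hypotheses are added with factors 121, 11 and 1, after which n, r, f and x cancel. The 3 in
  -- the first becomes 363 and absorbs the error 54.
  combine-bounds : ∀ A r f x n m → A + r + 3 ≤ n + f → 3 * x + 11 * f ≤ 11 * r → 121 * n ≤ 33 * x + 233 * m + 54 →
                   121 * A ≤ 233 * m
  combine-bounds A r f x n m h₁ h₂ h₃ = +-cancelʳ-≤ 54 _ _ (≤-trans (+-monoʳ-≤ (121 * A) (m≤m+n 54 309)) (+-cancelʳ-≤ (121 * (r + f + n) + 33 * x) _ _ (begin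
    121 * A + 363 + (121 * (r + f + n) + 33 * x)                      ≡⟨ eq₁ A r f x n ⟩
    121 * (A + r + 3) + 11 * (3 * x + 11 * f) + 121 * n               ≤⟨ +-mono-≤ (+-mono-≤ (*-monoʳ-≤ 121 h₁) (*-monoʳ-≤ 11 h₂)) h₃ ⟩
    121 * (n + f) + 11 * (11 * r) + (33 * x + 233 * m + 54)           ≡⟨ eq₂ r f x n m ⟩
    233 * m + 54 + (121 * (r + f + n) + 33 * x)                       ∎)))
    where open ≤-Reasoning

  combine-bounds-∅ : ∀ A n m → A + 1 ≤ n → 121 * n ≤ 33 * 0 + 233 * m + 54 → 121 * A ≤ 233 * m
  combine-bounds-∅ A n m h₁ h₂ = +-cancelʳ-≤ 54 _ _ (begin
    121 * A + 54            ≤⟨ +-monoʳ-≤ (121 * A) (m≤m+n 54 67) ⟩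
    121 * A + 121           ≡⟨ sym (*-distribˡ-+ 121 A 1) ⟩
    121 * (A + 1)           ≤⟨ *-monoʳ-≤ 121 h₁ ⟩
    121 * n                 ≤⟨ h₂ ⟩
    233 * m + 54            ∎)
    where open ≤-Reasoning

size-bound : ∀ {n S N Q F O} → 4 ≤ n → Polygon.Chords n S → 9 ≤ N → LocalSearchOutput n S (ℤ.+ 8 / 11) N Q F →
             O ⊑ S → Feasible n O → 121 * ∣ Q ++ F ∣ ≤ 233 * ∣ O ∣
size-bound {n} {S} {N} {Q} {[]} {O} 4≤n chS 9≤N (_ , crit , mc) O⊑S feas =
  combine-bounds-∅ (∣ Q ++ [] ∣) n (∣ O ∣) (Completions.completion-bound-∅ n 4≤n chS (λ ()) mc refl)
    (subst (λ x → 121 * n ≤ 33 * x + 233 * ∣ O ∣ + 54) (∑-0 n) (LowerBound.lower-bound n chS 9≤N crit 4≤n O⊑S feas))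
size-bound {n} {S} {N} {Q} {F@(x ∷ _)} {O} 4≤n chS 9≤N (reach , crit , mc) O⊑S feas =
  combine-bounds (∣ Q ++ F ∣) (Potential.ρ n (𝓛 F)) (∣ F ∣) (Weighted.cnt n F) n (∣ O ∣)
    (Completions.completion-bound n 4≤n chS (All.lookup (proj₁ crit)) mc (proj₁ (proj₂ crit)) (x , here refl))
    (proj₂ (proj₂ (Utility.Reachable-invariant n chS reach)))
    (LowerBound.lower-bound n chS 9≤N crit 4≤n O⊑S feas)

open import Data.Integer using (+_)

theorem2 : (n : ℕ) → 4 ≤ n → (S : List Chord) → IsInstance n S →
    (Nmax : ℕ) → 9 ≤ Nmax →
    (Q F : List Chord) → LocalSearchOutput n S (+ 8 / 11) Nmax Q F →
    Feasible n (Q ++ F) ×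
    ((OPT : List Chord) → IsOPT n S OPT →
    ℚ._≤_ (ℕtoℚ ∣ Q ++ F ∣) ((+ 233 / 121) ℚ.* ℕtoℚ ∣ OPT ∣))
theorem2 n 4≤n S (chords , _) Nmax 9≤Nmax Q F out@(_ , _ , (_ , feasible) , _) =
  feasible-mono (λ x∈ → [ ∈-++⁺ʳ Q , ∈-++⁺ˡ ]′ (∈-++⁻ F x∈)) feasible ,
  λ OPT (OPT⊆S , OPT-feasible , _) →
    ratio-bound (∣ Q ++ F ∣) (∣ OPT ∣) (size-bound 4≤n (All.lookup chords) 9≤Nmax out (All.lookup OPT⊆S) OPT-feasible)
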